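{- Let $a,b,c>1$ be integers with $\gcd(a,b)>1$, and suppose $(a,b,c)\in S_c\cup S_o\cup S_{aa}\cup S_{bb}$. Then $N(a,b,c)=2$, and the equation $a^x+b^y=c^z$ has two distinct solutions $(x_1,y_1,z_1)$ and $(x_2,y_2,z_2)$ such that the nine-tuple $(a,b,c,x_1,y_1,z_1,x_2,y_2,z_2)$ is in one of the infinite families (i), (ii), (iii), or (iv).
   Context: Equation and counting: for integers $a,b,c>1$ consider $a^x+b^y=c^z$ in positive integers $x,y,z$. $N(a,b,c)$ is the number of solutions, where two solutions $(x_1,y_1,z_1)$, $(x_2,y_2,z_2)$ are considered the same if $\{a^{x_1},b^{y_1}\}=\{a^{x_2},b^{y_2}\}$. Two solutions are called distinct if they differ as ordered triples. A solution $(x,y,z)$ for the triple $(a,b,c)$ corresponds to a solution $(X,Y,Z)$ for the triple $(A,B,C)$ (of the same equation with $A,B,C$ in place of $a,b,c$) if $\{a^x,b^y\}=\{A^X,B^Y\}$. Types: when $\gcd(a,b)>1$, let $Q$ be the set of primes dividing all of $a$, $b$, $c$; for $p\in Q$ let $p^{\alpha_p}\parallel a$, $p^{\beta_p}\parallel b$, $p^{\gamma_p}\parallel c$. A solution $(x,y,z)$ is Type A for $p$ if $\alpha_p x>\beta_p y=\gamma_p z$; Type B for $p$ if $\beta_p y>\alpha_p x=\gamma_p z$; Type C for $p$ if $\gamma_p z>\alpha_p x=\beta_p y$; Type O for $p$ if $\alpha_p x=\beta_p y=\gamma_p z$. Sets: $S_c$ is the set of triples $(a,b,c)$ with $\gcd(a,b)>1$,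 $N(a,b,c)>1$, $a,b,c$ not all powers of 2, and some solution that is Type C for some prime in $Q$. $S_o$ is the set of triples with $\gcd(a,b)>1$, $N(a,b,c)>1$, and some solution that is Type O for some prime in $Q$. $S_{aa}$ (resp. $S_{bb}$) is the set of triples with $\gcd(a,b)>1$ such that the equation has two distinct solutions both of which are Type A (resp. Type B) for some (common) prime in $Q$. Infinite families (all parameters are integers; a choice of parameters is allowable when it satisfies the stated constraints and all entries below are positive integers): (i) $(a,b,c)=(2,\,2^u(2^{h-1}-1),\,2^u(2^{h-1}+1))$, $(x_1,y_1,z_1)=(u+1,1,1)$, $(x_2,y_2,z_2)=(2u+h+1,2,2)$, with $u>0$, $h>1$. (ii) $(a,b,c)=(2\cdot 3^t,3,3)$, $(x_1,y_1,z_1)=(1,t,t+1)$, $(x_2,y_2,z_2)=(3,3t,3t+2)$, with $t>0$. (iii) $(a,b,c)=(g^j,\,g^{ju}d,\,g^{ju}(d+1))$, $(x_1,y_1,z_1)=(u,1,1)$, $(x_2,y_2,z_2)=(ku+\frac{w}{j},k,k)$, with $j>0$, $u>0$, $d>0$, $g>1$ odd, $(d+1)^k-d^k=g^w$, $w>0$, $k>1$. (iv) $(a,b,c)=(2^ig^j,\,2^{iu-1}g^{ju}d,\,2^{iu-1}g^{ju}(d+2))$, $(x_1,y_1,z_1)=(u,1,1)$, $(x_2,y_2,z_2)=(ku+\frac{w}{j},k,k)$, with $i>0$, $j>0$, $u>0$, $d>0$ odd, $g>1$ odd, $g^w$ the greatest odd divisor of $(d+2)^k-d^k$, $w>0$,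 $k>0$ even, and $k-v=h-\frac{iw}{j}$ where $2^h\parallel 2d+2$ and $2^v\parallel k$. For each family, let $F$ be the set of all nine-tuples $(a,b,c,x_1,y_1,z_1,x_2,y_2,z_2)$ obtained from allowable parameter choices. If $(x_1,y_1,z_1)$ and $(x_2,y_2,z_2)$ are distinct solutions for $(a,b,c)$, the nine-tuple $(a,b,c,x_1,y_1,z_1,x_2,y_2,z_2)$ is said to be in that family if there is $(A,B,C,X_1,Y_1,Z_1,X_2,Y_2,Z_2)\in F$ such that each of the solutions $(X_1,Y_1,Z_1)$, $(X_2,Y_2,Z_2)$ for $(A,B,C)$ corresponds to one of the solutions $(x_1,y_1,z_1)$, $(x_2,y_2,z_2)$ for $(a,b,c)$. -}

module Defs where

open import Data.Nat using (ℕ; zero; suc; _+_; _*_; _∸_; _^_; _≤_; _<_)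
open import Data.Nat.Divisibility using (_∣_)
open import Data.Nat.GCD using (gcd)
open import Data.Nat.Primality using (Prime)
open import Data.Fin using (Fin)
open import Data.Vec using (Vec; lookup)
open import Data.Product using (Σ; ∃; ∃-syntax; _×_; _,_)
open import Data.Sum using (_⊎_)
open import Relation.Nullary using (¬_)
open import Relation.Binary.PropositionalEquality using (_≡_; _≢_)

Triple : Set
Triple = ℕ × ℕ × ℕ

Sol : ℕ → ℕ → ℕ → Triple → Set
Sol a b c (x , y , z) = 1 ≤ x × 1 ≤ y × 1 ≤ z × a ^ x + b ^ y ≡ c ^ z

PairSetEq : ℕ → ℕ → ℕ → ℕ → Set
PairSetEq p q r s = (p ≡ r × q ≡ s) ⊎ (p ≡ s × q ≡ r)

Corr : ℕ → ℕ → ℕ → Triple → ℕ → ℕ → ℕ → Triple → Set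
Corr a b c (x , y , z) A B C (X , Y , Z) = PairSetEq (a ^ x) (b ^ y) (A ^ X) (B ^ Y)

SameSol : ℕ → ℕ → ℕ → Triple → Triple → Set
SameSol a b c s t = Corr a b c s a b c t

NEq : ℕ → ℕ → ℕ → ℕ → Set
NEq a b c n = Σ (Vec Triple n) λ v →
    ((i : Fin n) → Sol a b c (lookup v i))
  × ((i j : Fin n) → i ≢ j → ¬ SameSol a b c (lookup v i) (lookup v j))
  × ((s : Triple) → Sol a b c s → ∃[ i ] SameSol a b c s (lookup v i))

NGt1 : ℕ → ℕ → ℕ → Set
NGt1 a b c = ∃[ s ] ∃[ t ] (Sol a b c s × Sol a b c t × ¬ SameSol a b c s t)

ExactPow : ℕ → ℕ → ℕ → Set
ExactPow p k n = p ^ k ∣ n × ¬ (p ^ suc k ∣ n)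

InQ : ℕ → ℕ → ℕ → ℕ → Set
InQ a b c p = Prime p × p ∣ a × p ∣ b × p ∣ c

WithVals : ℕ → ℕ → ℕ → ℕ → (ℕ → ℕ → ℕ → Set) → Set
WithVals a b c p P = ∃[ α ] ∃[ β ] ∃[ γ ]
  (ExactPow p α a × ExactPow p β b × ExactPow p γ c × P α β γ)

TypeA TypeB TypeC TypeO : ℕ → ℕ → ℕ → ℕ → Triple → Set
TypeA a b c p (x , y , z) = WithVals a b c p λ α β γ → β * y < α * x × β * y ≡ γ * z
TypeB a b c p (x , y , z) = WithVals a b c p λ α β γ → α * x < β * y × α * x ≡ γ * z
TypeC a b c p (x , y , z) = WithVals a b c p λ α β γ → α * x < γ * z × α * x ≡ β * y
TypeO a b c p (x , y , z) = WithVals a b c p λ α β γ → α * x ≡ β * y × β * y ≡ γ * z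

IsPow2 : ℕ → Set
IsPow2 n = ∃[ k ] n ≡ 2 ^ k

Sc : ℕ → ℕ → ℕ → Set
Sc a b c = 1 < gcd a b × NGt1 a b c × ¬ (IsPow2 a × IsPow2 b × IsPow2 c)
  × ∃[ s ] ∃[ p ] (Sol a b c s × InQ a b c p × TypeC a b c p s)

So : ℕ → ℕ → ℕ → Set
So a b c = 1 < gcd a b × NGt1 a b c
  × ∃[ s ] ∃[ p ] (Sol a b c s × InQ a b c p × TypeO a b c p s)

Saa : ℕ → ℕ → ℕ → Set
Saa a b c = 1 < gcd a b × ∃[ s ] ∃[ t ] ∃[ p ]
  (Sol a b c s × Sol a b c t × s ≢ t × InQ a b c p × TypeA a b c p s × TypeA a b c p t)

Sbb : ℕ → ℕ → ℕ → Set
Sbb a b c = 1 < gcd a b × ∃[ s ] ∃[ t ] ∃[ p ]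
  (Sol a b c s × Sol a b c t × s ≢ t × InQ a b c p × TypeB a b c p s × TypeB a b c p t)

Odd : ℕ → Set
Odd n = ¬ (2 ∣ n)

Nine : Set
Nine = (ℕ × ℕ × ℕ) × Triple × Triple

FamI : Nine → Set
FamI ((A , B , C) , s1 , s2) = ∃[ u ] ∃[ h ] (0 < u × 1 < h ×
  A ≡ 2 × B ≡ 2 ^ u * (2 ^ (h ∸ 1) ∸ 1) × C ≡ 2 ^ u * (2 ^ (h ∸ 1) + 1) ×
  s1 ≡ (u + 1 , 1 , 1) × s2 ≡ (2 * u + h + 1 , 2 , 2))

FamII : Nine → Set
FamII ((A , B , C) , s1 , s2) = ∃[ t ] (0 < t ×
  A ≡ 2 * 3 ^ t × B ≡ 3 × C ≡ 3 ×
  s1 ≡ (1 , t , t + 1) × s2 ≡ (3 , 3 * t , 3 * t + 2))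

-- w / j is required to be an integer q (w = j * q) so that x₂ is an integer
FamIII : Nine → Set
FamIII ((A , B , C) , s1 , s2) = ∃[ j ] ∃[ u ] ∃[ d ] ∃[ g ] ∃[ k ] ∃[ w ] ∃[ q ] (
  0 < j × 0 < u × 0 < d × 1 < g × Odd g ×
  (d + 1) ^ k ≡ d ^ k + g ^ w × 0 < w × 1 < k × w ≡ j * q ×
  A ≡ g ^ j × B ≡ g ^ (j * u) * d × C ≡ g ^ (j * u) * (d + 1) ×
  s1 ≡ (u , 1 , 1) × s2 ≡ (k * u + q , k , k))

-- g^w is the greatest odd divisor of (d+2)^k - d^k : (d+2)^k - d^k = 2^e g^w
-- (g^w is odd since g is odd).  The integer condition k - v = h - i w / j is
-- written (with w = j q) as k + i q = h + v.
FamIV : Nine → Set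
FamIV ((A , B , C) , s1 , s2) =
  ∃[ i ] ∃[ j ] ∃[ u ] ∃[ d ] ∃[ g ] ∃[ k ] ∃[ w ] ∃[ q ] ∃[ e ] ∃[ h ] ∃[ v ] (
  0 < i × 0 < j × 0 < u × 0 < d × Odd d × 1 < g × Odd g ×
  (d + 2) ^ k ≡ d ^ k + 2 ^ e * g ^ w × 0 < w × 0 < k × 2 ∣ k ×
  ExactPow 2 h (2 * d + 2) × ExactPow 2 v k × w ≡ j * q × k + i * q ≡ h + v ×
  A ≡ 2 ^ i * g ^ j × B ≡ 2 ^ (i * u ∸ 1) * g ^ (j * u) * d ×
  C ≡ 2 ^ (i * u ∸ 1) * g ^ (j * u) * (d + 2) ×
  s1 ≡ (u , 1 , 1) × s2 ≡ (k * u + q , k , k))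

InFamily : (Nine → Set) → ℕ → ℕ → ℕ → Triple → Triple → Set
InFamily Fam a b c s1 s2 = ∃[ A ] ∃[ B ] ∃[ C ] ∃[ S1 ] ∃[ S2 ] (
  Fam ((A , B , C) , S1 , S2) ×
  (Corr A B C S1 a b c s1 ⊎ Corr A B C S1 a b c s2) ×
  (Corr A B C S2 a b c s1 ⊎ Corr A B C S2 a b c s2))

{-# OPTIONS --safe #-}
-- Fix a prime p dividing a, b and c.  In a solution the minimum of the p-adic valuations of a^x, b^y, c^z is attained
-- twice, so two solutions sharing a type at p have two proportional exponents.  A comparison of p-free parts shows that
-- the strict type C never coexists with type A, B or O.
--
-- If (y, z) is proportional, both solutions read C^n - B^n = a^x and C^m - B^m = a^x' with n, m coprime.  Dividing by
-- gcd(B, C)^n and comparing sizes, every prime of (C^n - B^n)/(C - B) divides (C^m - B^m)/(C - B); these quotients are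
-- coprime, so n = 1, and lifting the exponent bounds the reduced gap C - B by 2.  Gap 1 gives family (iii), gap 2
-- gives (iv), or (i) when a is a power of 2.  If (x, y) is proportional, the same argument for A^n + B^n and lifting the
-- exponent leave only 2 + 1 = 3 and 8 + 1 = 9, which is family (ii), or powers of 2.
--
-- A third solution of the same type would start a second pair whose gap exceeds 2.  A third solution of type B is
-- compared with the first one at an odd prime of a, where the first is of type O; if a is a power of 2 it gives
-- (2^r + 1)^z = 1 + 2^t (2^r - 1)^y, excluded by lifting the exponent unless r = 1, where it is a swap of a known one.

module Submission where

open import Defs
open import Data.Empty using (⊥; ⊥-elim)
open import Data.Fin using (Fin)
open import Data.List using ([]; _∷_)
open import Data.List.Relation.Unary.All using (All; []; _∷_)
open import Data.Nat using (ℕ; zero; suc; _+_; _*_; _∸_; _^_; _≤_; _<_; z≤n; s≤s; NonZero; >-nonZero; _<?_; _≤?_)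
open import Data.Nat.Coprimality using (Coprime; coprime-Bézout; coprime-divisor; coprime⇒gcd≡1; gcd≡1⇒coprime)
open import Data.Nat.Divisibility
open import Data.Nat.GCD using (gcd; gcd[m,n]∣m; gcd[m,n]∣n; gcd-comm; c*gcd[m,n]≡gcd[cm,cn]; module Bézout)
open import Data.Nat.ListAction using (product)
open import Data.Nat.Primality using (Prime; euclidsLemma; prime[2]; prime⇒irreducible; prime⇒nonZero; ¬prime[1])
open import Data.Nat.Primality.Factorisation using (factorise)
open import Data.Nat.Properties
open import Data.Nat.Tactic.RingSolver using (solve-∀)
open import Data.Product using (∃-syntax; _×_; _,_; proj₁; proj₂)
open import Data.Sum using (_⊎_; inj₁; inj₂)
open import Data.Vec using (lookup; _∷_; [])
open import Relation.Nullary using (¬_; Dec; yes; no)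
open import Relation.Binary.Definitions using (tri<; tri≈; tri>)
open import Relation.Binary.PropositionalEquality using (_≡_; _≢_; refl; sym; trans; cong; cong₂; subst; subst₂; module ≡-Reasoning)

-- Proportional exponents come only from a shared type, so the choice of prime decides whether a
-- third solution can be compared with a known pair. An odd prime of `a` divides none of `d`, `δ`,
-- `d + δ` in the normal form `Lifted`; the smaller solution then has types A and B at once, and a
-- third solution of either type is proportional to it. At 2 with gap 2 the term `a ^ x` has one
-- factor 2 more than the other two terms. That single factor destroys the comparison with type B
-- and is the reason for the separate exponential equation. Solutions are counted by their unordered
-- pair of terms, so a third triple need not be absurd: it may be a known solution with its terms
-- exchanged. The uniqueness lemmas therefore conclude `SameSol` where a contradiction might be
-- expected. Lifting the exponent enters as one divisibility, from `K ∣ M * S X Y n` to `K ∣ M * n`.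
-- This form needs neither subtraction nor valuations and bounds sizes directly.

-- Cancellation, positivity and monotonicity of products and powers

cancelˡ : ∀ {o m n} → 0 < o → o * m ≡ o * n → m ≡ n
cancelˡ {o} {m} {n} o>0 = *-cancelˡ-≡ m n o {{>-nonZero o>0}}

cancelʳ : ∀ {o m n} → 0 < o → m * o ≡ n * o → m ≡ n
cancelʳ {o} {m} {n} o>0 = *-cancelʳ-≡ m n o {{>-nonZero o>0}}

^-pos : ∀ {m} n → 0 < m → 0 < m ^ n
^-pos {m} n m>0 = m^n>0 m {{>-nonZero m>0}} n

*-pos : ∀ {m n} → 0 < m → 0 < n → 0 < m * n
*-pos m>0 n>0 = *-mono-≤ m>0 n>0

*-pos⁻¹ˡ : ∀ {m n} → 0 < m * n → 0 < m
*-pos⁻¹ˡ {suc m} _ = s≤s z≤n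

*-pos⁻¹ʳ : ∀ m {n} → 0 < m * n → 0 < n
*-pos⁻¹ʳ m {zero} h = subst (0 <_) (*-zeroʳ m) h
*-pos⁻¹ʳ m {suc n} _ = s≤s z≤n

∣-≤ : ∀ {m n} → 0 < n → m ∣ n → m ≤ n
∣-≤ n>0 = ∣⇒≤ {{>-nonZero n>0}}

n<2^n : ∀ n → n < 2 ^ n
n<2^n zero = s≤s z≤n
n<2^n (suc n) = begin-strict
  suc n           ≤⟨ n<2^n n ⟩
  2 ^ n           <⟨ m<m+n (2 ^ n) (^-pos n (s≤s z≤n)) ⟩
  2 ^ n + 2 ^ n   ≡⟨ cong (2 ^ n +_) (sym (+-identityʳ (2 ^ n))) ⟩
  2 ^ suc n       ∎
  where open ≤-Reasoning

^-distribʳ-* : ∀ n x y → (x * y) ^ n ≡ x ^ n * y ^ n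
^-distribʳ-* zero x y = refl
^-distribʳ-* (suc n) x y = trans (cong (x * y *_) (^-distribʳ-* n x y)) (shuffle x y (x ^ n) (y ^ n))
  where
  shuffle : ∀ a b c d → a * b * (c * d) ≡ a * c * (b * d)
  shuffle = solve-∀

^-^-comm : ∀ x m n → (x ^ m) ^ n ≡ (x ^ n) ^ m
^-^-comm x m n = trans (^-*-assoc x m n) (trans (cong (x ^_) (*-comm m n)) (sym (^-*-assoc x n m)))

^-cancelʳ-< : ∀ {m} → 0 < m → ∀ {i j} → m ^ i < m ^ j → i < j
^-cancelʳ-< {m} m>0 {i} {j} h with i <? j
... | yes p = p
... | no p = ⊥-elim (<⇒≱ h (^-monoʳ-≤ m {{>-nonZero m>0}} (≮⇒≥ p)))

^-cancelʳ-≡ : ∀ {m} → 1 < m → ∀ {i j} → m ^ i ≡ m ^ j → i ≡ j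
^-cancelʳ-≡ {m} m>1 {i} {j} h with <-cmp i j
... | tri< p _ _ = ⊥-elim (<⇒≢ (^-monoʳ-< m m>1 p) h)
... | tri≈ _ p _ = p
... | tri> _ _ p = ⊥-elim (<⇒≢ (^-monoʳ-< m m>1 p) (sym h))

^-cancelˡ-≤ : ∀ n {x y} → 0 < n → x ^ n ≤ y ^ n → x ≤ y
^-cancelˡ-≤ n {x} {y} n>0 h with x ≤? y
... | yes p = p
... | no p = ⊥-elim (<⇒≱ (^-monoˡ-< n {{>-nonZero n>0}} (≰⇒> p)) h)

^-cancelˡ-< : ∀ n {x y} → x ^ n < y ^ n → x < y
^-cancelˡ-< n {x} {y} h with x <? y
... | yes p = p
... | no p = ⊥-elim (<⇒≱ h (^-monoˡ-≤ n (≮⇒≥ p)))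

^-cancelˡ-≡ : ∀ n {x y} → 0 < n → x ^ n ≡ y ^ n → x ≡ y
^-cancelˡ-≡ n n>0 h = ≤-antisym (^-cancelˡ-≤ n n>0 (≤-reflexive h)) (^-cancelˡ-≤ n n>0 (≤-reflexive (sym h)))

base<^ : ∀ {m n} → 1 < m → 1 < n → m < m ^ n
base<^ {m} {n} m>1 n>1 = subst (_< m ^ n) (*-identityʳ m) (^-monoʳ-< m m>1 n>1)

1<^ : ∀ {m n} → 1 < m → 0 < n → 1 < m ^ n
1<^ {m} {n} m>1 n>0 = ^-monoʳ-< m m>1 n>0

base∣^ : ∀ m {n} → 0 < n → m ∣ m ^ n
base∣^ m {suc n} _ = m∣m*n (m ^ n)

^-monoʳ-∣ : ∀ m {i j} → i ≤ j → m ^ i ∣ m ^ j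
^-monoʳ-∣ m {i} {j} i≤j = divides (m ^ (j ∸ i)) (trans (cong (m ^_) (sym (m∸n+n≡m i≤j))) (^-distribˡ-+-* m (j ∸ i) i))

^-monoˡ-∣ : ∀ {x y} n → x ∣ y → x ^ n ∣ y ^ n
^-monoˡ-∣ zero d = ∣-refl
^-monoˡ-∣ (suc n) d = *-pres-∣ d (^-monoˡ-∣ n d)

-- Primes and coprimality

prime>1 : ∀ {p} → Prime p → 1 < p
prime>1 {zero} pp = ⊥-elim (NonZero.nonZero (prime⇒nonZero pp))
prime>1 {suc zero} pp = ⊥-elim (¬prime[1] pp)
prime>1 {suc (suc p)} _ = s≤s (s≤s z≤n)

prime-∣^ : ∀ {p} → Prime p → ∀ x n → p ∣ x ^ n → p ∣ x
prime-∣^ pp x zero d = ⊥-elim (<⇒≢ (prime>1 pp) (sym (∣1⇒≡1 d)))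
prime-∣^ pp x (suc n) d with euclidsLemma x (x ^ n) pp d
... | inj₁ e = e
... | inj₂ e = prime-∣^ pp x n e

prime-∣-prime : ∀ {p q} → Prime p → Prime q → p ∣ q → p ≡ q
prime-∣-prime pp pq d with prime⇒irreducible pq d
... | inj₁ refl = ⊥-elim (¬prime[1] pp)
... | inj₂ e = e

prime-factor : ∀ n → 1 < n → ∃[ p ] (Prime p × p ∣ n)
prime-factor n n>1 with factorise n {{>-nonZero (<-trans (s≤s z≤n) n>1)}}
... | record { factors = [] ; isFactorisation = e } = ⊥-elim (<⇒≢ n>1 (sym e))
... | record { factors = p ∷ ps ; isFactorisation = e ; factorsPrime = pp ∷ _ } =
  p , pp , subst (p ∣_) (sym e) (m∣m*n (product ps))

coprime-from-primes : ∀ {m n} → 0 < m → (∀ q → Prime q → q ∣ m → q ∣ n → ⊥) → Coprime m n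
coprime-from-primes m>0 h {zero} (d , _) = ⊥-elim (<⇒≢ m>0 (sym (0∣⇒≡0 d)))
coprime-from-primes m>0 h {suc zero} _ = refl
coprime-from-primes m>0 h {suc (suc i)} (d , e) with prime-factor (suc (suc i)) (s≤s (s≤s z≤n))
... | q , pq , f = ⊥-elim (h q pq (∣-trans f d) (∣-trans f e))

coprime-sym : ∀ {m n} → Coprime m n → Coprime n m
coprime-sym c (d , e) = c (e , d)

coprime-prime : ∀ {m n} → Coprime m n → ∀ {q} → Prime q → q ∣ m → q ∣ n → ⊥
coprime-prime c pq d e = <⇒≢ (prime>1 pq) (sym (c (d , e)))

coprime-^ : ∀ {m n} → 0 < m → Coprime m n → ∀ i j → Coprime (m ^ i) (n ^ j)
coprime-^ {m} {n} m>0 c i j = coprime-from-primes (^-pos i m>0)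
  λ q pq d e → coprime-prime c pq (prime-∣^ pq m i d) (prime-∣^ pq n j e)

coprime-∣^⇒1 : ∀ {m n} → 0 < m → Coprime m n → ∀ j → m ∣ n ^ j → m ≡ 1
coprime-∣^⇒1 {m} {n} m>0 c j d = subst (λ e → Coprime e (n ^ j)) (*-identityʳ m) (coprime-^ m>0 c 1 j) (∣-refl , d)

prime-coprime : ∀ {p n} → Prime p → ¬ (p ∣ n) → Coprime p n
prime-coprime {p} pp h = coprime-from-primes (<-trans (s≤s z≤n) (prime>1 pp))
  λ q pq d e → h (subst (_∣ _) (prime-∣-prime pq pp d) e)

coprime-+ʳ : ∀ {m n} → Coprime m n → Coprime m (m + n)
coprime-+ʳ c (d , e) = c (d , ∣m+n∣m⇒∣n e d)

-- Parity and exact powers of a prime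

∣-odd : ∀ {n m} → Odd n → m ∣ n → Odd m
∣-odd o d e = o (∣-trans e d)

odd-* : ∀ {m n} → Odd m → Odd n → Odd (m * n)
odd-* {m} {n} om on d with euclidsLemma m n prime[2] d
... | inj₁ e = om e
... | inj₂ e = on e

odd-^ : ∀ {m} n → Odd m → Odd (m ^ n)
odd-^ {m} n om d = om (prime-∣^ prime[2] m n d)

odd-pos : ∀ {n} → Odd n → 0 < n
odd-pos {zero} o = ⊥-elim (o (2 ∣0))
odd-pos {suc n} _ = s≤s z≤n

odd⇒1+2* : ∀ n → Odd n → ∃[ m ] n ≡ 1 + 2 * m
odd⇒1+2* zero o = ⊥-elim (o (2 ∣0))
odd⇒1+2* (suc zero) o = 0 , refl
odd⇒1+2* (suc (suc n)) o with odd⇒1+2* n (λ d → o (∣m∣n⇒∣m+n (∣-refl {2}) d))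
... | m , refl = suc m , cong suc (sym (*-suc 2 m))

1+2*-odd : ∀ m → Odd (1 + 2 * m)
1+2*-odd m d with ∣1⇒≡1 (∣m+n∣m⇒∣n (subst (2 ∣_) (+-comm 1 (2 * m)) d) (m∣m*n m))
... | ()

odd+odd : ∀ {m n} → Odd m → Odd n → 2 ∣ m + n
odd+odd {m} {n} om on with odd⇒1+2* m om | odd⇒1+2* n on
... | i , refl | j , refl = divides (1 + i + j) (lemma i j)
  where
  lemma : ∀ i j → (1 + 2 * i) + (1 + 2 * j) ≡ (1 + i + j) * 2
  lemma = solve-∀

even+odd : ∀ {m n} → 2 ∣ m → Odd n → Odd (m + n)
even+odd d o e = o (∣m+n∣m⇒∣n e d)

odd∣2^⇒1 : ∀ {m} k → Odd m → m ∣ 2 ^ k → m ≡ 1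
odd∣2^⇒1 {m} k o d = coprime-∣^⇒1 (odd-pos o) (coprime-sym (prime-coprime prime[2] o)) k d

∣2^⇒2^ : ∀ k m → m ∣ 2 ^ k → ∃[ j ] m ≡ 2 ^ j
∣2^⇒2^ zero m d = 0 , ∣1⇒≡1 d
∣2^⇒2^ (suc k) m d with 2 ∣? m
... | no o = 0 , odd∣2^⇒1 (suc k) o d
... | yes (divides r refl) with ∣2^⇒2^ k r (*-cancelˡ-∣ 2 (subst (_∣ 2 ^ suc k) (*-comm r 2) d))
... | j , refl = suc j , *-comm (2 ^ j) 2

exact-power : ∀ p → 1 < p → ∀ n → 0 < n → ∃[ k ] ∃[ m ] (n ≡ p ^ k * m × ¬ (p ∣ m))
exact-power p p>1 n n>0 = go n n ≤-refl n>0
  where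
  -- `f` is fuel bounding `n`: removing one factor `p > 1` strictly lowers `n`, so the recursion is
  -- structural in `f`.
  go : ∀ f n → n ≤ f → 0 < n → ∃[ k ] ∃[ m ] (n ≡ p ^ k * m × ¬ (p ∣ m))
  go zero n n≤0 n>0 = ⊥-elim (<⇒≱ n>0 n≤0)
  go (suc f) n n≤f n>0 with p ∣? n
  ... | no h = 0 , n , sym (*-identityˡ n) , h
  ... | yes (divides r refl) with go f r (≤-pred (≤-trans (m<m*n r p {{>-nonZero (*-pos⁻¹ˡ n>0)}} p>1) n≤f)) (*-pos⁻¹ˡ n>0)
  ... | k , m , refl , h = suc k , m , trans (*-comm (p ^ k * m) p) (sym (*-assoc p (p ^ k) m)) , h

exact-power-unique : ∀ {p} → 1 < p → ∀ i j {m n} → ¬ (p ∣ m) → ¬ (p ∣ n) → p ^ i * m ≡ p ^ j * n → i ≡ j × m ≡ n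
exact-power-unique p>1 zero zero {m} {n} _ _ e = refl , trans (sym (*-identityˡ m)) (trans e (*-identityˡ n))
exact-power-unique {p} p>1 zero (suc j) {m} {n} hm _ e =
  ⊥-elim (hm (subst (p ∣_) (trans (sym e) (*-identityˡ m)) (∣m⇒∣m*n n (m∣m*n (p ^ j)))))
exact-power-unique {p} p>1 (suc i) zero {m} {n} _ hn e =
  ⊥-elim (hn (subst (p ∣_) (trans e (*-identityˡ n)) (∣m⇒∣m*n m (m∣m*n (p ^ i)))))
exact-power-unique {p} p>1 (suc i) (suc j) {m} {n} hm hn e
  with exact-power-unique p>1 i j hm hn
    (cancelˡ (<-trans (s≤s z≤n) p>1) (trans (sym (*-assoc p (p ^ i) m)) (trans e (*-assoc p (p ^ j) n))))
... | refl , f = refl , f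

-- Homogeneous geometric sums and lifting the exponent

-- S X Y n = X^(n-1) + X^(n-2) Y + ... + Y^(n-1)
S : ℕ → ℕ → ℕ → ℕ
S X Y zero    = 0
S X Y (suc n) = X * S X Y n + Y ^ n

^-difference : ∀ Y δ n → (Y + δ) ^ n ≡ Y ^ n + δ * S (Y + δ) Y n
^-difference Y δ zero = sym (cong suc (*-zeroʳ δ))
^-difference Y δ (suc n) =
  trans (cong ((Y + δ) *_) (^-difference Y δ n)) (lemma Y δ (Y ^ n) (S (Y + δ) Y n))
  where
  lemma : ∀ Y δ u s → (Y + δ) * (u + δ * s) ≡ Y * u + δ * ((Y + δ) * s + u)
  lemma = solve-∀

S-+ : ∀ X Y r n → S X Y (r + n) ≡ X ^ r * S X Y n + Y ^ n * S X Y r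
S-+ X Y zero n = lemma (S X Y n) (Y ^ n)
  where
  lemma : ∀ s u → s ≡ 1 * s + u * 0
  lemma = solve-∀
S-+ X Y (suc r) n = begin
  X * S X Y (r + n) + Y ^ (r + n)
    ≡⟨ cong₂ (λ s u → X * s + u) (S-+ X Y r n) (^-distribˡ-+-* Y r n) ⟩
  X * (X ^ r * S X Y n + Y ^ n * S X Y r) + Y ^ r * Y ^ n
    ≡⟨ lemma X (X ^ r) (S X Y n) (Y ^ n) (S X Y r) (Y ^ r) ⟩
  X * X ^ r * S X Y n + Y ^ n * (X * S X Y r + Y ^ r) ∎
  where
  open ≡-Reasoning
  lemma : ∀ X u s v t w → X * (u * s + v * t) + w * v ≡ X * u * s + v * (X * t + w)
  lemma = solve-∀

-- This is (X^(mn) - Y^(mn)) / (X - Y) split through X^n - Y^n. Written with `S` it involves no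
-- subtraction and also covers X ≤ Y.
S-* : ∀ X Y m n → S X Y (m * n) ≡ S X Y n * S (X ^ n) (Y ^ n) m
S-* X Y zero n = sym (*-zeroʳ (S X Y n))
S-* X Y (suc m) n = begin
  S X Y (n + m * n)
    ≡⟨ S-+ X Y n (m * n) ⟩
  X ^ n * S X Y (m * n) + Y ^ (m * n) * S X Y n
    ≡⟨ cong₂ (λ s u → X ^ n * s + u * S X Y n) (S-* X Y m n) (trans (cong (Y ^_) (*-comm m n)) (sym (^-*-assoc Y n m))) ⟩
  X ^ n * (S X Y n * S (X ^ n) (Y ^ n) m) + (Y ^ n) ^ m * S X Y n
    ≡⟨ lemma (X ^ n) (S X Y n) (S (X ^ n) (Y ^ n) m) ((Y ^ n) ^ m) ⟩
  S X Y n * (X ^ n * S (X ^ n) (Y ^ n) m + (Y ^ n) ^ m) ∎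
  where
  open ≡-Reasoning
  lemma : ∀ u s t v → u * (s * t) + v * s ≡ s * (u * t + v)
  lemma = solve-∀

S-one : ∀ X Y → S X Y 1 ≡ 1
S-one X Y = cong (_+ 1) (*-zeroʳ X)

S-pos : ∀ {X Y n} → 0 < Y → 0 < n → 0 < S X Y n
S-pos {X} {Y} {suc n} Y>0 _ = ≤-trans (^-pos n Y>0) (m≤n+m (Y ^ n) (X * S X Y n))

S≡1⇒n≡1 : ∀ {X Y n} → 0 < X → 0 < Y → S X Y n ≡ 1 → n ≡ 1
S≡1⇒n≡1 {n = suc zero} _ _ _ = refl
S≡1⇒n≡1 {X} {Y} {suc (suc n)} X>0 Y>0 e =
  ⊥-elim (<⇒≢ (+-mono-≤ (*-pos X>0 (S-pos {X} {Y} {suc n} Y>0 (s≤s z≤n))) (^-pos (suc n) Y>0)) (sym e))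

-- Modulo a prime divisor of `Y` only the leading term `X ^ n` of the sum survives.
S-∣Y⇒∣X : ∀ {q} → Prime q → ∀ X Y n → q ∣ S X Y (suc n) → q ∣ Y → q ∣ X
S-∣Y⇒∣X {q} pq X Y zero d _ = ⊥-elim (<⇒≢ (prime>1 pq) (sym (∣1⇒≡1 (subst (q ∣_) (S-one X Y) d))))
S-∣Y⇒∣X {q} pq X Y (suc n) d e = go (euclidsLemma X (S X Y (suc n)) pq
    (∣m+n∣m⇒∣n (subst (q ∣_) (+-comm (X * S X Y (suc n)) (Y ^ suc n)) d) (∣m⇒∣m*n (Y ^ n) e)))
  where
  go : q ∣ X ⊎ q ∣ S X Y (suc n) → q ∣ X
  go (inj₁ f) = f
  go (inj₂ f) = S-∣Y⇒∣X pq X Y n f e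

-- A common prime `q` divides `S` at the consecutive indices `u * n` and `v * m`. The recursion of
-- `S` then leaves `q ∣ Y`, and `S-∣Y⇒∣X` gives `q ∣ X`.
S-coprime-aux : ∀ {X Y n m u v} → Coprime X Y → 0 < n → 1 + u * n ≡ v * m →
  ∀ q → Prime q → q ∣ S X Y n → q ∣ S X Y m → ⊥
S-coprime-aux {X} {Y} {suc n} {m} {u} {v} c n>0 e q pq dn dm =
  coprime-prime c pq (S-∣Y⇒∣X pq X Y n dn q∣Y) q∣Y
  where
  d₁ : q ∣ S X Y (1 + u * suc n)
  d₁ = subst (q ∣_) (sym (trans (cong (S X Y) e) (S-* X Y v m))) (∣m⇒∣m*n _ dm)
  d₂ : q ∣ S X Y (u * suc n)
  d₂ = subst (q ∣_) (sym (S-* X Y u (suc n))) (∣m⇒∣m*n _ dn)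
  q∣Y : q ∣ Y
  q∣Y = prime-∣^ pq Y (u * suc n) (∣m+n∣m⇒∣n d₁ (∣n⇒∣m*n X d₂))

S-coprime : ∀ {X Y n m} → 0 < Y → Coprime X Y → 0 < n → 0 < m → Coprime n m →
  Coprime (S X Y n) (S X Y m)
S-coprime {X} {Y} {n} {m} Y>0 c n>0 m>0 cnm = coprime-from-primes (S-pos {X} Y>0 n>0) (go (coprime-Bézout cnm))
  where
  go : Bézout.Identity 1 n m → ∀ q → Prime q → q ∣ S X Y n → q ∣ S X Y m → ⊥
  go (Bézout.+- x y e) q pq dn dm = S-coprime-aux {u = y} {v = x} c m>0 e q pq dm dn
  go (Bézout.-+ x y e) q pq dn dm = S-coprime-aux {u = x} {v = y} c n>0 e q pq dn dm

-- First and second order expansions of S (Y + δ) Y n in powers of δ, cleared of denominators.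
S-expand : ∀ Y δ n → ∃[ w ] ∃[ v ] (Y * S (Y + δ) Y n ≡ n * Y ^ n + δ * w
                                    × 2 * Y * w ≡ n * (n ∸ 1) * Y ^ n + δ * v)
S-expand Y δ zero = 0 , 0 , lemma₁ Y δ , lemma₂ Y δ
  where
  lemma₁ : ∀ Y δ → Y * 0 ≡ δ * 0
  lemma₁ = solve-∀
  lemma₂ : ∀ Y δ → 2 * Y * 0 ≡ δ * 0
  lemma₂ = solve-∀
S-expand Y δ (suc n) with S-expand Y δ n
... | w , v , e , f = n * Y ^ n + (Y + δ) * w , n * (n ∸ 1) * Y ^ n + (Y + δ) * v , first , second
  where
  open ≡-Reasoning
  lemma₁ : ∀ Y δ s u → Y * ((Y + δ) * s + u) ≡ (Y + δ) * (Y * s) + Y * u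
  lemma₁ = solve-∀
  lemma₂ : ∀ Y δ n u w → (Y + δ) * (n * u + δ * w) + Y * u ≡ (1 + n) * (Y * u) + δ * (n * u + (Y + δ) * w)
  lemma₂ = solve-∀
  first : Y * S (Y + δ) Y (suc n) ≡ suc n * Y ^ suc n + δ * (n * Y ^ n + (Y + δ) * w)
  first = begin
    Y * ((Y + δ) * S (Y + δ) Y n + Y ^ n)      ≡⟨ lemma₁ Y δ (S (Y + δ) Y n) (Y ^ n) ⟩
    (Y + δ) * (Y * S (Y + δ) Y n) + Y * Y ^ n  ≡⟨ cong (λ t → (Y + δ) * t + Y * Y ^ n) e ⟩
    (Y + δ) * (n * Y ^ n + δ * w) + Y * Y ^ n  ≡⟨ lemma₂ Y δ n (Y ^ n) w ⟩
    suc n * Y ^ suc n + δ * (n * Y ^ n + (Y + δ) * w) ∎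
  lemma₃ : ∀ Y δ n u w → 2 * Y * (n * u + (Y + δ) * w) ≡ 2 * n * (Y * u) + (Y + δ) * (2 * Y * w)
  lemma₃ = solve-∀
  lemma₄ : ∀ Y δ n u t v → 2 * n * (Y * u) + (Y + δ) * (t * u + δ * v) ≡ (2 * n + t) * (Y * u) + δ * (t * u + (Y + δ) * v)
  lemma₄ = solve-∀
  falling : ∀ n → 2 * n + n * (n ∸ 1) ≡ suc n * n
  falling zero = refl
  falling (suc n) = lemma n
    where
    lemma : ∀ n → 2 * (1 + n) + (1 + n) * n ≡ (2 + n) * (1 + n)
    lemma = solve-∀
  second : 2 * Y * (n * Y ^ n + (Y + δ) * w) ≡ suc n * n * Y ^ suc n + δ * (n * (n ∸ 1) * Y ^ n + (Y + δ) * v)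
  second = begin
    2 * Y * (n * Y ^ n + (Y + δ) * w)
      ≡⟨ lemma₃ Y δ n (Y ^ n) w ⟩
    2 * n * Y ^ suc n + (Y + δ) * (2 * Y * w)
      ≡⟨ cong (λ t → 2 * n * Y ^ suc n + (Y + δ) * t) f ⟩
    2 * n * Y ^ suc n + (Y + δ) * (n * (n ∸ 1) * Y ^ n + δ * v)
      ≡⟨ lemma₄ Y δ n (Y ^ n) (n * (n ∸ 1)) v ⟩
    (2 * n + n * (n ∸ 1)) * Y ^ suc n + δ * (n * (n ∸ 1) * Y ^ n + (Y + δ) * v)
      ≡⟨ cong (λ t → t * Y ^ suc n + δ * (n * (n ∸ 1) * Y ^ n + (Y + δ) * v)) (falling n) ⟩
    suc n * n * Y ^ suc n + δ * (n * (n ∸ 1) * Y ^ n + (Y + δ) * v) ∎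

S-mod : ∀ {q} Y δ n → q ∣ δ → q ∣ S (Y + δ) Y n → q ∣ n * Y ^ n
S-mod {q} Y δ n d e with S-expand Y δ n
... | w , v , f , _ = ∣m+n∣m⇒∣n (subst (q ∣_) (trans f (+-comm (n * Y ^ n) (δ * w))) (∣n⇒∣m*n Y e)) (∣m⇒∣m*n w d)

prime-∣-S : ∀ {ℓ} → Prime ℓ → ∀ Y δ → ℓ ∣ δ → ¬ (ℓ ∣ Y) → ℓ ∣ S (Y + δ) Y ℓ
prime-∣-S {ℓ} pℓ Y δ d h with S-expand Y δ ℓ
... | w , v , f , _ with euclidsLemma Y (S (Y + δ) Y ℓ) pℓ
    (subst (ℓ ∣_) (sym f) (∣m∣n⇒∣m+n (m∣m*n (Y ^ ℓ)) (∣m⇒∣m*n w d)))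
... | inj₁ e = ⊥-elim (h e)
... | inj₂ e = e

-- For odd `ℓ` the second-order expansion gives `ℓ ∣ w`, so `Y` times the sum is `ℓ * Y ^ ℓ` modulo
-- `ℓ * ℓ`. For `ℓ = 2` the binomial coefficient offers no factor 2; the sum is `δ + 2 * Y`, which
-- explains the condition `4 ∣ δ`.
prime²-∤-S : ∀ {ℓ} → Prime ℓ → ∀ Y δ → ℓ ∣ δ → ¬ (ℓ ∣ Y) → (2 ∣ ℓ → 4 ∣ δ) → ¬ (ℓ * ℓ ∣ S (Y + δ) Y ℓ)
prime²-∤-S {ℓ} pℓ Y δ d h four e with 2 ∣? ℓ
... | yes two with prime-∣-prime prime[2] pℓ two
... | refl = h (*-cancelˡ-∣ 2 (∣m+n∣m⇒∣n (subst (4 ∣_) (lemma Y δ) e) (four two)))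
  where
  lemma : ∀ Y δ → (Y + δ) * ((Y + δ) * 0 + 1) + Y * 1 ≡ δ + 2 * Y
  lemma = solve-∀
prime²-∤-S {ℓ} pℓ Y δ d h four e | no odd with S-expand Y δ ℓ
... | w , v , f , g = h (prime-∣^ pℓ Y ℓ (*-cancelˡ-∣ ℓ {{prime⇒nonZero pℓ}}
    (∣m+n∣m⇒∣n (subst (ℓ * ℓ ∣_) (trans f (+-comm (ℓ * Y ^ ℓ) (δ * w))) (∣n⇒∣m*n Y e)) (*-pres-∣ d ℓ∣w))))
  where
  ℓ∣2Yw : ℓ ∣ 2 * Y * w
  ℓ∣2Yw = subst (ℓ ∣_) (sym g) (∣m∣n⇒∣m+n (∣m⇒∣m*n (Y ^ ℓ) (m∣m*n (ℓ ∸ 1))) (∣m⇒∣m*n v d))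
  ℓ∣w : ℓ ∣ w
  ℓ∣w with euclidsLemma (2 * Y) w pℓ ℓ∣2Yw
  ... | inj₂ k = k
  ... | inj₁ k with euclidsLemma 2 Y pℓ k
  ... | inj₂ j = ⊥-elim (h j)
  ... | inj₁ j with prime-∣-prime pℓ prime[2] j
  ... | refl = ⊥-elim (odd ∣-refl)

-- For a prime ℓ the sum S X Y ℓ is coprime to K up to at most one factor ℓ.
lte-prime : ∀ {ℓ} → Prime ℓ → ∀ {Y δ K P} → 0 < K → Coprime K Y → (∀ q → Prime q → q ∣ K → q ∣ δ) →
  (2 ∣ K → 4 ∣ δ) → K ∣ P * S (Y + δ) Y ℓ → K ∣ P * ℓ
lte-prime {ℓ} pℓ {Y} {δ} {K} {P} K>0 c rad four d with ℓ ∣? K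
... | no h = ∣m⇒∣m*n ℓ (coprime-divisor coprime (subst (K ∣_) (*-comm P _) d))
  where
  coprime : Coprime K (S (Y + δ) Y ℓ)
  coprime = coprime-from-primes K>0 λ q pq e f → case q pq e (euclidsLemma ℓ (Y ^ ℓ) pq (S-mod Y δ ℓ (rad q pq e) f))
    where
    case : ∀ q → Prime q → q ∣ K → q ∣ ℓ ⊎ q ∣ Y ^ ℓ → ⊥
    case q pq e (inj₁ f) = h (subst (_∣ K) (prime-∣-prime pq pℓ f) e)
    case q pq e (inj₂ f) = coprime-prime c pq e (prime-∣^ pq Y ℓ f)
... | yes ℓ∣K with prime-∣-S pℓ Y δ (rad ℓ pℓ ℓ∣K) (λ e → coprime-prime c pℓ ℓ∣K e)
... | divides s S≡ = coprime-divisor coprime (subst (K ∣_) (trans (cong (P *_) S≡) (lemma P s ℓ)) d)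
  where
  lemma : ∀ P s l → P * (s * l) ≡ s * (P * l)
  lemma = solve-∀
  case : ∀ q → Prime q → q ∣ K → q ∣ s → q ∣ ℓ ⊎ q ∣ Y ^ ℓ → ⊥
  case q pq e f (inj₂ g) = coprime-prime c pq e (prime-∣^ pq Y ℓ g)
  case q pq e f (inj₁ g) with prime-∣-prime pq pℓ g
  ... | refl = prime²-∤-S pℓ Y δ (rad ℓ pℓ ℓ∣K) (λ i → coprime-prime c pℓ ℓ∣K i)
                 (λ i → four (∣-trans i ℓ∣K)) (subst (ℓ * ℓ ∣_) (sym S≡) (*-pres-∣ f ∣-refl))
  coprime : Coprime K s
  coprime = coprime-from-primes K>0 λ q pq e f → case q pq e f
    (euclidsLemma ℓ (Y ^ ℓ) pq (S-mod Y δ ℓ (rad q pq e) (subst (q ∣_) (sym S≡) (∣m⇒∣m*n ℓ f))))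

-- The multiplier M keeps the statement closed under splitting off one prime factor of n.
lte : ∀ {n} → 0 < n → ∀ {Y δ K M} → 0 < K → Coprime K Y → (∀ q → Prime q → q ∣ K → q ∣ δ) →
  (2 ∣ K → 4 ∣ δ) → K ∣ M * S (Y + δ) Y n → K ∣ M * n
lte {n} n>0 {Y} {δ} {K} {M} K>0 c rad four d with factorise n {{>-nonZero n>0}}
... | record { factors = ps ; isFactorisation = e ; factorsPrime = pps } =
  subst (λ m → K ∣ M * m) (sym e) (go ps pps {M = M} c rad four (subst (λ m → K ∣ M * S (Y + δ) Y m) e d))
  where
  go : ∀ ps → All Prime ps → ∀ {Y δ M} → Coprime K Y → (∀ q → Prime q → q ∣ K → q ∣ δ) →
    (2 ∣ K → 4 ∣ δ) → K ∣ M * S (Y + δ) Y (product ps) → K ∣ M * product ps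
  go [] [] {Y} {δ} {M} c rad four d = subst (λ s → K ∣ M * s) (S-one (Y + δ) Y) d
  go (ℓ ∷ ps) (pℓ ∷ pps) {Y} {δ} {M} c rad four d =
    subst (K ∣_) (lemma₂ M m ℓ) (lte-prime pℓ {P = M * m} K>0 c rad four (subst (K ∣_) (lemma₃ M s m) rest))
    where
    m s : ℕ
    m = product ps
    s = S (Y + δ) Y ℓ
    lemma₁ : ∀ M s t → M * (s * t) ≡ M * s * t
    lemma₁ = solve-∀
    lemma₂ : ∀ M m l → M * m * l ≡ M * (l * m)
    lemma₂ = solve-∀
    lemma₃ : ∀ M s m → M * s * m ≡ M * m * s
    lemma₃ = solve-∀
    -- Passing to `ℓ`-th powers multiplies the gap `δ` by `s`, so the divisibility hypotheses on the
    -- gap persist, while `s` moves into the multiplier.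
    factor : M * S (Y + δ) Y (ℓ * m) ≡ M * s * S (Y ^ ℓ + δ * s) (Y ^ ℓ) m
    factor = trans (cong (M *_) (trans (cong (S (Y + δ) Y) (*-comm ℓ m)) (S-* (Y + δ) Y m ℓ)))
      (trans (lemma₁ M s _) (cong (λ X → M * s * S X (Y ^ ℓ) m) (^-difference Y δ ℓ)))
    rest : K ∣ M * s * m
    rest = go ps pps {M = M * s} (subst (λ k → Coprime k (Y ^ ℓ)) (*-identityʳ K) (coprime-^ K>0 c 1 ℓ))
      (λ q pq e → ∣m⇒∣m*n s (rad q pq e)) (λ e → ∣m⇒∣m*n s (four e)) (subst (K ∣_) factor d)

-- Two solutions with proportional exponents of b and c

gcd-split : ∀ m n → 0 < m → ∃[ g ] ∃[ m′ ] ∃[ n′ ] (m ≡ g * m′ × n ≡ g * n′ × Coprime m′ n′)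
gcd-split m n m>0 with gcd[m,n]∣m m n | gcd[m,n]∣n m n
... | divides m′ em | divides n′ en = g , m′ , n′ , em′ , en′ , gcd≡1⇒coprime (cancelˡ g>0 gcd-eq)
  where
  g : ℕ
  g = gcd m n
  em′ : m ≡ g * m′
  em′ = trans em (*-comm m′ g)
  en′ : n ≡ g * n′
  en′ = trans en (*-comm n′ g)
  g>0 : 0 < g
  g>0 = *-pos⁻¹ˡ (subst (0 <_) em′ m>0)
  gcd-eq : g * gcd m′ n′ ≡ g * 1
  gcd-eq = trans (c*gcd[m,n]≡gcd[cm,cn] g m′ n′) (trans (cong₂ gcd (sym em′) (sym en′)) (sym (*-identityʳ g)))

-- Cancelling the gcd of `y₁` and `y₂` leaves `n * z₂ = m * z₁` with `n`, `m` coprime, so `n ∣ z₁`.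
-- Two proportional solutions thereby become `n`-th and `m`-th powers of the same two bases.
proportional : ∀ {y₁ y₂ z₁ z₂} → 0 < y₁ → y₁ * z₂ ≡ y₂ * z₁ →
  ∃[ n ] ∃[ m ] ∃[ y₀ ] ∃[ z₀ ] (y₁ ≡ y₀ * n × y₂ ≡ y₀ * m × z₁ ≡ z₀ * n × z₂ ≡ z₀ * m × Coprime n m)
proportional {y₁} {y₂} {z₁} {z₂} y₁>0 e with gcd-split y₁ y₂ y₁>0
... | g , n , m , refl , refl , c with coprime-divisor c (divides z₂ (trans (sym n*z₂) (*-comm n z₂)))
  where
  n*z₂ : n * z₂ ≡ m * z₁
  n*z₂ = cancelˡ {g} (*-pos⁻¹ˡ y₁>0) (trans (sym (*-assoc g n z₂)) (trans e (*-assoc g m z₁)))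
... | divides z₀ refl = n , m , g , z₀ , refl , refl , refl , z₂≡ , c
  where
  lemma : ∀ m z n → m * (z * n) ≡ n * (z * m)
  lemma = solve-∀
  z₂≡ : z₂ ≡ z₀ * m
  z₂≡ = cancelˡ (*-pos⁻¹ʳ g y₁>0) (cancelˡ {g} (*-pos⁻¹ˡ y₁>0)
    (trans (sym (*-assoc g n z₂)) (trans e (trans (*-assoc g m (z₀ * n)) (cong (g *_) (lemma m z₀ n))))))

split-< : ∀ {m n} → m < n → ∃[ r ] (n ≡ m + r × 0 < r)
split-< {m} {n} m<n = n ∸ m , sym (m+[n∸m]≡n (<⇒≤ m<n)) , m<n⇒0<n∸m m<n

-- Both `P < C ^ n` and `P * C ^ r ≤ R` are read off the equations. With `P`, `R` powers of `a` the
-- conclusion compares their exponents, and this makes `s` positive in `Lifted`.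
difference-growth : ∀ {B C P R n r} → 0 < P → 0 < r → B ≤ C → 0 < B →
  P + B ^ n ≡ C ^ n → R + B ^ (n + r) ≡ C ^ (n + r) → P ^ (n + r) < R ^ n
difference-growth {B} {C} {P} {R} {n} {r} P>0 r>0 B≤C B>0 eP eR = begin-strict
  P ^ (n + r)        ≡⟨ ^-distribˡ-+-* P n r ⟩
  P ^ n * P ^ r      <⟨ *-monoʳ-< (P ^ n) {{>-nonZero (^-pos n P>0)}} (^-monoˡ-< r {{>-nonZero r>0}} P<C^n) ⟩
  P ^ n * (C ^ n) ^ r ≡⟨ cong (P ^ n *_) (^-^-comm C n r) ⟩
  P ^ n * (C ^ r) ^ n ≡⟨ sym (^-distribʳ-* n P (C ^ r)) ⟩
  (P * C ^ r) ^ n    ≤⟨ ^-monoˡ-≤ n (+-cancelʳ-≤ (B ^ n * C ^ r) (P * C ^ r) R PC≤R) ⟩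
  R ^ n              ∎
  where
  open ≤-Reasoning
  P<C^n : P < C ^ n
  P<C^n = subst (P <_) eP (m<m+n P (^-pos n B>0))
  PC≤R : P * C ^ r + B ^ n * C ^ r ≤ R + B ^ n * C ^ r
  PC≤R = begin
    P * C ^ r + B ^ n * C ^ r ≡⟨ sym (*-distribʳ-+ (C ^ r) P (B ^ n)) ⟩
    (P + B ^ n) * C ^ r       ≡⟨ cong (_* C ^ r) eP ⟩
    C ^ n * C ^ r             ≡⟨ sym (^-distribˡ-+-* C n r) ⟩
    C ^ (n + r)               ≡⟨ sym eR ⟩
    R + B ^ (n + r)           ≡⟨ cong (R +_) (^-distribˡ-+-* B n r) ⟩
    R + B ^ n * B ^ r         ≤⟨ +-monoʳ-≤ R (*-monoʳ-≤ (B ^ n) (^-monoˡ-≤ r B≤C)) ⟩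
    R + B ^ n * C ^ r         ∎

1+r<3^r : ∀ r → 0 < r → 1 + r < 3 ^ r
1+r<3^r (suc zero) _ = s≤s (s≤s (s≤s z≤n))
1+r<3^r (suc (suc r)) _ = begin-strict
  2 + suc r           ≤⟨ 1+r<3^r (suc r) (s≤s z≤n) ⟩
  3 ^ suc r           <⟨ m<m*n (3 ^ suc r) 3 {{>-nonZero (^-pos (suc r) (s≤s z≤n))}} (s≤s (s≤s z≤n)) ⟩
  3 ^ suc r * 3       ≡⟨ *-comm (3 ^ suc r) 3 ⟩
  3 ^ suc (suc r)     ∎
  where open ≤-Reasoning

-- Lifting the exponent gives `o ^ r ∣ 1 + r`, but `1 + r < 3 ^ r`. The divisor `o` is kept apart
-- from the gap `δ` because lifting at 2 fails when `δ` is twice an odd number; there `o` is the odd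
-- half.
power-∣-S⇒<3 : ∀ {o d δ r} → 0 < o → 0 < r → o ∣ δ → (2 ∣ o → 4 ∣ δ) → Coprime d δ →
  o ^ r ∣ S (d + δ) d (1 + r) → o < 3
power-∣-S⇒<3 {o} {d} {δ} {r} o>0 r>0 o∣δ four c h with o <? 3
... | yes p = p
... | no p = ⊥-elim (<⇒≱ (1+r<3^r r r>0) (≤-trans (^-monoˡ-≤ r (≮⇒≥ p)) (∣-≤ (s≤s z≤n) o^r∣1+r)))
  where
  o^r∣1+r : o ^ r ∣ 1 + r
  o^r∣1+r = subst (o ^ r ∣_) (*-identityˡ (1 + r)) (lte (s≤s z≤n) {M = 1} (^-pos r o>0)
    (λ {i} (e , f) → coprime-^ o>0 (coprime-sym {d} {o} (λ (e , f) → c (e , ∣-trans f o∣δ))) r 1 (e , subst (i ∣_) (sym (*-identityʳ d)) f))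
    (λ q pq e → ∣-trans (prime-∣^ pq o r e) o∣δ) (λ e → four (prime-∣^ prime[2] o r e))
    (subst (o ^ r ∣_) (sym (*-identityˡ _)) h))

δ≡1∨2 : ∀ {d δ r} → 0 < δ → 0 < r → Coprime d δ → δ ^ r ∣ S (d + δ) d (1 + r) → δ ≡ 1 ⊎ δ ≡ 2
δ≡1∨2 {d} {δ} {r} δ>0 r>0 c h with 2 ∣? δ
... | no o = small δ δ>0 (power-∣-S⇒<3 δ>0 r>0 ∣-refl (λ e → ⊥-elim (o e)) c h)
  where
  small : ∀ δ → 0 < δ → δ < 3 → δ ≡ 1 ⊎ δ ≡ 2
  small (suc zero) _ _ = inj₁ refl
  small (suc (suc zero)) _ _ = inj₂ refl
  small (suc (suc (suc _))) _ (s≤s (s≤s (s≤s ())))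
... | yes (divides o refl) with 2 ∣? o
... | yes e = ⊥-elim (<⇒≱ (power-∣-S⇒<3 δ>0 r>0 ∣-refl (λ _ → *-monoˡ-∣ 2 e) c h)
                 (≤-trans (n≤1+n 3) (∣-≤ δ>0 (*-monoˡ-∣ 2 e))))
... | no e = inj₂ (cong (_* 2) (one o e (power-∣-S⇒<3 (*-pos⁻¹ˡ δ>0) r>0 (m∣m*n 2) (λ f → ⊥-elim (e f)) c
                 (∣-trans (^-monoˡ-∣ r (m∣m*n 2)) h))))
  where
  one : ∀ o → Odd o → o < 3 → o ≡ 1
  one zero f _ = ⊥-elim (f (2 ∣0))
  one (suc zero) _ _ = refl
  one (suc (suc zero)) f _ = ⊥-elim (f ∣-refl)
  one (suc (suc (suc _))) _ (s≤s (s≤s (s≤s ())))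

-- The normal form of the pair a^x₁ + B = C, a^x₂ + B^m = C^m, where `D` is the gcd of `B` and `C`.
-- Substituting `a ^ x₁ = D * δ` in a^x₂ = a^(m x₁ + s) and dividing the second equation by `D ^ m`
-- gives `difference`.
record Lifted (a B C x₁ m x₂ : ℕ) : Set where
  constructor lifted
  field
    D d δ s : ℕ
    d>0 : 0 < d
    s>0 : 0 < s
    δ-small : δ ≡ 1 ⊎ δ ≡ 2
    coprime : Coprime d δ
    B≡ : B ≡ D * d
    C≡ : C ≡ D * (d + δ)
    a^x₁≡ : a ^ x₁ ≡ D * δ
    x₂≡ : x₂ ≡ m * x₁ + s
    difference : (d + δ) ^ m ≡ d ^ m + δ ^ m * a ^ s

-- After removing gcd(B, C) = D, write C^n - B^n = δ S_n D^n.  Comparing sizes, the exponents satisfy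
-- n x₂ = m x₁ + s with s > 0, so S_m^n = δ^(m-n) S_n^m a^s; since S_n and S_m are coprime, S_n = 1.
two-differences : ∀ {a B C n m x₁ x₂} → 1 < a → 0 < B → 0 < n → n < m → Coprime n m →
  a ^ x₁ + B ^ n ≡ C ^ n → a ^ x₂ + B ^ m ≡ C ^ m → n ≡ 1 × Lifted a B C x₁ m x₂
two-differences {a} {B} {C} {n} {m} {x₁} {x₂} a>1 B>0 n>0 n<m cnm e₁ e₂ with split-< n<m
... | r , refl , r>0 with gcd-split B C B>0
... | D , d , C₁ , refl , refl , cdC with split-< (*-cancelˡ-< D d C₁ (^-cancelˡ-< n (subst ((D * d) ^ n <_) e₁ (m<n+m _ (^-pos x₁ (<-trans (s≤s z≤n) a>1))))))
... | δ , refl , δ>0 = n≡1 , record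
  { D = D ; d = d ; δ = δ ; s = s ; d>0 = d>0 ; s>0 = s>0
  ; δ-small = δ≡1∨2 δ>0 r>0 cdδ (divides (a ^ s) (trans (cong (λ k → S (d + δ) d (k + r)) (sym n≡1)) (trans Sm≡ (*-comm (δ ^ r) (a ^ s)))))
  ; coprime = cdδ ; B≡ = refl ; C≡ = refl
  ; a^x₁≡ = trans power₁ (trans (cong₂ _*_ (trans (cong (D ^_) n≡1) (*-identityʳ D)) (cong (δ *_) Sn≡1)) (cong (D *_) (*-identityʳ δ)))
  ; x₂≡ = trans (sym (*-identityʳ x₂)) (trans (cong (x₂ *_) (sym n≡1)) (trans x₂n≡ (cong (_+ s) (*-comm x₁ m))))
  ; difference = difference }
  where
  a>0 : 0 < a
  a>0 = <-trans (s≤s z≤n) a>1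
  D>0 : 0 < D
  D>0 = *-pos⁻¹ˡ B>0
  d>0 : 0 < d
  d>0 = *-pos⁻¹ʳ D B>0
  Sn Sm : ℕ
  Sn = S (d + δ) d n
  Sm = S (d + δ) d m
  cdδ : Coprime d δ
  cdδ (e , f) = cdC (e , ∣m∣n⇒∣m+n e f)
  power : ∀ {x} k → a ^ x + (D * d) ^ k ≡ (D * (d + δ)) ^ k → a ^ x ≡ D ^ k * (δ * S (d + δ) d k)
  power {x} k e = +-cancelʳ-≡ ((D * d) ^ k) (a ^ x) (D ^ k * (δ * S (d + δ) d k)) (begin
    a ^ x + (D * d) ^ k                                 ≡⟨ e ⟩
    (D * (d + δ)) ^ k                                   ≡⟨ ^-distribʳ-* k D (d + δ) ⟩
    D ^ k * (d + δ) ^ k                                 ≡⟨ cong (D ^ k *_) (trans (^-difference d δ k) (+-comm (d ^ k) _)) ⟩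
    D ^ k * (δ * S (d + δ) d k + d ^ k)                 ≡⟨ *-distribˡ-+ (D ^ k) _ (d ^ k) ⟩
    D ^ k * (δ * S (d + δ) d k) + D ^ k * d ^ k         ≡⟨ cong (D ^ k * (δ * S (d + δ) d k) +_) (sym (^-distribʳ-* k D d)) ⟩
    D ^ k * (δ * S (d + δ) d k) + (D * d) ^ k           ∎)
    where open ≡-Reasoning
  power₁ : a ^ x₁ ≡ D ^ n * (δ * Sn)
  power₁ = power {x₁} n e₁
  power₂ : a ^ x₂ ≡ D ^ m * (δ * Sm)
  power₂ = power {x₂} m e₂
  growth : a ^ (x₁ * m) < a ^ (x₂ * n)
  growth = subst₂ _<_ (^-*-assoc a x₁ m) (^-*-assoc a x₂ n)
    (difference-growth {R = a ^ x₂} {n} (^-pos x₁ a>0) r>0 (*-monoʳ-≤ D (m≤m+n d δ)) B>0 e₁ e₂)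
  gap : ∃[ s ] (x₂ * n ≡ x₁ * m + s × 0 < s)
  gap = split-< (^-cancelʳ-< a>0 growth)
  s : ℕ
  s = proj₁ gap
  x₂n≡ : x₂ * n ≡ x₁ * m + s
  x₂n≡ = proj₁ (proj₂ gap)
  s>0 : 0 < s
  s>0 = proj₂ (proj₂ gap)
  expand : ∀ i j T → (D ^ i * (δ * T)) ^ j ≡ D ^ (i * j) * (δ ^ j * T ^ j)
  expand i j T = trans (^-distribʳ-* j (D ^ i) (δ * T)) (cong₂ _*_ (^-*-assoc D i j) (^-distribʳ-* j δ T))
  -- The `n`-th power of the second equation is set against the `m`-th power of the first; both
  -- contain `D ^ (m * n)` and `δ ^ n`, which cancel.
  Sm^n≡ : Sm ^ n ≡ δ ^ r * Sn ^ m * a ^ s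
  Sm^n≡ = cancelˡ (^-pos n δ>0) (cancelˡ (^-pos (m * n) D>0) (begin
    D ^ (m * n) * (δ ^ n * Sm ^ n)                   ≡⟨ sym (expand m n Sm) ⟩
    (D ^ m * (δ * Sm)) ^ n                           ≡⟨ cong (_^ n) (sym power₂) ⟩
    (a ^ x₂) ^ n                                     ≡⟨ ^-*-assoc a x₂ n ⟩
    a ^ (x₂ * n)                                     ≡⟨ cong (a ^_) x₂n≡ ⟩
    a ^ (x₁ * m + s)                                 ≡⟨ ^-distribˡ-+-* a (x₁ * m) s ⟩
    a ^ (x₁ * m) * a ^ s                             ≡⟨ cong (_* a ^ s) (trans (sym (^-*-assoc a x₁ m)) (cong (_^ m) power₁)) ⟩
    (D ^ n * (δ * Sn)) ^ m * a ^ s                   ≡⟨ cong (_* a ^ s) (expand n m Sn) ⟩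
    D ^ (n * m) * (δ ^ m * Sn ^ m) * a ^ s           ≡⟨ cong₂ (λ i u → D ^ i * (u * Sn ^ m) * a ^ s) (*-comm n m) (^-distribˡ-+-* δ n r) ⟩
    D ^ (m * n) * (δ ^ n * δ ^ r * Sn ^ m) * a ^ s   ≡⟨ lemma (D ^ (m * n)) (δ ^ n) (δ ^ r) (Sn ^ m) (a ^ s) ⟩
    D ^ (m * n) * (δ ^ n * (δ ^ r * Sn ^ m * a ^ s)) ∎))
    where
    open ≡-Reasoning
    lemma : ∀ p q u v w → p * (q * u * v) * w ≡ p * (q * (u * v * w))
    lemma = solve-∀
  Sn≡1 : Sn ≡ 1
  Sn≡1 = coprime-∣^⇒1 (S-pos {d + δ} d>0 n>0)
    (S-coprime d>0 (coprime-sym cdC) n>0 (<-trans n>0 n<m) cnm) n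
    (subst (Sn ∣_) (sym Sm^n≡) (∣m⇒∣m*n (a ^ s) (∣n⇒∣m*n (δ ^ r) (base∣^ Sn (<-trans n>0 n<m)))))
  n≡1 : n ≡ 1
  n≡1 = S≡1⇒n≡1 {d + δ} (≤-trans d>0 (m≤m+n d δ)) d>0 Sn≡1
  Sm≡ : Sm ≡ δ ^ r * a ^ s
  Sm≡ = trans (sym (*-identityʳ Sm)) (trans (cong (Sm ^_) (sym n≡1)) (trans Sm^n≡ (cong (_* a ^ s)
    (trans (cong (δ ^ r *_) (trans (cong (_^ m) Sn≡1) (^-zeroˡ m))) (*-identityʳ (δ ^ r))))))
  difference : (d + δ) ^ m ≡ d ^ m + δ ^ m * a ^ s
  difference = trans (^-difference d δ m) (cong (d ^ m +_) (trans (cong (δ *_) Sm≡)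
    (trans (sym (*-assoc δ (δ ^ r) (a ^ s))) (cong (λ k → δ ^ (k + r) * a ^ s) (sym n≡1)))))

-- Two solutions with proportional exponents of a and b

square-difference : ∀ Y δ → (Y + δ) ^ 2 ≡ Y ^ 2 + δ * (Y + δ + Y)
square-difference = lemma
  where
  lemma : ∀ Y δ → (Y + δ) * ((Y + δ) * 1) ≡ Y * (Y * 1) + δ * (Y + δ + Y)
  lemma = solve-∀

-- (X^k + Y^k) / (X + Y) for X = Y + δ and k = 1 + 2 j
T : ℕ → ℕ → ℕ → ℕ
T Y δ j = (Y ^ 2) ^ j + (Y + δ) * (δ * S ((Y + δ) ^ 2) (Y ^ 2) j)

even-power-difference : ∀ Y δ j →
  (Y + δ) ^ (2 * j) ≡ Y ^ (2 * j) + (Y + δ + Y) * (δ * S ((Y + δ) ^ 2) (Y ^ 2) j)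
even-power-difference Y δ j = begin
  (Y + δ) ^ (2 * j)                        ≡⟨ sym (^-*-assoc (Y + δ) 2 j) ⟩
  ((Y + δ) ^ 2) ^ j                        ≡⟨ cong (_^ j) (square-difference Y δ) ⟩
  (Y ^ 2 + δ * (Y + δ + Y)) ^ j            ≡⟨ ^-difference (Y ^ 2) (δ * (Y + δ + Y)) j ⟩
  (Y ^ 2) ^ j + δ * (Y + δ + Y) * S (Y ^ 2 + δ * (Y + δ + Y)) (Y ^ 2) j
    ≡⟨ cong₂ _+_ (^-*-assoc Y 2 j) (cong (λ X → δ * (Y + δ + Y) * S X (Y ^ 2) j) (sym (square-difference Y δ))) ⟩
  Y ^ (2 * j) + δ * (Y + δ + Y) * s        ≡⟨ cong (Y ^ (2 * j) +_) (lemma δ (Y + δ + Y) s) ⟩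
  Y ^ (2 * j) + (Y + δ + Y) * (δ * s)      ∎
  where
  open ≡-Reasoning
  s : ℕ
  s = S ((Y + δ) ^ 2) (Y ^ 2) j
  lemma : ∀ a b c → a * b * c ≡ b * (a * c)
  lemma = solve-∀

odd-power-sum : ∀ Y δ j → (Y + δ) ^ (1 + 2 * j) + Y ^ (1 + 2 * j) ≡ (Y + δ + Y) * T Y δ j
odd-power-sum Y δ j = begin
  (Y + δ) * (Y + δ) ^ (2 * j) + Y * Y ^ (2 * j)
    ≡⟨ cong (λ u → (Y + δ) * u + Y * Y ^ (2 * j)) (even-power-difference Y δ j) ⟩
  (Y + δ) * (Y ^ (2 * j) + (Y + δ + Y) * s) + Y * Y ^ (2 * j)
    ≡⟨ lemma (Y + δ) Y (Y ^ (2 * j)) s ⟩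
  (Y + δ + Y) * (Y ^ (2 * j) + (Y + δ) * s)
    ≡⟨ cong (λ u → (Y + δ + Y) * (u + (Y + δ) * s)) (sym (^-*-assoc Y 2 j)) ⟩
  (Y + δ + Y) * T Y δ j ∎
  where
  open ≡-Reasoning
  s : ℕ
  s = δ * S ((Y + δ) ^ 2) (Y ^ 2) j
  lemma : ∀ X Y u s → X * (u + (X + Y) * s) + Y * u ≡ (X + Y) * (u + X * s)
  lemma = solve-∀

-- One of `δ` and `Y + δ` is even, so the second summand of `T` is even and the first is a power of
-- the odd `Y`.
T-odd : ∀ {Y δ} j → Odd Y → Odd (T Y δ j)
T-odd {Y} {δ} j oY d = even+odd product-even (odd-^ j (odd-^ 2 oY)) (subst (2 ∣_) (+-comm ((Y ^ 2) ^ j) _) d)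
  where
  s : ℕ
  s = S ((Y + δ) ^ 2) (Y ^ 2) j
  product-even : 2 ∣ (Y + δ) * (δ * s)
  product-even with 2 ∣? δ
  ... | yes e = ∣n⇒∣m*n (Y + δ) (∣m⇒∣m*n s e)
  ... | no e = ∣m⇒∣m*n (δ * s) (odd+odd oY e)

T-pos : ∀ {Y δ} j → 0 < Y → 0 < T Y δ j
T-pos {Y} {δ} j Y>0 = ≤-trans (^-pos j (^-pos 2 Y>0)) (m≤m+n ((Y ^ 2) ^ j) _)

-- Factor X^(2k) - Y^(2k) as (X^k - Y^k)(X^k + Y^k) and cancel X^2 - Y^2. Coprimality and lifting,
-- proved for differences, thus carry over to sums of odd powers.
T∣S : ∀ Y δ j → 0 < Y → 0 < δ → T Y δ j ∣ S ((Y + δ) ^ 2) (Y ^ 2) (1 + 2 * j)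
T∣S Y δ j Y>0 δ>0 = divides (S (Y + δ) Y k) (cancelˡ (*-pos {Y + δ + Y} {δ} σ>0 δ>0)
    (+-cancelˡ-≡ (Y ^ (2 * k)) _ _ (begin
  Y ^ (2 * k) + (Y + δ + Y) * δ * S ((Y + δ) ^ 2) (Y ^ 2) k
    ≡⟨ cong (Y ^ (2 * k) +_) (*-assoc (Y + δ + Y) δ _) ⟩
  Y ^ (2 * k) + (Y + δ + Y) * (δ * S ((Y + δ) ^ 2) (Y ^ 2) k)
    ≡⟨ sym (even-power-difference Y δ k) ⟩
  (Y + δ) ^ (2 * k)
    ≡⟨ square (Y + δ) ⟩
  (Y + δ) ^ k * (Y + δ) ^ k
    ≡⟨ cong (λ u → (Y + δ) ^ k * u) (^-difference Y δ k) ⟩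
  (Y + δ) ^ k * (Y ^ k + δ * s)
    ≡⟨ *-distribˡ-+ ((Y + δ) ^ k) (Y ^ k) (δ * s) ⟩
  (Y + δ) ^ k * Y ^ k + (Y + δ) ^ k * (δ * s)
    ≡⟨ cong (λ u → u * Y ^ k + (Y + δ) ^ k * (δ * s)) (^-difference Y δ k) ⟩
  (Y ^ k + δ * s) * Y ^ k + (Y + δ) ^ k * (δ * s)
    ≡⟨ lemma (Y ^ k) (δ * s) ((Y + δ) ^ k) ⟩
  Y ^ k * Y ^ k + ((Y + δ) ^ k + Y ^ k) * (δ * s)
    ≡⟨ cong₂ (λ u v → u + v * (δ * s)) (sym (square Y)) (odd-power-sum Y δ j) ⟩
  Y ^ (2 * k) + (Y + δ + Y) * t * (δ * s)
    ≡⟨ cong (Y ^ (2 * k) +_) (lemma′ (Y + δ + Y) t δ s) ⟩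
  Y ^ (2 * k) + (Y + δ + Y) * δ * (s * t) ∎)))
  where
  open ≡-Reasoning
  k s t : ℕ
  k = 1 + 2 * j
  s = S (Y + δ) Y k
  t = T Y δ j
  σ>0 : 0 < Y + δ + Y
  σ>0 = ≤-trans Y>0 (m≤n+m Y (Y + δ))
  square : ∀ x → x ^ (2 * k) ≡ x ^ k * x ^ k
  square x = trans (^-distribˡ-+-* x k (k + 0)) (cong (λ i → x ^ k * x ^ i) (+-identityʳ k))
  lemma : ∀ u v w → (u + v) * u + w * v ≡ u * u + (w + u) * v
  lemma = solve-∀
  lemma′ : ∀ a t d s → a * t * (d * s) ≡ a * d * (s * t)
  lemma′ = solve-∀

odd-even-power : ∀ {x k} → Odd x → 2 ∣ k → ∃[ t ] x ^ k ≡ 1 + 4 * t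
odd-even-power {x} {k} ox (divides j refl) with odd⇒1+2* x ox
... | i , refl = go j
  where
  lemma : ∀ i t → (1 + 2 * i) * ((1 + 2 * i) * (1 + 4 * t)) ≡ 1 + 4 * (t + (1 + 4 * t) * (i + i * i))
  lemma = solve-∀
  go : ∀ j → ∃[ t ] (1 + 2 * i) ^ (j * 2) ≡ 1 + 4 * t
  go zero = 0 , refl
  go (suc j) with go j
  ... | t , e = t + (1 + 4 * t) * (i + i * i) , trans (cong (λ u → (1 + 2 * i) * ((1 + 2 * i) * u)) e) (lemma i t)

-- Each of the two powers is 1 modulo 4.
even-powers-sum : ∀ {x y k} → Odd x → Odd y → 2 ∣ k → ¬ (4 ∣ x ^ k + y ^ k)
even-powers-sum {x} {y} {k} ox oy ek d with odd-even-power ox ek | odd-even-power oy ek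
... | s , e | t , f = contra (∣m+n∣m⇒∣n (subst (4 ∣_) (trans (cong₂ _+_ e f) (lemma s t)) d) (m∣m*n (s + t)))
  where
  lemma : ∀ s t → (1 + 4 * s) + (1 + 4 * t) ≡ 4 * (s + t) + 2
  lemma = solve-∀
  contra : ¬ (4 ∣ 2)
  contra h = <⇒≱ (s≤s (s≤s (s≤s z≤n))) (∣-≤ (s≤s z≤n) h)

2*-even : ∀ k → 2 ∣ k → ∃[ j ] k ≡ 2 * j
2*-even k (divides j e) = j , trans e (*-comm j 2)

only-prime-2 : ∀ n → 0 < n → (∀ q → Prime q → q ∣ n → q ≡ 2) → IsPow2 n
only-prime-2 n n>0 h with exact-power 2 (s≤s (s≤s z≤n)) n n>0
... | k , zero , e , o = ⊥-elim (o (2 ∣0))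
... | k , suc zero , e , o = k , trans e (*-identityʳ (2 ^ k))
... | k , suc (suc m) , e , o with prime-factor (suc (suc m)) (s≤s (s≤s z≤n))
... | q , pq , d with h q pq (subst (q ∣_) (sym e) (∣n⇒∣m*n (2 ^ k) d))
... | refl = ⊥-elim (o d)

sum-∣-odd-powers : ∀ {q X Y m} → Y ≤ X → Odd m → q ∣ X + Y → q ∣ X ^ m + Y ^ m
sum-∣-odd-powers {q} {X} {Y} {m} Y≤X om d with m≤n⇒∃[o]m+o≡n Y≤X | odd⇒1+2* m om
... | δ , refl | j , refl = subst (q ∣_) (sym (odd-power-sum Y δ j)) (∣m⇒∣m*n (T Y δ j) d)

sum-∣-even-powers : ∀ {q X Y n} → Y ≤ X → 2 ∣ n → q ∣ X + Y → ∃[ w ] (q ∣ w × X ^ n ≡ Y ^ n + w)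
sum-∣-even-powers {q} {X} {Y} {n} Y≤X en d with m≤n⇒∃[o]m+o≡n Y≤X | 2*-even n en
... | δ , refl | i , refl = _ , ∣m⇒∣m*n (δ * S ((Y + δ) ^ 2) (Y ^ 2) i) d , even-power-difference Y δ i

-- If n is even and m odd, X^(nm) is congruent to both Y^(nm) and -Y^(nm) modulo q.
opposite-parity : ∀ {q} → Prime q → ∀ {X Y n m} → Y ≤ X → Coprime X Y → 2 ∣ n → Odd m →
  q ∣ X ^ n + Y ^ n → q ∣ X ^ m + Y ^ m → q ≡ 2
opposite-parity {q} pq {X} {Y} {n} {m} Y≤X c en om dn dm
  with sum-∣-even-powers {n = n} (^-monoˡ-≤ m Y≤X) en dm
... | w , q∣w , e = conclude (euclidsLemma 2 (Y ^ (m * n)) pq (∣m+n∣m⇒∣n (subst (q ∣_) rearrange plus) q∣w))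
  where
  plus : q ∣ (X ^ n) ^ m + (Y ^ n) ^ m
  plus = sum-∣-odd-powers {m = m} (^-monoˡ-≤ n Y≤X) om dn
  lemma : ∀ u v → (u + v) + u ≡ v + 2 * u
  lemma = solve-∀
  rearrange : (X ^ n) ^ m + (Y ^ n) ^ m ≡ w + 2 * Y ^ (m * n)
  rearrange = trans (cong₂ _+_ (trans (^-^-comm X n m) e) (^-^-comm Y n m))
    (trans (lemma ((Y ^ m) ^ n) w) (cong (λ u → w + 2 * u) (^-*-assoc Y m n)))
  conclude : q ∣ 2 ⊎ q ∣ Y ^ (m * n) → q ≡ 2
  conclude (inj₁ f) = prime-∣-prime pq prime[2] f
  conclude (inj₂ f) = ⊥-elim (coprime-prime c pq (prime-∣^ pq X m (∣m+n∣m⇒∣n (subst (q ∣_) (+-comm (X ^ m) (Y ^ m)) dm)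
      (∣-trans q∣Y (base∣^ Y (odd-pos om))))) q∣Y)
    where
    q∣Y : q ∣ Y
    q∣Y = prime-∣^ pq Y (m * n) f

-- The counterpart of `difference-growth` with the inequality reversed: for sums, the quotient
-- `c ^ s` appears on the side of the larger exponent.
sum-growth : ∀ {A B n r} → 0 < B → B ≤ A → 0 < r →
  (A ^ (n + r) + B ^ (n + r)) ^ n < (A ^ n + B ^ n) ^ (n + r)
sum-growth {A} {B} {n} {r} B>0 B≤A r>0 = begin-strict
  (A ^ (n + r) + B ^ (n + r)) ^ n  ≤⟨ ^-monoˡ-≤ n bound ⟩
  (P * A ^ r) ^ n                  ≡⟨ ^-distribʳ-* n P (A ^ r) ⟩
  P ^ n * (A ^ r) ^ n              ≡⟨ cong (P ^ n *_) (^-^-comm A r n) ⟩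
  P ^ n * (A ^ n) ^ r              <⟨ *-monoʳ-< (P ^ n) {{>-nonZero (^-pos n P>0)}} (^-monoˡ-< r {{>-nonZero r>0}} (m<m+n (A ^ n) (^-pos n B>0))) ⟩
  P ^ n * P ^ r                    ≡⟨ sym (^-distribˡ-+-* P n r) ⟩
  P ^ (n + r)                      ∎
  where
  open ≤-Reasoning
  P : ℕ
  P = A ^ n + B ^ n
  P>0 : 0 < P
  P>0 = ≤-trans (^-pos n B>0) (m≤n+m (B ^ n) (A ^ n))
  bound : A ^ (n + r) + B ^ (n + r) ≤ P * A ^ r
  bound = begin
    A ^ (n + r) + B ^ (n + r)         ≡⟨ cong₂ _+_ (^-distribˡ-+-* A n r) (^-distribˡ-+-* B n r) ⟩
    A ^ n * A ^ r + B ^ n * B ^ r     ≤⟨ +-monoʳ-≤ (A ^ n * A ^ r) (*-monoʳ-≤ (B ^ n) (^-monoˡ-≤ r B≤A)) ⟩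
    A ^ n * A ^ r + B ^ n * A ^ r     ≡⟨ sym (*-distribʳ-+ (A ^ r) (A ^ n) (B ^ n)) ⟩
    P * A ^ r                         ∎

2*[4+i]≤2^[3+i] : ∀ i → 2 * (4 + i) ≤ 2 ^ (3 + i)
2*[4+i]≤2^[3+i] zero = ≤-refl
2*[4+i]≤2^[3+i] (suc i) = *-monoʳ-≤ 2 (begin
  4 + suc i      ≡⟨ +-comm 4 (suc i) ⟩
  1 + i + 4      ≤⟨ +-monoˡ-≤ 4 (m≤n+m (1 + i) 3) ⟩
  3 + (1 + i) + 4  ≤⟨ m≤m+n _ i ⟩
  3 + (1 + i) + 4 + i ≡⟨ lemma i ⟩
  2 * (4 + i)    ≤⟨ 2*[4+i]≤2^[3+i] i ⟩
  2 ^ (3 + i)    ∎)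
  where
  open ≤-Reasoning
  lemma : ∀ i → 3 + (1 + i) + 4 + i ≡ 2 * (4 + i)
  lemma = solve-∀

-- Dividing by `X` gives X^(m-1) < 2m. As `X ≥ 2`, this fails from `m = 4` on, and `m = 3` leaves
-- `X ^ 2 < 6`.
power-sum-small : ∀ {X Y m} → 0 < Y → Y < X → 2 < m → X ^ m + Y ^ m ≤ (X + Y) * m → X ≡ 2 × Y ≡ 1 × m ≡ 3
power-sum-small {X} {Y} {suc m} Y>0 Y<X (s≤s m>1) h = go m m>1 X^m<2m
  where
  X>0 : 0 < X
  X>0 = <-trans Y>0 Y<X
  X^m<2m : X ^ m < 2 * suc m
  X^m<2m = *-cancelˡ-< X (X ^ m) (2 * suc m) (begin-strict
    X ^ suc m              <⟨ m<m+n (X ^ suc m) (^-pos (suc m) Y>0) ⟩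
    X ^ suc m + Y ^ suc m  ≤⟨ h ⟩
    (X + Y) * suc m        ≤⟨ *-monoˡ-≤ (suc m) (+-monoʳ-≤ X (<⇒≤ Y<X)) ⟩
    (X + X) * suc m        ≡⟨ lemma X (suc m) ⟩
    X * (2 * suc m)        ∎)
    where
    open ≤-Reasoning
    lemma : ∀ x m → (x + x) * m ≡ x * (2 * m)
    lemma = solve-∀
  go : ∀ m → 1 < m → X ^ m < 2 * suc m → X ≡ 2 × Y ≡ 1 × suc m ≡ 3
  go (suc zero) (s≤s ()) _
  go (suc (suc zero)) _ g = X≡2 , Y≡1 , refl
    where
    X<3 : X < 3
    X<3 with X <? 3
    ... | yes p = p
    ... | no p = ⊥-elim (<⇒≱ g (≤-trans (m≤n+m 6 3) (^-monoˡ-≤ 2 (≮⇒≥ p))))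
    X≡2 : X ≡ 2
    X≡2 = ≤-antisym (≤-pred X<3) (≤-trans (s≤s Y>0) Y<X)
    Y≡1 : Y ≡ 1
    Y≡1 = ≤-antisym (≤-pred (subst (Y <_) X≡2 Y<X)) Y>0
  go (suc (suc (suc m))) _ g = ⊥-elim (<⇒≱ g (≤-trans (2*[4+i]≤2^[3+i] m)
    (^-monoˡ-≤ (3 + m) (≤-trans (s≤s Y>0) Y<X))))

-- For even `m` the sum exceeds 4 but is 2 modulo 4. For odd `m` the cofactor `T` of `X + Y` is an
-- odd divisor of a power of 2, hence 1, although the sum exceeds `X + Y`.
power-sum≢2^ : ∀ {X Y m} → 0 < Y → Y < X → Coprime X Y → 1 < m → ¬ IsPow2 (X ^ m + Y ^ m)
power-sum≢2^ {X} {Y} {m} Y>0 Y<X c m>1 (e , f) with 2 ∣? m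
... | yes em = even-powers-sum oX oY em 4∣
  where
  X>1 : 1 < X
  X>1 = ≤-trans (s≤s Y>0) Y<X
  4∣ : 4 ∣ X ^ m + Y ^ m
  4∣ = subst (4 ∣_) (sym f) (^-monoʳ-∣ 2 {2} {e} (<⇒≤ (^-cancelʳ-< {2} (s≤s z≤n)
    (subst (4 <_) f (≤-<-trans (≤-trans (^-monoˡ-≤ 2 X>1) (^-monoʳ-≤ X {{>-nonZero (<⇒≤ X>1)}} m>1)) (m<m+n (X ^ m) (^-pos m Y>0)))))))
  2∣ : 2 ∣ X ^ m + Y ^ m
  2∣ = ∣-trans (m∣m*n 2) 4∣
  oX : Odd X
  oX d = coprime-prime c prime[2] d (prime-∣^ prime[2] Y m (∣m+n∣m⇒∣n 2∣ (∣-trans d (base∣^ X (<-trans (s≤s z≤n) m>1)))))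
  oY : Odd Y
  oY d = coprime-prime c prime[2] (prime-∣^ prime[2] X m (∣m+n∣m⇒∣n (subst (2 ∣_) (+-comm (X ^ m) (Y ^ m)) 2∣) (∣-trans d (base∣^ Y (<-trans (s≤s z≤n) m>1))))) d
... | no om with m≤n⇒∃[o]m+o≡n (<⇒≤ Y<X) | odd⇒1+2* m om
... | δ , refl | j , refl = <⇒≢ (+-mono-<-≤ (base<^ X>1 m>1) (subst (_≤ Y ^ m) (*-identityʳ Y) (^-monoʳ-≤ Y {{>-nonZero Y>0}} {1} (<⇒≤ m>1))))
    (sym (trans (odd-power-sum Y δ j) (trans (cong ((Y + δ + Y) *_) T≡1) (*-identityʳ _))))
  where
  X>1 : 1 < Y + δ
  X>1 = ≤-trans (s≤s Y>0) Y<X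
  T∣ : T Y δ j ∣ 2 ^ e
  T∣ = subst (T Y δ j ∣_) f (subst (T Y δ j ∣_) (sym (odd-power-sum Y δ j)) (n∣m*n (Y + δ + Y)))
  oY : Odd Y
  oY d = coprime-prime c prime[2] (prime-∣^ prime[2] (Y + δ) m (∣m+n∣m⇒∣n (subst (2 ∣_) (+-comm ((Y + δ) ^ m) (Y ^ m)) 2∣) (∣-trans d (base∣^ Y (<-trans (s≤s z≤n) m>1))))) d
    where
    2∣ : 2 ∣ (Y + δ) ^ m + Y ^ m
    2∣ = subst (2 ∣_) (sym f) (base∣^ 2 {e} (^-cancelʳ-< {2} (s≤s z≤n) {0} {e} (subst (1 <_) f
           (≤-trans (1<^ X>1 (<-trans (s≤s z≤n) m>1)) (m≤m+n _ (Y ^ m))))))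
  T≡1 : T Y δ j ≡ 1
  T≡1 = odd∣2^⇒1 e (T-odd j oY) T∣

-- The equation is what two solutions leave once the gcd of the bases and the exponents of `c` are
-- eliminated. Every prime of the `m`-th sum divides the `n`-th; opposite parities allow only the
-- prime 2. For odd exponents lifting yields `Tm ∣ m`, so the `m`-th sum is at most `(X + Y) * m`.
two-coprime-sums : ∀ {X Y n m c s} → 0 < Y → Y < X → Coprime X Y → 0 < n → n < m → Coprime n m → 1 < c → 0 < s →
  (X ^ n + Y ^ n) ^ m ≡ (X ^ m + Y ^ m) ^ n * c ^ s → X ≡ 2 × Y ≡ 1 × n ≡ 1 × m ≡ 3 × c ≡ 3
two-coprime-sums {X} {Y} {n} {m} {c} {s} Y>0 Y<X cXY n>0 n<m cnm c>1 s>0 e = cases (2 ∣? n) (2 ∣? m)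
  where
  m>1 : 1 < m
  m>1 = ≤-trans (s≤s n>0) n<m
  sum>0 : ∀ k → 0 < X ^ k + Y ^ k
  sum>0 k = ≤-trans (^-pos k Y>0) (m≤n+m (Y ^ k) (X ^ k))
  transfer : ∀ q → Prime q → q ∣ X ^ m + Y ^ m → q ∣ X ^ n + Y ^ n
  transfer q pq d = prime-∣^ pq (X ^ n + Y ^ n) m (subst (q ∣_) (sym e) (∣m⇒∣m*n (c ^ s) (∣-trans d (base∣^ _ n>0))))
  opposite : (∀ q → Prime q → q ∣ X ^ m + Y ^ m → q ≡ 2) → ⊥
  opposite h = power-sum≢2^ Y>0 Y<X cXY m>1 (only-prime-2 _ (sum>0 m) h)
  3-power : c ^ s ≡ 3 → c ≡ 3
  3-power f = small c (subst (c ∣_) f (base∣^ c s>0)) c>1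
    where
    small : ∀ c → c ∣ 3 → 1 < c → c ≡ 3
    small zero d _ = ⊥-elim (<⇒≢ (s≤s z≤n) (sym (0∣⇒≡0 d)))
    small (suc zero) d (s≤s ())
    small (suc (suc zero)) d _ = ⊥-elim (1+2*-odd 1 d)
    small (suc (suc (suc zero))) d _ = refl
    small (suc (suc (suc (suc c)))) d _ = ⊥-elim (<⇒≱ (s≤s (s≤s (s≤s (s≤s z≤n)))) (∣-≤ (s≤s z≤n) d))
  both-odd : ∀ i j → n ≡ 1 + 2 * i → m ≡ 1 + 2 * j → X ≡ 2 × Y ≡ 1 × n ≡ 1 × m ≡ 3 × c ≡ 3
  both-odd i j en em with split-< Y<X
  ... | δ , X≡ , δ>0 = finish (power-sum-small Y>0 Y<X m>2 bound)
    where
    σ Tn Tm : ℕ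
    σ = X + Y
    Tn = T Y δ i
    Tm = T Y δ j
    m>2 : 2 < m
    m>2 = ≤∧≢⇒< m>1 (λ f → 1+2*-odd j (subst (2 ∣_) (trans f em) ∣-refl))
    σ>0 : 0 < σ
    σ>0 = ≤-trans Y>0 (m≤n+m Y X)
    sum-n : X ^ n + Y ^ n ≡ σ * Tn
    sum-n = trans (cong₂ (λ x k → x ^ k + Y ^ k) X≡ en) (trans (odd-power-sum Y δ i) (cong (λ x → (x + Y) * Tn) (sym X≡)))
    sum-m : X ^ m + Y ^ m ≡ σ * Tm
    sum-m = trans (cong₂ (λ x k → x ^ k + Y ^ k) X≡ em) (trans (odd-power-sum Y δ j) (cong (λ x → (x + Y) * Tm) (sym X≡)))
    T∣S-n : Tn ∣ S (X ^ 2) (Y ^ 2) n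
    T∣S-n = subst₂ (λ x k → Tn ∣ S (x ^ 2) (Y ^ 2) k) (sym X≡) (sym en) (T∣S Y δ i Y>0 δ>0)
    T∣S-m : Tm ∣ S (X ^ 2) (Y ^ 2) m
    T∣S-m = subst₂ (λ x k → Tm ∣ S (x ^ 2) (Y ^ 2) k) (sym X≡) (sym em) (T∣S Y δ j Y>0 δ>0)
    Tm>0 : 0 < Tm
    Tm>0 = T-pos j Y>0
    coprime-squares : Coprime (X ^ 2) (Y ^ 2)
    coprime-squares = coprime-^ (<-trans Y>0 Y<X) cXY 2 2
    coprime-T : ∀ {q} → Prime q → q ∣ Tm → q ∣ Tn → ⊥
    coprime-T pq d f = coprime-prime (S-coprime (^-pos 2 Y>0) coprime-squares n>0 (<-trans n>0 n<m) cnm) pq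
      (∣-trans f T∣S-n) (∣-trans d T∣S-m)
    -- σ^m Tn^m = σ^n Tm^n c^s, so a prime of Tm divides σ Tn, hence σ.
    rad-σ : ∀ q → Prime q → q ∣ Tm → q ∣ σ
    rad-σ q pq d with euclidsLemma σ Tn pq (subst (q ∣_) sum-n (transfer q pq (subst (q ∣_) (sym sum-m) (∣n⇒∣m*n σ d))))
    ... | inj₁ f = f
    ... | inj₂ f = ⊥-elim (coprime-T pq d f)
    coprime-TY : ∀ q → Prime q → q ∣ Tm → q ∣ Y → ⊥
    coprime-TY q pq d f = coprime-prime cXY pq (∣m+n∣m⇒∣n (subst (q ∣_) (+-comm X Y) (rad-σ q pq d)) f) f
    Tm-odd : Odd Tm
    Tm-odd d = T-odd {Y} {δ} j (coprime-TY 2 prime[2] d) d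
    X²≡ : X ^ 2 ≡ Y ^ 2 + δ * σ
    X²≡ = trans (cong (_^ 2) X≡) (trans (square-difference Y δ) (cong (λ x → Y ^ 2 + δ * (x + Y)) (sym X≡)))
    Tm∣m : Tm ∣ m
    Tm∣m = subst (Tm ∣_) (*-identityˡ m) (lte (<-trans n>0 n<m) {Y ^ 2} {δ * σ} {Tm} {1} Tm>0
      (coprime-from-primes Tm>0 (λ q pq d f → coprime-TY q pq d (prime-∣^ pq Y 2 f)))
      (λ q pq d → ∣n⇒∣m*n δ (rad-σ q pq d)) (λ d → ⊥-elim (Tm-odd d))
      (subst (Tm ∣_) (trans (cong (λ x → S x (Y ^ 2) m) X²≡) (sym (*-identityˡ _))) T∣S-m))
    bound : X ^ m + Y ^ m ≤ (X + Y) * m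
    bound = subst (_≤ σ * m) (sym sum-m) (*-monoʳ-≤ σ (∣-≤ (<-trans n>0 n<m) Tm∣m))
    finish : X ≡ 2 × Y ≡ 1 × m ≡ 3 → X ≡ 2 × Y ≡ 1 × n ≡ 1 × m ≡ 3 × c ≡ 3
    finish (X≡2 , Y≡1 , m≡3) = X≡2 , Y≡1 , n≡1 , m≡3 , 3-power (cancelˡ {9} (s≤s z≤n) (sym (numeric X≡2 Y≡1 n≡1 m≡3 e)))
      where
      n≡1 : n ≡ 1
      n≡1 = one n en (subst (n <_) m≡3 n<m)
        where
        one : ∀ n → n ≡ 1 + 2 * i → n < 3 → n ≡ 1
        one zero ()
        one (suc zero) _ _ = refl
        one (suc (suc zero)) f _ = ⊥-elim (1+2*-odd i (subst (2 ∣_) f ∣-refl))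
        one (suc (suc (suc _))) _ (s≤s (s≤s (s≤s ())))
      numeric : ∀ {X Y n m} → X ≡ 2 → Y ≡ 1 → n ≡ 1 → m ≡ 3 →
        (X ^ n + Y ^ n) ^ m ≡ (X ^ m + Y ^ m) ^ n * c ^ s → 27 ≡ 9 * c ^ s
      numeric refl refl refl refl f = f
  cases : Dec (2 ∣ n) → Dec (2 ∣ m) → X ≡ 2 × Y ≡ 1 × n ≡ 1 × m ≡ 3 × c ≡ 3
  cases (yes en) (yes em) = ⊥-elim (coprime-prime cnm prime[2] en em)
  cases (yes en) (no om) = ⊥-elim (opposite λ q pq d → opposite-parity pq {n = n} {m = m} (<⇒≤ Y<X) cXY en om (transfer q pq d) d)
  cases (no on) (yes em) = ⊥-elim (opposite λ q pq d → opposite-parity pq {n = m} {m = n} (<⇒≤ Y<X) cXY em on d (transfer q pq d))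
  cases (no on) (no om) with odd⇒1+2* n on | odd⇒1+2* m om
  ... | i , en | j , em = both-odd i j en em

TwoSums : ℕ → ℕ → ℕ → ℕ → ℕ → Set
TwoSums A B c n m = (IsPow2 A × IsPow2 B × IsPow2 c)
  ⊎ (n ≡ 1 × m ≡ 3 × c ≡ 3 × ∃[ D ] ((A ≡ D * 2 × B ≡ D) ⊎ (A ≡ D × B ≡ D * 2)))

two-sums-ordered : ∀ {A B c n m z₁ z₂} → 1 < c → 0 < B → B ≤ A → 0 < n → n < m → Coprime n m →
  A ^ n + B ^ n ≡ c ^ z₁ → A ^ m + B ^ m ≡ c ^ z₂ → TwoSums A B c n m
two-sums-ordered {A} {B} {c} {n} {m} {z₁} {z₂} c>1 B>0 B≤A n>0 n<m cnm e₁ e₂ with split-< n<m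
... | r , refl , r>0 with gcd-split B A B>0
... | D , Y , X , refl , refl , cYX with <-cmp Y X
... | tri> _ _ X<Y = ⊥-elim (<⇒≱ X<Y (*-cancelˡ-≤ D {{>-nonZero (*-pos⁻¹ˡ B>0)}} B≤A))
... | tri< Y<X _ _ = inj₂ (conclude (two-coprime-sums (*-pos⁻¹ʳ D B>0) Y<X (coprime-sym cYX) n>0 n<m cnm c>1 s>0 (cancelˡ (^-pos (n * m) (*-pos⁻¹ˡ B>0)) key)))
  where
  c>0 : 0 < c
  c>0 = <-trans (s≤s z≤n) c>1
  gap : ∃[ s ] (z₁ * m ≡ z₂ * n + s × 0 < s)
  gap = split-< (^-cancelʳ-< c>0 (subst₂ _<_ (trans (cong (_^ n) e₂) (^-*-assoc c z₂ n)) (trans (cong (_^ m) e₁) (^-*-assoc c z₁ m))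
    (sum-growth {n = n} B>0 B≤A r>0)))
  s : ℕ
  s = proj₁ gap
  s>0 : 0 < s
  s>0 = proj₂ (proj₂ gap)
  factor : ∀ k → (D * X) ^ k + (D * Y) ^ k ≡ D ^ k * (X ^ k + Y ^ k)
  factor k = trans (cong₂ _+_ (^-distribʳ-* k D X) (^-distribʳ-* k D Y)) (sym (*-distribˡ-+ (D ^ k) (X ^ k) (Y ^ k)))
  expand : ∀ i j → ((D * X) ^ i + (D * Y) ^ i) ^ j ≡ D ^ (i * j) * (X ^ i + Y ^ i) ^ j
  expand i j = trans (cong (_^ j) (factor i)) (trans (^-distribʳ-* j (D ^ i) (X ^ i + Y ^ i)) (cong (_* (X ^ i + Y ^ i) ^ j) (^-*-assoc D i j)))
  key : D ^ (n * m) * (X ^ n + Y ^ n) ^ m ≡ D ^ (n * m) * ((X ^ m + Y ^ m) ^ n * c ^ s)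
  key = begin
    D ^ (n * m) * (X ^ n + Y ^ n) ^ m             ≡⟨ sym (expand n m) ⟩
    ((D * X) ^ n + (D * Y) ^ n) ^ m               ≡⟨ cong (_^ m) e₁ ⟩
    (c ^ z₁) ^ m                                  ≡⟨ ^-*-assoc c z₁ m ⟩
    c ^ (z₁ * m)                                  ≡⟨ cong (c ^_) (proj₁ (proj₂ gap)) ⟩
    c ^ (z₂ * n + s)                              ≡⟨ ^-distribˡ-+-* c (z₂ * n) s ⟩
    c ^ (z₂ * n) * c ^ s                          ≡⟨ cong (_* c ^ s) (trans (sym (^-*-assoc c z₂ n)) (cong (_^ n) (sym e₂))) ⟩
    ((D * X) ^ m + (D * Y) ^ m) ^ n * c ^ s       ≡⟨ cong (_* c ^ s) (expand m n) ⟩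
    D ^ (m * n) * (X ^ m + Y ^ m) ^ n * c ^ s     ≡⟨ *-assoc (D ^ (m * n)) _ _ ⟩
    D ^ (m * n) * ((X ^ m + Y ^ m) ^ n * c ^ s)   ≡⟨ cong (λ k → D ^ k * ((X ^ m + Y ^ m) ^ n * c ^ s)) (*-comm m n) ⟩
    D ^ (n * m) * ((X ^ m + Y ^ m) ^ n * c ^ s)   ∎
    where open ≡-Reasoning
  conclude : X ≡ 2 × Y ≡ 1 × n ≡ 1 × m ≡ 3 × c ≡ 3 → _
  conclude (X≡2 , Y≡1 , n≡1 , m≡3 , c≡3) = n≡1 , m≡3 , c≡3 , D , inj₁ (cong (D *_) X≡2 , trans (cong (D *_) Y≡1) (*-identityʳ D))
-- Coprimality makes both reduced bases 1, so the sums are `2 * D ^ n` and `2 * D ^ m`. Eliminating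
-- `D` gives `2 ^ m = 2 ^ n * c ^ s`: `c` is a power of 2, and then so is `D`.
... | tri≈ _ refl _ = inj₁ (D-pow , D-pow , c-pow)
  where
  c>0 : 0 < c
  c>0 = <-trans (s≤s z≤n) c>1
  Y≡1 : Y ≡ 1
  Y≡1 = cYX (∣-refl , ∣-refl)
  D>0 : 0 < D
  D>0 = *-pos⁻¹ˡ B>0
  DY≡D : D * Y ≡ D
  DY≡D = trans (cong (D *_) Y≡1) (*-identityʳ D)
  double : ∀ k → (D * Y) ^ k + (D * Y) ^ k ≡ 2 * D ^ k
  double k = trans (cong (λ x → x ^ k + x ^ k) DY≡D) (cong (D ^ k +_) (sym (+-identityʳ (D ^ k))))
  gap : ∃[ s ] (z₁ * m ≡ z₂ * n + s × 0 < s)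
  gap = split-< (^-cancelʳ-< c>0 (subst₂ _<_ (trans (cong (_^ n) e₂) (^-*-assoc c z₂ n)) (trans (cong (_^ m) e₁) (^-*-assoc c z₁ m))
    (sum-growth {n = n} B>0 B≤A r>0)))
  s : ℕ
  s = proj₁ gap
  key : 2 ^ m ≡ 2 ^ n * c ^ s
  key = cancelʳ (^-pos (n * m) D>0) (begin
    2 ^ m * D ^ (n * m)                           ≡⟨ cong (2 ^ m *_) (sym (^-*-assoc D n m)) ⟩
    2 ^ m * (D ^ n) ^ m                           ≡⟨ sym (^-distribʳ-* m 2 (D ^ n)) ⟩
    (2 * D ^ n) ^ m                               ≡⟨ cong (_^ m) (trans (sym (double n)) e₁) ⟩
    (c ^ z₁) ^ m                                  ≡⟨ ^-*-assoc c z₁ m ⟩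
    c ^ (z₁ * m)                                  ≡⟨ cong (c ^_) (proj₁ (proj₂ gap)) ⟩
    c ^ (z₂ * n + s)                              ≡⟨ ^-distribˡ-+-* c (z₂ * n) s ⟩
    c ^ (z₂ * n) * c ^ s                          ≡⟨ cong (_* c ^ s) (trans (sym (^-*-assoc c z₂ n)) (cong (_^ n) (trans (sym e₂) (double m)))) ⟩
    (2 * D ^ m) ^ n * c ^ s                       ≡⟨ cong (_* c ^ s) (trans (^-distribʳ-* n 2 (D ^ m)) (cong (2 ^ n *_) (trans (^-*-assoc D m n) (cong (D ^_) (*-comm m n))))) ⟩
    2 ^ n * D ^ (n * m) * c ^ s                   ≡⟨ lemma (2 ^ n) (D ^ (n * m)) (c ^ s) ⟩
    2 ^ n * c ^ s * D ^ (n * m)                   ∎)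
    where
    open ≡-Reasoning
    lemma : ∀ a b c → a * b * c ≡ a * c * b
    lemma = solve-∀
  c-pow : IsPow2 c
  c-pow = ∣2^⇒2^ m c (subst (c ∣_) (sym key) (∣n⇒∣m*n (2 ^ n) (base∣^ c (proj₂ (proj₂ gap)))))
  D-pow : IsPow2 (D * Y)
  D-pow with c-pow
  ... | k , refl = ∣2^⇒2^ (k * z₁) (D * Y) (subst₂ _∣_ (sym DY≡D) (trans (sym (double n)) (trans e₁ (^-*-assoc 2 k z₁))) (∣n⇒∣m*n 2 (base∣^ D n>0)))

two-sums : ∀ {A B c n m z₁ z₂} → 1 < c → 0 < A → 0 < B → 0 < n → n < m → Coprime n m →
  A ^ n + B ^ n ≡ c ^ z₁ → A ^ m + B ^ m ≡ c ^ z₂ → TwoSums A B c n m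
two-sums {A} {B} {c} {n} {m} {z₁} {z₂} c>1 A>0 B>0 n>0 n<m cnm e₁ e₂ with ≤-total B A
... | inj₁ B≤A = two-sums-ordered {z₁ = z₁} {z₂} c>1 B>0 B≤A n>0 n<m cnm e₁ e₂
... | inj₂ A≤B with two-sums-ordered {z₁ = z₁} {z₂} c>1 A>0 A≤B n>0 n<m cnm (trans (+-comm (B ^ n) (A ^ n)) e₁) (trans (+-comm (B ^ m) (A ^ m)) e₂)
... | inj₁ (p , q , r) = inj₁ (q , p , r)
... | inj₂ (p , q , r , D , inj₁ (f , g)) = inj₂ (p , q , r , D , inj₂ (g , f))
... | inj₂ (p , q , r , D , inj₂ (f , g)) = inj₂ (p , q , r , D , inj₁ (g , f))

-- Proportional pairs of solutions of the given equation

-- `two-differences` forces the smaller of the coprime exponents to be 1. The smaller solution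
-- therefore generates the larger, and the normal form can be stated at `b ^ y₁` and `c ^ z₁`
-- themselves.
proportional-bc : ∀ {a b c x₁ y₁ z₁ x₂ y₂ z₂} → 1 < a → 1 < b →
  Sol a b c (x₁ , y₁ , z₁) → Sol a b c (x₂ , y₂ , z₂) → y₁ * z₂ ≡ y₂ * z₁ → y₁ < y₂ →
  ∃[ k ] (1 < k × y₂ ≡ k * y₁ × z₂ ≡ k * z₁ × Lifted a (b ^ y₁) (c ^ z₁) x₁ k x₂)
proportional-bc {a} {b} {c} {x₁} {y₁} {z₁} {x₂} {y₂} {z₂} a>1 b>1 (_ , y₁>0 , z₁>0 , e₁) (_ , _ , _ , e₂) prop y₁<y₂
  with proportional {y₁} {y₂} {z₁} {z₂} y₁>0 prop
... | n , m , y₀ , z₀ , refl , refl , refl , refl , cnm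
  with two-differences {a} {b ^ y₀} {c ^ z₀} {n} {m} {x₁} {x₂} a>1 (^-pos y₀ (<-trans (s≤s z≤n) b>1)) (*-pos⁻¹ʳ y₀ y₁>0)
    (*-cancelˡ-< y₀ n m y₁<y₂) cnm (reshape {x₁} n e₁) (reshape {x₂} m e₂)
  where
  reshape : ∀ {x} k → a ^ x + b ^ (y₀ * k) ≡ c ^ (z₀ * k) → a ^ x + (b ^ y₀) ^ k ≡ (c ^ z₀) ^ k
  reshape {x} k e = trans (cong (a ^ x +_) (^-*-assoc b y₀ k)) (trans e (sym (^-*-assoc c z₀ k)))
... | refl , L = m , *-cancelˡ-< y₀ 1 m y₁<y₂ , unit y₀ , unit z₀ ,
    subst₂ (λ u v → Lifted a (b ^ u) (c ^ v) x₁ m x₂) (sym (*-identityʳ y₀)) (sym (*-identityʳ z₀)) L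
  where
  unit : ∀ u → u * m ≡ m * (u * 1)
  unit u = trans (*-comm u m) (cong (m *_) (sym (*-identityʳ u)))

IsPow2-root : ∀ {a x} → 0 < x → IsPow2 (a ^ x) → IsPow2 a
IsPow2-root {a} {x} x>0 (k , e) = ∣2^⇒2^ k a (subst (a ∣_) e (base∣^ a x>0))

proportional-ab : ∀ {a b c x₁ y₁ z₁ x₂ y₂ z₂} → 1 < a → 1 < b → 1 < c →
  Sol a b c (x₁ , y₁ , z₁) → Sol a b c (x₂ , y₂ , z₂) → x₁ * y₂ ≡ x₂ * y₁ → x₁ < x₂ →
  (IsPow2 a × IsPow2 b × IsPow2 c) ⊎
  (x₂ ≡ 3 * x₁ × y₂ ≡ 3 * y₁ × c ≡ 3 ×
    ∃[ t ] (0 < t × ((a ^ x₁ ≡ 2 * 3 ^ t × b ^ y₁ ≡ 3 ^ t) ⊎ (b ^ y₁ ≡ 2 * 3 ^ t × a ^ x₁ ≡ 3 ^ t))))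
proportional-ab {a} {b} {c} {x₁} {y₁} {z₁} {x₂} {y₂} {z₂} a>1 b>1 c>1 (x₁>0 , y₁>0 , z₁>0 , e₁) (_ , _ , _ , e₂) prop x₁<x₂
  with proportional {x₁} {x₂} {y₁} {y₂} x₁>0 prop
... | n , m , x₀ , y₀ , refl , refl , refl , refl , cnm = conclude
  (two-sums {z₁ = z₁} {z₂} c>1 (^-pos x₀ (<-trans (s≤s z≤n) a>1)) (^-pos y₀ (<-trans (s≤s z≤n) b>1)) (*-pos⁻¹ʳ x₀ x₁>0)
    (*-cancelˡ-< x₀ n m x₁<x₂) cnm
    (trans (cong₂ _+_ (^-*-assoc a x₀ n) (^-*-assoc b y₀ n)) e₁)
    (trans (cong₂ _+_ (^-*-assoc a x₀ m) (^-*-assoc b y₀ m)) e₂))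
  where
  Goal : Set
  Goal = (IsPow2 a × IsPow2 b × IsPow2 c) ⊎
    (x₀ * m ≡ 3 * (x₀ * n) × y₀ * m ≡ 3 * (y₀ * n) × c ≡ 3 ×
      ∃[ t ] (0 < t × ((a ^ (x₀ * n) ≡ 2 * 3 ^ t × b ^ (y₀ * n) ≡ 3 ^ t) ⊎ (b ^ (y₀ * n) ≡ 2 * 3 ^ t × a ^ (x₀ * n) ≡ 3 ^ t))))
  three-power : ∀ {D z} → 1 < D → 3 * D ≡ 3 ^ z → ∃[ t ] (0 < t × D ≡ 3 ^ t)
  three-power {D} {zero} D>1 e = ⊥-elim (<⇒≢ (≤-trans (s≤s (s≤s z≤n)) (*-monoʳ-≤ 3 (<⇒≤ D>1))) (sym e))
  three-power {D} {suc zero} D>1 e = ⊥-elim (<⇒≢ D>1 (sym (cancelˡ {3} (s≤s z≤n) e)))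
  three-power {D} {suc (suc t)} D>1 e = suc t , s≤s z≤n , cancelˡ {3} (s≤s z≤n) e
  triple : ∀ u → n ≡ 1 → m ≡ 3 → u * m ≡ 3 * (u * n)
  triple u refl refl = trans (*-comm u 3) (cong (3 *_) (sym (*-identityʳ u)))
  root : ∀ v w → n ≡ 1 → v ^ (w * n) ≡ v ^ w
  root v w refl = cong (v ^_) (*-identityʳ w)
  lemma : ∀ D → D * 2 + D ≡ 3 * D
  lemma = solve-∀
  conclude : TwoSums (a ^ x₀) (b ^ y₀) c n m → Goal
  conclude (inj₁ (p , q , r)) = inj₁ (IsPow2-root {x = x₀} (*-pos⁻¹ˡ x₁>0) p , IsPow2-root {x = y₀} (*-pos⁻¹ˡ y₁>0) q , r)
  conclude (inj₂ (n≡1 , m≡3 , c≡3 , D , inj₁ (p , q)))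
    with three-power {D} {z₁} (subst (1 <_) q (1<^ {n = y₀} b>1 (*-pos⁻¹ˡ y₁>0)))
      (trans (sym (lemma D)) (trans (cong₂ _+_ (trans (sym p) (sym (root a x₀ n≡1))) (trans (sym q) (sym (root b y₀ n≡1)))) (trans e₁ (cong (_^ z₁) c≡3))))
  ... | t , t>0 , D≡ = inj₂ (triple x₀ n≡1 m≡3 , triple y₀ n≡1 m≡3 , c≡3 , t , t>0 ,
      inj₁ (trans (root a x₀ n≡1) (trans p (trans (*-comm D 2) (cong (2 *_) D≡))) , trans (root b y₀ n≡1) (trans q D≡)))
  conclude (inj₂ (n≡1 , m≡3 , c≡3 , D , inj₂ (p , q)))
    with three-power {D} {z₁} (subst (1 <_) p (1<^ {n = x₀} a>1 (*-pos⁻¹ˡ x₁>0)))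
      (trans (sym (lemma D)) (trans (cong₂ _+_ (trans (sym q) (sym (root b y₀ n≡1))) (trans (sym p) (sym (root a x₀ n≡1))))
        (trans (+-comm (b ^ (y₀ * n)) _) (trans e₁ (cong (_^ z₁) c≡3)))))
  ... | t , t>0 , D≡ = inj₂ (triple x₀ n≡1 m≡3 , triple y₀ n≡1 m≡3 , c≡3 , t , t>0 ,
      inj₂ (trans (root b y₀ n≡1) (trans q (trans (*-comm D 2) (cong (2 *_) D≡))) , trans (root a x₀ n≡1) (trans p D≡)))

-- Local types at a prime

record Local (a b c : ℕ) : Set where
  constructor local
  field
    p : ℕ
    prime : Prime p
    α β γ a′ b′ c′ : ℕ
    α>0 : 0 < α
    β>0 : 0 < β
    γ>0 : 0 < γ
    a≡ : a ≡ p ^ α * a′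
    b≡ : b ≡ p ^ β * b′
    c≡ : c ≡ p ^ γ * c′
    p∤a′ : ¬ (p ∣ a′)
    p∤b′ : ¬ (p ∣ b′)
    p∤c′ : ¬ (p ∣ c′)

-- The non-strict types A and B (so that Type O is both) and the strict type C.
WeakA WeakB StrictC : ∀ {a b c} → Local a b c → Triple → Set
WeakA L (x , y , z) = let open Local L in β * y ≡ γ * z × β * y ≤ α * x
WeakB L (x , y , z) = let open Local L in α * x ≡ γ * z × α * x ≤ β * y
StrictC L (x , y , z) = let open Local L in α * x ≡ β * y × α * x < γ * z

swap-Local : ∀ {a b c} → Local a b c → Local b a c
swap-Local (local p pp α β γ a′ b′ c′ α>0 β>0 γ>0 a≡ b≡ c≡ ha hb hc) =
  local p pp β α γ b′ a′ c′ β>0 α>0 γ>0 b≡ a≡ c≡ hb ha hc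

swap : Triple → Triple
swap (x , y , z) = y , x , z

swap-Sol : ∀ {a b c} s → Sol a b c s → Sol b a c (swap s)
swap-Sol {a} {b} (x , y , z) (x>0 , y>0 , z>0 , e) = y>0 , x>0 , z>0 , trans (+-comm (b ^ y) (a ^ x)) e

swap-StrictC : ∀ {a b c} (L : Local a b c) s → StrictC L s → StrictC (swap-Local L) (swap s)
swap-StrictC L (x , y , z) (e , h) = sym e , subst (_< Local.γ L * z) e h

≢0-from-∤ : ∀ {p n} → ¬ (p ∣ n) → 0 < n
≢0-from-∤ {p} {zero} h = ⊥-elim (h (p ∣0))
≢0-from-∤ {p} {suc n} _ = s≤s z≤n

local-power : ∀ p α a′ {a} x → a ≡ p ^ α * a′ → a ^ x ≡ p ^ (α * x) * a′ ^ x
local-power p α a′ x refl = trans (^-distribʳ-* x (p ^ α) a′) (cong (_* a′ ^ x) (^-*-assoc p α x))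

∤-^ : ∀ {p n} → Prime p → ¬ (p ∣ n) → ∀ x → ¬ (p ∣ n ^ x)
∤-^ {n = n} pp h x d = h (prime-∣^ pp n x d)

∤-+-power : ∀ {p A} r B → 0 < r → ¬ (p ∣ A) → ¬ (p ∣ A + p ^ r * B)
∤-+-power {p} {A} r B r>0 h d = h (∣m+n∣m⇒∣n (subst (p ∣_) (+-comm A (p ^ r * B)) d) (∣m⇒∣m*n B (base∣^ p r>0)))

minimum-twice : ∀ {p A B C} → Prime p → ¬ (p ∣ A) → ¬ (p ∣ B) → ¬ (p ∣ C) → ∀ i j k →
  p ^ i * A + p ^ j * B ≡ p ^ k * C → (j ≡ k × j ≤ i) ⊎ (i ≡ k × i ≤ j) ⊎ (i ≡ j × i < k)
minimum-twice {p} {A} {B} {C} pp hA hB hC i j k e with <-cmp i j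
... | tri< i<j _ _ with split-< i<j
... | r , refl , r>0 = inj₂ (inj₁ (proj₁ (exact-power-unique (prime>1 pp) i k (∤-+-power r B r>0 hA) hC (trans (sym factor) e)) , <⇒≤ i<j))
  where
  factor : p ^ i * A + p ^ (i + r) * B ≡ p ^ i * (A + p ^ r * B)
  factor = trans (cong (λ u → p ^ i * A + u * B) (^-distribˡ-+-* p i r)) (lemma (p ^ i) A (p ^ r) B)
    where
    lemma : ∀ u A v B → u * A + u * v * B ≡ u * (A + v * B)
    lemma = solve-∀
minimum-twice {p} {A} {B} {C} pp hA hB hC i j k e | tri> _ _ j<i with split-< j<i
... | r , refl , r>0 = inj₁ (proj₁ (exact-power-unique (prime>1 pp) j k (∤-+-power r A r>0 hB) hC (trans (sym factor) e)) , <⇒≤ j<i)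
  where
  factor : p ^ (j + r) * A + p ^ j * B ≡ p ^ j * (B + p ^ r * A)
  factor = trans (cong (λ u → u * A + p ^ j * B) (^-distribˡ-+-* p j r)) (lemma (p ^ j) A (p ^ r) B)
    where
    lemma : ∀ u A v B → u * v * A + u * B ≡ u * (B + v * A)
    lemma = solve-∀
minimum-twice {p} {A} {B} {C} pp hA hB hC i j k e | tri≈ _ refl _ with <-cmp i k
... | tri< i<k _ _ = inj₂ (inj₂ (refl , i<k))
... | tri≈ _ i≡k _ = inj₁ (i≡k , ≤-refl)
-- When the two valuations on the left agree, the sum may gain factors `p` but cannot lose any:
-- `k < i` would give `p ∣ C`.
... | tri> _ _ k<i with split-< k<i
... | r , refl , r>0 = ⊥-elim (hC (subst (p ∣_) (sym C≡) (∣m⇒∣m*n (A + B) (base∣^ p r>0))))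
  where
  C≡ : C ≡ p ^ r * (A + B)
  C≡ = cancelˡ (^-pos k (<-trans (s≤s z≤n) (prime>1 pp))) (trans (sym e) (trans (cong (λ u → u * A + u * B) (^-distribˡ-+-* p k r)) (lemma (p ^ k) (p ^ r) A B)))
    where
    lemma : ∀ u v A B → u * v * A + u * v * B ≡ u * (v * (A + B))
    lemma = solve-∀

local-type : ∀ {a b c} (L : Local a b c) s → Sol a b c s → WeakA L s ⊎ WeakB L s ⊎ StrictC L s
local-type (local p pp α β γ a′ b′ c′ _ _ _ a≡ b≡ c≡ ha hb hc) (x , y , z) (_ , _ , _ , e) =
  minimum-twice pp (∤-^ pp ha x) (∤-^ pp hb y) (∤-^ pp hc z) (α * x) (β * y) (γ * z)
    (trans (sym (cong₂ _+_ (local-power p α a′ x a≡) (local-power p β b′ y b≡))) (trans e (local-power p γ c′ z c≡)))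

-- The ratio `γ / α` separates x₁/z₁ from x₂/z₂.
cross-≤ : ∀ {α γ x₁ z₁ x₂ z₂} → 0 < α → 0 < γ → α * x₁ ≤ γ * z₁ → γ * z₂ ≤ α * x₂ → x₁ * z₂ ≤ x₂ * z₁
cross-≤ {α} {γ} {x₁} {z₁} {x₂} {z₂} α>0 γ>0 h₁ h₂ = *-cancelˡ-≤ (α * γ) {{>-nonZero (*-pos α>0 γ>0)}} (begin
  α * γ * (x₁ * z₂)     ≡⟨ lemma α γ x₁ z₂ ⟩
  (α * x₁) * (γ * z₂)   ≤⟨ *-mono-≤ h₁ h₂ ⟩
  (γ * z₁) * (α * x₂)   ≡⟨ lemma′ γ z₁ α x₂ ⟩
  α * γ * (x₂ * z₁)     ∎)
  where
  open ≤-Reasoning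
  lemma : ∀ a g x z → a * g * (x * z) ≡ (a * x) * (g * z)
  lemma = solve-∀
  lemma′ : ∀ g z a x → (g * z) * (a * x) ≡ a * g * (x * z)
  lemma′ = solve-∀

cross-≡ : ∀ {α γ x₁ z₁ x₂ z₂} → 0 < α → 0 < γ → α * x₁ ≡ γ * z₁ → α * x₂ ≡ γ * z₂ → x₁ * z₂ ≡ x₂ * z₁
cross-≡ {α} {γ} {x₁} {z₁} {x₂} {z₂} α>0 γ>0 e₁ e₂ = ≤-antisym
  (cross-≤ {α} {γ} α>0 γ>0 (≤-reflexive e₁) (≤-reflexive (sym e₂)))
  (subst₂ _≤_ (*-comm z₁ x₂) (*-comm z₂ x₁) (cross-≤ {γ} {α} {z₁} {x₁} {z₂} {x₂} γ>0 α>0 (≤-reflexive (sym e₁)) (≤-reflexive e₂)))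

-- An inequality between powers bounds the ratio of their exponents, and a smaller ratio x₁/z₁
-- satisfies the same bound. Raising to the powers `z₁` and `z₂` replaces logarithms.
power-transfer : ∀ {u w x₁ z₁ x₂ z₂} → 0 < u → 0 < z₁ → u ^ x₂ < w ^ z₂ → x₁ * z₂ ≤ x₂ * z₁ → u ^ x₁ < w ^ z₁
power-transfer {u} {w} {x₁} {z₁} {x₂} {z₂} u>0 z₁>0 h le = ^-cancelˡ-< z₂ (begin-strict
  (u ^ x₁) ^ z₂   ≡⟨ ^-*-assoc u x₁ z₂ ⟩
  u ^ (x₁ * z₂)   ≤⟨ ^-monoʳ-≤ u {{>-nonZero u>0}} le ⟩
  u ^ (x₂ * z₁)   ≡⟨ sym (^-*-assoc u x₂ z₁) ⟩
  (u ^ x₂) ^ z₁   <⟨ ^-monoˡ-< z₁ {{>-nonZero z₁>0}} h ⟩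
  (w ^ z₂) ^ z₁   ≡⟨ ^-^-comm w z₂ z₁ ⟩
  (w ^ z₁) ^ z₂   ∎)
  where open ≤-Reasoning

weakA-reduce : ∀ {a b c} (L : Local a b c) x y z → Sol a b c (x , y , z) → WeakA L (x , y , z) →
  let open Local L in ∃[ r ] (α * x ≡ β * y + r × p ^ r * a′ ^ x + b′ ^ y ≡ c′ ^ z)
weakA-reduce (local p pp α β γ a′ b′ c′ _ _ _ a≡ b≡ c≡ _ _ _) x y z (_ , _ , _ , e) (A≡ , A≤) with m≤n⇒∃[o]m+o≡n A≤
... | r , αx≡ = r , sym αx≡ , cancelˡ (^-pos (β * y) (<-trans (s≤s z≤n) (prime>1 pp))) (begin
    p ^ (β * y) * (p ^ r * a′ ^ x + b′ ^ y)       ≡⟨ lemma (p ^ (β * y)) (p ^ r) (a′ ^ x) (b′ ^ y) ⟩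
    p ^ (β * y) * p ^ r * a′ ^ x + p ^ (β * y) * b′ ^ y
      ≡⟨ cong (λ u → u * a′ ^ x + p ^ (β * y) * b′ ^ y) (trans (sym (^-distribˡ-+-* p (β * y) r)) (cong (p ^_) αx≡)) ⟩
    p ^ (α * x) * a′ ^ x + p ^ (β * y) * b′ ^ y   ≡⟨ sym (cong₂ _+_ (local-power p α a′ x a≡) (local-power p β b′ y b≡)) ⟩
    _ ^ x + _ ^ y                                 ≡⟨ e ⟩
    _ ^ z                                         ≡⟨ local-power p γ c′ z c≡ ⟩
    p ^ (γ * z) * c′ ^ z                          ≡⟨ cong (λ i → p ^ i * c′ ^ z) (sym A≡) ⟩
    p ^ (β * y) * c′ ^ z                          ∎)
  where
  open ≡-Reasoning
  lemma : ∀ u v w t → u * (v * w + t) ≡ u * v * w + u * t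
  lemma = solve-∀

-- Divide both equations by their common power of p.  The second shows that the p-free parts of a^x and b^y
-- are smaller than that of c^z, and this carries over to the first, where p still divides their sum.
strictC-weakA : ∀ {a b c} (L : Local a b c) s t → Sol a b c s → Sol a b c t → StrictC L s → WeakA L t → ⊥
strictC-weakA L@(local p pp α β γ a′ b′ c′ α>0 β>0 γ>0 a≡ b≡ c≡ ha hb hc) (x₁ , y₁ , z₁) (x₂ , y₂ , z₂)
  (_ , _ , z₁>0 , e₁) τ (C≡ , C<) A@(A≡ , A≤)
  with split-< C< | weakA-reduce L x₂ y₂ z₂ τ A
... | s , γz₁≡ , s>0 | r , _ , reduced₂ = <⇒≱ total (≤-reflexive (sym reduced₁))
  where
  p>0 : 0 < p
  p>0 = <-trans (s≤s z≤n) (prime>1 pp)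
  reduced₁ : a′ ^ x₁ + b′ ^ y₁ ≡ p ^ s * c′ ^ z₁
  reduced₁ = cancelˡ (^-pos (α * x₁) p>0) (begin
    p ^ (α * x₁) * (a′ ^ x₁ + b′ ^ y₁)               ≡⟨ *-distribˡ-+ (p ^ (α * x₁)) _ _ ⟩
    p ^ (α * x₁) * a′ ^ x₁ + p ^ (α * x₁) * b′ ^ y₁  ≡⟨ cong (λ i → p ^ (α * x₁) * a′ ^ x₁ + p ^ i * b′ ^ y₁) C≡ ⟩
    p ^ (α * x₁) * a′ ^ x₁ + p ^ (β * y₁) * b′ ^ y₁  ≡⟨ sym (cong₂ _+_ (local-power p α a′ x₁ a≡) (local-power p β b′ y₁ b≡)) ⟩
    _ ^ x₁ + _ ^ y₁                                  ≡⟨ e₁ ⟩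
    _ ^ z₁                                           ≡⟨ local-power p γ c′ z₁ c≡ ⟩
    p ^ (γ * z₁) * c′ ^ z₁                           ≡⟨ cong (λ i → p ^ i * c′ ^ z₁) γz₁≡ ⟩
    p ^ (α * x₁ + s) * c′ ^ z₁                       ≡⟨ cong (_* c′ ^ z₁) (^-distribˡ-+-* p (α * x₁) s) ⟩
    p ^ (α * x₁) * p ^ s * c′ ^ z₁                   ≡⟨ *-assoc (p ^ (α * x₁)) (p ^ s) (c′ ^ z₁) ⟩
    p ^ (α * x₁) * (p ^ s * c′ ^ z₁)                 ∎)
    where open ≡-Reasoning
  a-small : a′ ^ x₁ < c′ ^ z₁
  a-small = power-transfer {a′} {c′} {x₁} {z₁} {x₂} {z₂} (≢0-from-∤ ha) z₁>0
    (subst (a′ ^ x₂ <_) reduced₂ (≤-<-trans (m≤n*m (a′ ^ x₂) (p ^ r) {{>-nonZero (^-pos r p>0)}}) (m<m+n _ (^-pos y₂ (≢0-from-∤ hb)))))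
    (cross-≤ {α} {γ} α>0 γ>0 (<⇒≤ C<) (≤-trans (≤-reflexive (sym A≡)) A≤))
  b-small : b′ ^ y₁ < c′ ^ z₁
  b-small = power-transfer {b′} {c′} {y₁} {z₁} {y₂} {z₂} (≢0-from-∤ hb) z₁>0
    (subst (b′ ^ y₂ <_) reduced₂ (m<n+m _ (*-pos (^-pos r p>0) (^-pos x₂ (≢0-from-∤ ha)))))
    (cross-≤ {β} {γ} β>0 γ>0 (subst (_≤ γ * z₁) C≡ (<⇒≤ C<)) (≤-reflexive (sym A≡)))
  total : a′ ^ x₁ + b′ ^ y₁ < p ^ s * c′ ^ z₁
  total = begin-strict
    a′ ^ x₁ + b′ ^ y₁         <⟨ +-mono-< a-small b-small ⟩
    c′ ^ z₁ + c′ ^ z₁         ≡⟨ cong (c′ ^ z₁ +_) (sym (+-identityʳ (c′ ^ z₁))) ⟩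
    2 * c′ ^ z₁               ≤⟨ *-monoˡ-≤ (c′ ^ z₁) (1<^ (prime>1 pp) s>0) ⟩
    p ^ s * c′ ^ z₁           ∎
    where open ≤-Reasoning

strictC-weakB : ∀ {a b c} (L : Local a b c) s t → Sol a b c s → Sol a b c t → StrictC L s → WeakB L t → ⊥
strictC-weakB L s t σ τ C B = strictC-weakA (swap-Local L) (swap s) (swap t) (swap-Sol s σ) (swap-Sol t τ) (swap-StrictC L s C) B

-- Two solutions that exhaust all solutions and lie in a family

InSomeFamily : ℕ → ℕ → ℕ → Triple → Triple → Set
InSomeFamily a b c s₁ s₂ = InFamily FamI a b c s₁ s₂ ⊎ InFamily FamII a b c s₁ s₂ ⊎
  InFamily FamIII a b c s₁ s₂ ⊎ InFamily FamIV a b c s₁ s₂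

-- Distinctness and covering are stated through `SameSol`, the relation by which `NEq` counts. All
-- fields survive the exchange of `a` and `b`, so type B reduces to type A.
record Classified (a b c : ℕ) : Set where
  constructor classified
  field
    s₁ s₂ : Triple
    sol₁ : Sol a b c s₁
    sol₂ : Sol a b c s₂
    distinct : ¬ SameSol a b c s₁ s₂
    cover : ∀ s → Sol a b c s → SameSol a b c s s₁ ⊎ SameSol a b c s s₂
    family : InSomeFamily a b c s₁ s₂

SameSol-refl : ∀ {a b c} s → SameSol a b c s s
SameSol-refl (x , y , z) = inj₁ (refl , refl)

SameSol-sym : ∀ {a b c} s t → SameSol a b c s t → SameSol a b c t s
SameSol-sym s t (inj₁ (p , q)) = inj₁ (sym p , sym q)
SameSol-sym s t (inj₂ (p , q)) = inj₂ (sym q , sym p)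

SameSol⇒z≡ : ∀ {a b c x₁ y₁ z₁ x₂ y₂ z₂} → 1 < c → Sol a b c (x₁ , y₁ , z₁) → Sol a b c (x₂ , y₂ , z₂) →
  SameSol a b c (x₁ , y₁ , z₁) (x₂ , y₂ , z₂) → z₁ ≡ z₂
SameSol⇒z≡ c>1 (_ , _ , _ , e₁) (_ , _ , _ , e₂) (inj₁ (p , q)) =
  ^-cancelʳ-≡ c>1 (trans (sym e₁) (trans (cong₂ _+_ p q) e₂))
SameSol⇒z≡ {a} {b} {x₂ = x₂} {y₂} c>1 (_ , _ , _ , e₁) (_ , _ , _ , e₂) (inj₂ (p , q)) =
  ^-cancelʳ-≡ c>1 (trans (sym e₁) (trans (cong₂ _+_ p q) (trans (+-comm (b ^ y₂) (a ^ x₂)) e₂)))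

Classified⇒conclusion : ∀ {a b c} → Classified a b c → NEq a b c 2 ×
  ∃[ s₁ ] ∃[ s₂ ] (Sol a b c s₁ × Sol a b c s₂ × s₁ ≢ s₂ × InSomeFamily a b c s₁ s₂)
Classified⇒conclusion {a} {b} {c} (classified s₁ s₂ sol₁ sol₂ distinct cover family) =
  (s₁ ∷ s₂ ∷ [] , sols , distincts , covers) ,
  s₁ , s₂ , sol₁ , sol₂ , (λ { refl → distinct (SameSol-refl {a} {b} {c} s₁) }) , family
  where
  sols : ∀ i → Sol a b c (lookup (s₁ ∷ s₂ ∷ []) i)
  sols Fin.zero = sol₁
  sols (Fin.suc Fin.zero) = sol₂
  distincts : ∀ i j → i ≢ j → ¬ SameSol a b c (lookup (s₁ ∷ s₂ ∷ []) i) (lookup (s₁ ∷ s₂ ∷ []) j)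
  distincts Fin.zero Fin.zero ne = ⊥-elim (ne refl)
  distincts Fin.zero (Fin.suc Fin.zero) _ = distinct
  distincts (Fin.suc Fin.zero) Fin.zero _ = λ h → distinct (SameSol-sym {a} {b} {c} s₂ s₁ h)
  distincts (Fin.suc Fin.zero) (Fin.suc Fin.zero) ne = ⊥-elim (ne refl)
  covers : ∀ s → Sol a b c s → ∃[ i ] SameSol a b c s (lookup (s₁ ∷ s₂ ∷ []) i)
  covers s σ with cover s σ
  ... | inj₁ h = Fin.zero , h
  ... | inj₂ h = Fin.suc Fin.zero , h

swap-SameSol : ∀ {a b c} s t → SameSol a b c s t → SameSol b a c (swap s) (swap t)
swap-SameSol s t (inj₁ (p , q)) = inj₁ (q , p)
swap-SameSol s t (inj₂ (p , q)) = inj₂ (q , p)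

swap-Corr : ∀ {A B C a b c} S s → Corr A B C S a b c s → Corr A B C S b a c (swap s)
swap-Corr S s (inj₁ (p , q)) = inj₂ (p , q)
swap-Corr S s (inj₂ (p , q)) = inj₁ (p , q)

swap-InFamily : ∀ {F a b c} s₁ s₂ → InFamily F a b c s₁ s₂ → InFamily F b a c (swap s₁) (swap s₂)
swap-InFamily {F} {a} {b} {c} s₁ s₂ (A , B , C , S₁ , S₂ , f , h₁ , h₂) = A , B , C , S₁ , S₂ , f , either S₁ h₁ , either S₂ h₂
  where
  either : ∀ S → Corr A B C S a b c s₁ ⊎ Corr A B C S a b c s₂ →
    Corr A B C S b a c (swap s₁) ⊎ Corr A B C S b a c (swap s₂)
  either S (inj₁ h) = inj₁ (swap-Corr {A} {B} {C} {a} {b} {c} S s₁ h)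
  either S (inj₂ h) = inj₂ (swap-Corr {A} {B} {C} {a} {b} {c} S s₂ h)

swap-Classified : ∀ {a b c} → Classified a b c → Classified b a c
swap-Classified {a} {b} {c} (classified s₁ s₂ sol₁ sol₂ distinct cover family) =
  classified (swap s₁) (swap s₂) (swap-Sol s₁ sol₁) (swap-Sol s₂ sol₂)
    (λ h → distinct (swap-SameSol {b} {a} {c} (swap s₁) (swap s₂) h))
    (λ s σ → swap-cover s (cover (swap s) (swap-Sol s σ))) (swap-family family)
  where
  swap-cover : ∀ s → SameSol a b c (swap s) s₁ ⊎ SameSol a b c (swap s) s₂ →
    SameSol b a c s (swap s₁) ⊎ SameSol b a c s (swap s₂)
  swap-cover s (inj₁ h) = inj₁ (swap-SameSol {a} {b} {c} (swap s) s₁ h)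
  swap-cover s (inj₂ h) = inj₂ (swap-SameSol {a} {b} {c} (swap s) s₂ h)
  swap-family : InSomeFamily a b c s₁ s₂ → InSomeFamily b a c (swap s₁) (swap s₂)
  swap-family (inj₁ f) = inj₁ (swap-InFamily {FamI} {a} {b} {c} s₁ s₂ f)
  swap-family (inj₂ (inj₁ f)) = inj₂ (inj₁ (swap-InFamily {FamII} {a} {b} {c} s₁ s₂ f))
  swap-family (inj₂ (inj₂ (inj₁ f))) = inj₂ (inj₂ (inj₁ (swap-InFamily {FamIII} {a} {b} {c} s₁ s₂ f)))
  swap-family (inj₂ (inj₂ (inj₂ f))) = inj₂ (inj₂ (inj₂ (swap-InFamily {FamIV} {a} {b} {c} s₁ s₂ f)))

-- The second pair of terms consists of the cubes of the first. Which of the two terms is even does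
-- not matter, because `Corr` compares unordered pairs.
familyII : ∀ {a b c x₁ y₁ z₁ x₂ y₂ z₂} → x₂ ≡ 3 * x₁ → y₂ ≡ 3 * y₁ →
  ∃[ t ] (0 < t × ((a ^ x₁ ≡ 2 * 3 ^ t × b ^ y₁ ≡ 3 ^ t) ⊎ (b ^ y₁ ≡ 2 * 3 ^ t × a ^ x₁ ≡ 3 ^ t))) →
  InFamily FamII a b c (x₁ , y₁ , z₁) (x₂ , y₂ , z₂)
familyII {a} {b} {c} {x₁} {y₁} {z₁} {z₂ = z₂} refl refl (t , t>0 , h) =
  2 * 3 ^ t , 3 , 3 , (1 , t , t + 1) , (3 , 3 * t , 3 * t + 2) , (t , t>0 , refl , refl , refl , refl , refl) ,
  inj₁ (first h) , inj₂ (second h)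
  where
  cube : ∀ {u v} x → u ^ x ≡ v → v ^ 3 ≡ u ^ (3 * x)
  cube {u} x refl = trans (^-*-assoc u x 3) (cong (u ^_) (*-comm x 3))
  cube₃ : ∀ {u} x → u ^ x ≡ 3 ^ t → 3 ^ (3 * t) ≡ u ^ (3 * x)
  cube₃ {u} x e = trans (cong (3 ^_) (*-comm 3 t)) (trans (sym (^-*-assoc 3 t 3)) (cube {u} x e))
  first : _ → Corr (2 * 3 ^ t) 3 3 (1 , t , t + 1) a b c (x₁ , y₁ , z₁)
  first (inj₁ (p , q)) = inj₁ (trans (*-identityʳ _) (sym p) , sym q)
  first (inj₂ (p , q)) = inj₂ (trans (*-identityʳ _) (sym p) , sym q)
  second : _ → Corr (2 * 3 ^ t) 3 3 (3 , 3 * t , 3 * t + 2) a b c (3 * x₁ , 3 * y₁ , z₂)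
  second (inj₁ (p , q)) = inj₁ (cube {a} x₁ p , cube₃ {b} y₁ q)
  second (inj₂ (p , q)) = inj₂ (cube {b} y₁ p , cube₃ {a} x₁ q)

-- All solutions are of type C, so any two have first exponents in the ratio 3. Three different
-- values cannot be in this ratio pairwise, and `x` determines the solution.
strictC-classified : ∀ {a b c} → 1 < a → 1 < b → 1 < c → (L : Local a b c) → NGt1 a b c →
  ¬ (IsPow2 a × IsPow2 b × IsPow2 c) → ∀ s → Sol a b c s → StrictC L s → Classified a b c
strictC-classified {a} {b} {c} a>1 b>1 c>1 L (t₁ , t₂ , σ₁ , σ₂ , distinct₀) not-pow2 s σ C = start t₁ t₂ σ₁ σ₂ distinct₀
  where
  open Local L
  all-C : ∀ t → Sol a b c t → StrictC L t
  all-C t τ with local-type L t τ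
  ... | inj₁ A = ⊥-elim (strictC-weakA L s t σ τ C A)
  ... | inj₂ (inj₁ B) = ⊥-elim (strictC-weakB L s t σ τ C B)
  ... | inj₂ (inj₂ h) = h
  same-x : ∀ {x y₁ z₁ y₂ z₂} → Sol a b c (x , y₁ , z₁) → Sol a b c (x , y₂ , z₂) → SameSol a b c (x , y₁ , z₁) (x , y₂ , z₂)
  same-x τ₁ τ₂ = inj₁ (refl , cong (b ^_) (cancelˡ β>0 (trans (sym (proj₁ (all-C _ τ₁))) (proj₁ (all-C _ τ₂)))))
  pair : ∀ {x₁ y₁ z₁ x₂ y₂ z₂} → Sol a b c (x₁ , y₁ , z₁) → Sol a b c (x₂ , y₂ , z₂) → x₁ < x₂ → _
  pair {x₁} {y₁} {z₁} {x₂} {y₂} {z₂} τ₁ τ₂ x₁<x₂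
    with proportional-ab a>1 b>1 c>1 τ₁ τ₂ (cross-≡ {α} {β} {x₁} {y₁} {x₂} {y₂} α>0 β>0 (proj₁ (all-C _ τ₁)) (proj₁ (all-C _ τ₂))) x₁<x₂
  ... | inj₁ h = ⊥-elim (not-pow2 h)
  ... | inj₂ h = h
  build : ∀ x₁ y₁ z₁ x₂ y₂ z₂ → Sol a b c (x₁ , y₁ , z₁) → Sol a b c (x₂ , y₂ , z₂) → x₁ < x₂ →
    ¬ SameSol a b c (x₁ , y₁ , z₁) (x₂ , y₂ , z₂) → Classified a b c
  build x₁ y₁ z₁ x₂ y₂ z₂ τ₁ τ₂ x₁<x₂ distinct with pair τ₁ τ₂ x₁<x₂
  ... | x₂≡ , y₂≡ , c≡3 , fam = classified _ _ τ₁ τ₂ distinct cover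
          (inj₂ (inj₁ (familyII {a} {b} {c} {x₁} {y₁} {z₁} {x₂} {y₂} {z₂} x₂≡ y₂≡ fam)))
    where
    cover : ∀ t → Sol a b c t → SameSol a b c t (x₁ , y₁ , z₁) ⊎ SameSol a b c t (x₂ , y₂ , z₂)
    cover (x , y , z) τ with <-cmp x x₁
    ... | tri≈ _ refl _ = inj₁ (same-x τ τ₁)
    ... | tri< x<x₁ _ _ = ⊥-elim (<⇒≢ x₁<x₂ (trans (proj₁ (pair τ τ₁ x<x₁)) (sym (proj₁ (pair τ τ₂ (<-trans x<x₁ x₁<x₂))))))
    ... | tri> _ _ x₁<x with trans (proj₁ (pair τ₁ τ x₁<x)) (sym x₂≡)
    ... | refl = inj₂ (same-x τ τ₂)
  start : ∀ t₁ t₂ → Sol a b c t₁ → Sol a b c t₂ → ¬ SameSol a b c t₁ t₂ → Classified a b c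
  start (x₁ , y₁ , z₁) (x₂ , y₂ , z₂) τ₁ τ₂ distinct with <-cmp x₁ x₂
  ... | tri< h _ _ = build x₁ y₁ z₁ x₂ y₂ z₂ τ₁ τ₂ h distinct
  ... | tri≈ _ refl _ = ⊥-elim (distinct (same-x τ₁ τ₂))
  ... | tri> _ _ h = build x₂ y₂ z₂ x₁ y₁ z₁ τ₂ τ₁ h (λ d → distinct (SameSol-sym {a} {b} {c} (x₂ , y₂ , z₂) (x₁ , y₁ , z₁) d))

-- The families (i), (iii) and (iv)

exact⇒ExactPow : ∀ {p k m n} → 1 < p → n ≡ p ^ k * m → ¬ (p ∣ m) → ExactPow p k n
exact⇒ExactPow {p} {k} {m} p>1 refl h = m∣m*n m , λ d → h (*-cancelˡ-∣ (p ^ k)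
  {{>-nonZero (^-pos k (<-trans (s≤s z≤n) p>1))}} (subst (_∣ p ^ k * m) (*-comm p (p ^ k)) d))

consecutive-powers-odd : ∀ {d k n} → 0 < k → (d + 1) ^ k ≡ d ^ k + n → Odd n
consecutive-powers-odd {d} {suc k} {n} _ e 2∣n with 2 ∣? d
... | yes 2∣d = odd-^ (suc k) (even+odd 2∣d (1+2*-odd 0)) (subst (2 ∣_) (sym e) (∣m∣n⇒∣m+n (∣m⇒∣m*n (d ^ k) 2∣d) 2∣n))
... | no 2∤d = odd-^ (suc k) 2∤d (∣m+n∣m⇒∣n (subst (2 ∣_) (trans e (+-comm (d ^ suc k) n))
                 (∣m⇒∣m*n ((d + 1) ^ k) (odd+odd 2∤d (1+2*-odd 0)))) 2∣n)

S-odd : ∀ {Y δ n} → Odd Y → 2 ∣ δ → Odd n → Odd (S (Y + δ) Y n)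
S-odd {Y} {δ} {n} oY 2∣δ on d = odd-* on (odd-^ n oY) (S-mod Y δ n 2∣δ d)

-- Each squaring multiplies the difference by a sum of two even powers of odd numbers, which is 2
-- modulo 4. Exactly one factor 2 is gained each time.
two-power-difference : ∀ Y δ v → Odd Y → Odd (Y + δ) →
  ∃[ o ] (Odd o × (Y + δ) ^ (2 ^ suc v) ≡ Y ^ (2 ^ suc v) + δ * (Y + δ + Y) * (2 ^ v * o))
two-power-difference Y δ zero oY oX = 1 , 1+2*-odd 0 , trans (square-difference Y δ) (cong (Y ^ 2 +_) (sym (*-identityʳ _)))
two-power-difference Y δ (suc v) oY oX with two-power-difference Y δ v oY oX
... | o , oo , e with odd-even-power {Y} {2 ^ suc v} oY (m∣m*n (2 ^ v)) | odd-even-power {Y + δ} {2 ^ suc v} oX (m∣m*n (2 ^ v))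
... | t , f | t′ , f′ = o * (1 + 2 * (t + t′)) , odd-* oo (1+2*-odd (t + t′)) , (begin
  (Y + δ) ^ (2 * 2 ^ suc v)           ≡⟨ square (Y + δ) ⟩
  X * X                               ≡⟨ cong (X *_) e ⟩
  X * (Z + w)                         ≡⟨ *-distribˡ-+ X Z w ⟩
  X * Z + X * w                       ≡⟨ cong (λ u → u * Z + X * w) e ⟩
  (Z + w) * Z + X * w                 ≡⟨ lemma₁ Z w X ⟩
  Z * Z + w * (X + Z)                 ≡⟨ cong₂ (λ u u′ → u + w * u′) (sym (square Y)) (trans (cong₂ _+_ f′ f) (lemma₂ t t′)) ⟩
  Y ^ (2 * 2 ^ suc v) + w * (2 * (1 + 2 * (t + t′)))  ≡⟨ cong (Y ^ (2 * 2 ^ suc v) +_) (lemma₃ (δ * (Y + δ + Y)) (2 ^ v) o (1 + 2 * (t + t′))) ⟩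
  Y ^ (2 * 2 ^ suc v) + δ * (Y + δ + Y) * (2 * 2 ^ v * (o * (1 + 2 * (t + t′)))) ∎)
  where
  open ≡-Reasoning
  X Z w : ℕ
  X = (Y + δ) ^ (2 ^ suc v)
  Z = Y ^ (2 ^ suc v)
  w = δ * (Y + δ + Y) * (2 ^ v * o)
  square : ∀ x → x ^ (2 * 2 ^ suc v) ≡ x ^ (2 ^ suc v) * x ^ (2 ^ suc v)
  square x = trans (^-distribˡ-+-* x (2 ^ suc v) (2 ^ suc v + 0)) (cong (λ i → x ^ (2 ^ suc v) * x ^ i) (+-identityʳ (2 ^ suc v)))
  lemma₁ : ∀ z w x → (z + w) * z + x * w ≡ z * z + w * (x + z)
  lemma₁ = solve-∀
  lemma₂ : ∀ t s → (1 + 4 * s) + (1 + 4 * t) ≡ 2 * (1 + 2 * (t + s))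
  lemma₂ = solve-∀
  lemma₃ : ∀ c p o r → c * (p * o) * (2 * r) ≡ c * (2 * p * (o * r))
  lemma₃ = solve-∀

-- Apply `two-power-difference` to the `l`-th powers. For odd `l` their difference is 2 times an odd
-- number and their sum is `2 * d + 2` times an odd number. The outcome is the exact power of 2 that
-- family (iv) prescribes.
even-lift-difference : ∀ d v l → Odd d → Odd l →
  ∃[ o ] (Odd o × (d + 2) ^ (2 ^ suc v * l) ≡ d ^ (2 ^ suc v * l) + 2 ^ suc v * (2 * d + 2) * o)
even-lift-difference d v l od ol with odd⇒1+2* l ol
... | j , refl with two-power-difference (d ^ l) (2 * S (d + 2) d l) v (odd-^ l od)
                     (subst Odd (^-difference d 2 l) (odd-^ l (λ e → od (∣m+n∣m⇒∣n (subst (2 ∣_) (+-comm d 2) e) ∣-refl))))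
... | o , oo , e = S (d + 2) d l * (T d 2 j * o) , odd-* (S-odd {n = l} od ∣-refl ol) (odd-* (T-odd {δ = 2} j od) oo) , (begin
  (d + 2) ^ (2 ^ suc v * l)            ≡⟨ cong ((d + 2) ^_) (*-comm (2 ^ suc v) l) ⟩
  (d + 2) ^ (l * 2 ^ suc v)            ≡⟨ sym (^-*-assoc (d + 2) l (2 ^ suc v)) ⟩
  ((d + 2) ^ l) ^ (2 ^ suc v)          ≡⟨ cong (_^ (2 ^ suc v)) (^-difference d 2 l) ⟩
  (d ^ l + 2 * s) ^ (2 ^ suc v)        ≡⟨ e ⟩
  (d ^ l) ^ (2 ^ suc v) + 2 * s * (d ^ l + 2 * s + d ^ l) * (2 ^ v * o)
    ≡⟨ cong₂ (λ u w → u + 2 * s * (w + d ^ l) * (2 ^ v * o)) (trans (^-*-assoc d l (2 ^ suc v)) (cong (d ^_) (*-comm l (2 ^ suc v)))) (sym (^-difference d 2 l)) ⟩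
  d ^ (2 ^ suc v * l) + 2 * s * ((d + 2) ^ l + d ^ l) * (2 ^ v * o)
    ≡⟨ cong (λ u → d ^ (2 ^ suc v * l) + 2 * s * u * (2 ^ v * o)) (odd-power-sum d 2 j) ⟩
  d ^ (2 ^ suc v * l) + 2 * s * ((d + 2 + d) * T d 2 j) * (2 ^ v * o)
    ≡⟨ cong (d ^ (2 ^ suc v * l) +_) (lemma s d (T d 2 j) (2 ^ v) o) ⟩
  d ^ (2 ^ suc v * l) + 2 ^ suc v * (2 * d + 2) * (s * (T d 2 j * o)) ∎)
  where
  open ≡-Reasoning
  s : ℕ
  s = S (d + 2) d l
  lemma : ∀ s d t p o → 2 * s * ((d + 2 + d) * t) * (p * o) ≡ 2 * p * (2 * d + 2) * (s * (t * o))
  lemma = solve-∀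

-- For odd `k` the difference divided by 2 is an odd sum `S`, yet at least one factor 2 remains on
-- the right.
lifted-2-even : ∀ {d k n} → Odd d → 1 < k → (d + 2) ^ k ≡ d ^ k + 2 ^ k * n → 2 ∣ k
lifted-2-even {d} {suc k} {n} od (s≤s k>0) e with 2 ∣? suc k
... | yes h = h
... | no h = ⊥-elim (S-odd {n = suc k} od ∣-refl h (subst (2 ∣_) (sym S≡) (∣m⇒∣m*n n (base∣^ 2 k>0))))
  where
  S≡ : S (d + 2) d (suc k) ≡ 2 ^ k * n
  S≡ = cancelˡ {2} (s≤s z≤n) (+-cancelˡ-≡ (d ^ suc k) _ _ (trans (sym (^-difference d 2 (suc k))) (trans e (cong (d ^ suc k +_) (*-assoc 2 (2 ^ k) n)))))

-- Both factors are powers of 2 and the second is larger. If 4 divided `w` it would divide the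
-- second as well, hence `2 * Q`.
power-of-two-gap : ∀ {Q w e} → Odd Q → 2 ∣ w → w * (2 * Q + w) ≡ 2 ^ e → w ≡ 2
power-of-two-gap {Q} {w} {e} oQ 2∣w f
  with ∣2^⇒2^ e w (subst (w ∣_) f (m∣m*n (2 * Q + w))) | ∣2^⇒2^ e (2 * Q + w) (subst (2 * Q + w ∣_) f (n∣m*n w))
... | zero , refl | _ = ⊥-elim (1+2*-odd 0 2∣w)
... | suc zero , refl | _ = refl
... | suc (suc i) , refl | j , g = ⊥-elim (oQ (*-cancelˡ-∣ 2 (∣m+n∣m⇒∣n (subst (4 ∣_) (+-comm (2 * Q) w) 4∣sum) 4∣w)))
  where
  4∣w : 4 ∣ w
  4∣w = ^-monoʳ-∣ 2 {2} {2 + i} (s≤s (s≤s z≤n))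
  4∣sum : 4 ∣ 2 * Q + w
  4∣sum = subst (4 ∣_) (sym g) (^-monoʳ-∣ 2 {2} {j} (≤-trans (s≤s (s≤s z≤n))
    (<⇒≤ (^-cancelʳ-< {2} (s≤s z≤n) {2 + i} {j} (subst (w <_) g (m<n+m w (*-pos {2} (s≤s z≤n) (odd-pos oQ))))))))

-- With `k = 2 * l` the difference of squares factors into two powers of 2, so (d + 2)^l - d^l is 2
-- and `l = 1`.
lifted-power-of-two : ∀ {d k e} → 0 < d → Odd d → 2 ∣ k → 0 < k → (d + 2) ^ k ≡ d ^ k + 2 ^ k * 2 ^ e → k ≡ 2 × d + 1 ≡ 2 ^ e
lifted-power-of-two {d} {k} {e} d>0 od ek k>0 f with 2*-even k ek
... | l , refl = cong (2 *_) l≡1 , d+1≡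
  where
  s Q : ℕ
  s = S (d + 2) d l
  Q = d ^ l
  square : ∀ x → x ^ (2 * l) ≡ x ^ l * x ^ l
  square x = trans (^-distribˡ-+-* x l (l + 0)) (cong (λ i → x ^ l * x ^ i) (+-identityʳ l))
  lemma : ∀ Q w → (Q + w) * (Q + w) ≡ Q * Q + w * (2 * Q + w)
  lemma = solve-∀
  gap : 2 * s * (2 * Q + 2 * s) ≡ 2 ^ (2 * l + e)
  gap = +-cancelˡ-≡ (Q * Q) _ _ (trans (sym (lemma Q (2 * s))) (trans (cong₂ _*_ (sym (^-difference d 2 l)) (sym (^-difference d 2 l)))
    (trans (sym (square (d + 2))) (trans f (cong₂ _+_ (square d) (sym (^-distribˡ-+-* 2 (2 * l) e)))))))
  l≡1 : l ≡ 1
  l≡1 = S≡1⇒n≡1 {d + 2} (≤-trans d>0 (m≤m+n d 2)) d>0 (cancelˡ {2} (s≤s z≤n) (power-of-two-gap {e = 2 * l + e} (odd-^ l od) (m∣m*n s) gap))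
  final : ∀ {l} → l ≡ 1 → (d + 2) ^ (2 * l) ≡ d ^ (2 * l) + 2 ^ (2 * l) * 2 ^ e → d + 1 ≡ 2 ^ e
  final refl g = cancelˡ {4} (s≤s z≤n) (+-cancelˡ-≡ (d ^ 2) _ _ (trans (lemma′ d) g))
    where
    lemma′ : ∀ d → d * (d * 1) + 4 * (d + 1) ≡ (d + 2) * ((d + 2) * 1)
    lemma′ = solve-∀
  d+1≡ : d + 1 ≡ 2 ^ e
  d+1≡ = final l≡1 f

corr-powers : ∀ {A B C X Y Z a b c x y z} → A ^ X ≡ a ^ x → B ^ Y ≡ b ^ y → Corr A B C (X , Y , Z) a b c (x , y , z)
corr-powers p q = inj₁ (p , q)

lifted-power : ∀ {b y w} k → b ^ y ≡ w → w ^ k ≡ b ^ (k * y)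
lifted-power {b} {y} k e = trans (cong (_^ k) (sym e)) (trans (^-*-assoc b y k) (cong (b ^_) (*-comm y k)))

-- The parameters are `j = 1`, `g = a`, `u = x` and `w = s`; `g` is odd because consecutive powers
-- differ by an odd number.
familyIII : ∀ {a b c x y z k s D d} → 1 < a → 0 < x → 1 < k → 0 < s → 0 < d →
  b ^ y ≡ D * d → a ^ x ≡ D → (d + 1) ^ k ≡ d ^ k + a ^ s →
  InFamily FamIII a b c (x , y , z) (k * x + s , k * y , k * z)
familyIII {a} {b} {c} {x} {y} {z} {k} {s} {D} {d} a>1 x>0 k>1 s>0 d>0 eb ea ed =
  a ^ 1 , a ^ (1 * x) * d , a ^ (1 * x) * (d + 1) , (x , 1 , 1) , (k * x + s , k , k) ,
  (1 , x , d , a , k , s , s , s≤s z≤n , x>0 , d>0 , a>1 ,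
   (λ h → consecutive-powers-odd {d} {k} (<-trans (s≤s z≤n) k>1) ed (∣-trans h (base∣^ a s>0))) ,
   ed , s>0 , k>1 , sym (*-identityˡ s) , refl , refl , refl , refl , refl) ,
  inj₁ (corr-powers {A = a ^ 1} {B} {C = a ^ (1 * x) * (d + 1)} {x} {1} {1} {a} {b} {c} {x} {y} {z}
    (cong (_^ x) (*-identityʳ a)) (trans (*-identityʳ B) (trans B≡ (sym eb)))) ,
  inj₂ (corr-powers {A = a ^ 1} {B} {C = a ^ (1 * x) * (d + 1)} {k * x + s} {k} {k} {a} {b} {c} {k * x + s} {k * y} {k * z}
    (cong (_^ (k * x + s)) (*-identityʳ a)) (trans (cong (_^ k) B≡) (lifted-power {b} {y} k eb)))
  where
  B : ℕ
  B = a ^ (1 * x) * d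
  B≡ : B ≡ D * d
  B≡ = cong (_* d) (trans (cong (a ^_) (*-identityˡ x)) ea)

-- Here `j = 1` and `g` is the odd part of `a`. Since `a ^ x = D * 2`, the gcd `D` is `a ^ x` with
-- one 2 removed, whence the exponent `i * x ∸ 1`. The condition on `k` follows by computing the
-- power of 2 in the difference twice, from `ed` and from `even-lift-difference`.
familyIV : ∀ {a b c x y z k s D d i g} → 0 < x → 1 < k → 2 ∣ k → 0 < s → 0 < d → Odd d →
  0 < i → 1 < g → Odd g → a ≡ 2 ^ i * g → b ^ y ≡ D * d → a ^ x ≡ D * 2 →
  (d + 2) ^ k ≡ d ^ k + 2 ^ k * a ^ s →
  InFamily FamIV a b c (x , y , z) (k * x + s , k * y , k * z)
familyIV {a} {b} {c} {x} {y} {z} {k} {s} {D} {d} {i} {g} x>0 k>1 ek s>0 d>0 od i>0 g>1 og refl eb ea ed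
  with exact-power 2 (s≤s (s≤s z≤n)) k (<-trans (s≤s z≤n) k>1) | exact-power 2 (s≤s (s≤s z≤n)) (2 * d + 2) (m≤n⇒m≤o+n (2 * d) (s≤s z≤n))
... | zero , l , k≡ , ol | _ = ⊥-elim (ol (subst (2 ∣_) (trans k≡ (*-identityˡ l)) ek))
... | suc v , l , k≡ , ol | h , m , h≡ , om with even-lift-difference d v l od ol
... | o , oo , lift =
  A , B , C , (x , 1 , 1) , (k * x + s , k , k) ,
  (i , 1 , x , d , g , k , s , s , k + i * s , h , suc v , i>0 , s≤s z≤n , x>0 , d>0 , od , g>1 , og ,
   trans ed (cong (d ^ k +_) power) , s>0 , <-trans (s≤s z≤n) k>1 , ek ,
   exact⇒ExactPow {2} {h} {m} (s≤s (s≤s z≤n)) h≡ om , exact⇒ExactPow {2} {suc v} {l} (s≤s (s≤s z≤n)) k≡ ol ,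
   sym (*-identityˡ s) , exponents , refl , refl , refl , refl , refl) ,
  inj₁ (corr-powers {A} {B} {C} {x} {1} {1} {a} {b} {c} {x} {y} {z} (cong (_^ x) A≡) (trans (*-identityʳ B) (trans B≡ (sym eb)))) ,
  inj₂ (corr-powers {A} {B} {C} {k * x + s} {k} {k} {a} {b} {c} {k * x + s} {k * y} {k * z} (cong (_^ (k * x + s)) A≡) (trans (cong (_^ k) B≡) (lifted-power {b} {y} k eb)))
  where
  A B C : ℕ
  A = 2 ^ i * g ^ 1
  B = 2 ^ (i * x ∸ 1) * g ^ (1 * x) * d
  C = 2 ^ (i * x ∸ 1) * g ^ (1 * x) * (d + 2)
  A≡ : A ≡ 2 ^ i * g
  A≡ = cong (2 ^ i *_) (*-identityʳ g)
  power-a : ∀ n → (2 ^ i * g) ^ n ≡ 2 ^ (i * n) * g ^ n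
  power-a n = trans (^-distribʳ-* n (2 ^ i) g) (cong (_* g ^ n) (^-*-assoc 2 i n))
  power : 2 ^ k * (2 ^ i * g) ^ s ≡ 2 ^ (k + i * s) * g ^ s
  power = trans (cong (2 ^ k *_) (power-a s)) (trans (sym (*-assoc (2 ^ k) _ _)) (cong (_* g ^ s) (sym (^-distribˡ-+-* 2 k (i * s)))))
  D≡ : 2 ^ (i * x ∸ 1) * g ^ (1 * x) ≡ D
  D≡ = cancelʳ {2} (s≤s z≤n) (begin
    2 ^ (i * x ∸ 1) * g ^ (1 * x) * 2   ≡⟨ lemma (2 ^ (i * x ∸ 1)) (g ^ (1 * x)) ⟩
    2 ^ (1 + (i * x ∸ 1)) * g ^ (1 * x) ≡⟨ cong₂ (λ u w → 2 ^ u * g ^ w) (m+[n∸m]≡n (*-pos i>0 x>0)) (*-identityˡ x) ⟩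
    2 ^ (i * x) * g ^ x                 ≡⟨ sym (power-a x) ⟩
    (2 ^ i * g) ^ x                     ≡⟨ ea ⟩
    D * 2                               ∎)
    where
    open ≡-Reasoning
    lemma : ∀ u w → u * w * 2 ≡ 2 * u * w
    lemma = solve-∀
  B≡ : B ≡ D * d
  B≡ = cong (_* d) D≡
  lift′ : (d + 2) ^ k ≡ d ^ k + 2 ^ suc v * (2 * d + 2) * o
  lift′ = subst (λ n → (d + 2) ^ n ≡ d ^ n + 2 ^ suc v * (2 * d + 2) * o) (sym k≡) lift
  lemma : ∀ p q m o → p * (q * m) * o ≡ q * p * (m * o)
  lemma = solve-∀
  exponents : k + i * s ≡ h + suc v
  exponents = proj₁ (exact-power-unique {2} (s≤s (s≤s z≤n)) (k + i * s) (h + suc v) (odd-^ s og) (odd-* om oo)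
    (trans (sym power) (trans (+-cancelˡ-≡ (d ^ k) _ _ (trans (sym ed) lift′))
      (trans (cong (λ u → 2 ^ suc v * u * o) h≡) (trans (lemma (2 ^ suc v) (2 ^ h) m o) (cong (_* (m * o)) (sym (^-distribˡ-+-* 2 h (suc v)))))))))

-- The family has first base 2 while `a = 2 ^ i`, so the first exponents are rescaled by `i`. The
-- value `h = 1 + i * s` is dictated by `d + 1 = 2 ^ (i * s)`.
familyI : ∀ {a b c x y z s d i u} → 0 < i → 0 < s → 0 < u → a ≡ 2 ^ i → b ^ y ≡ 2 ^ u * d →
  i * x ≡ 1 + u → d + 1 ≡ 2 ^ (i * s) →
  InFamily FamI a b c (x , y , z) (2 * x + s , 2 * y , 2 * z)
familyI {a} {b} {c} {x} {y} {z} {s} {d} {i} {u} i>0 s>0 u>0 refl eb ea ed =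
  2 , B , C , (u + 1 , 1 , 1) , (2 * u + h + 1 , 2 , 2) ,
  (u , h , u>0 , s≤s (*-pos i>0 s>0) , refl , refl , refl , refl , refl) ,
  inj₁ (corr-powers {2} {B} {C} {u + 1} {1} {1} {a} {b} {c} {x} {y} {z}
    (trans (cong (2 ^_) (trans (+-comm u 1) (sym ea))) (sym (^-*-assoc 2 i x))) (trans (*-identityʳ B) (trans B≡ (sym eb)))) ,
  inj₂ (corr-powers {2} {B} {C} {2 * u + h + 1} {2} {2} {a} {b} {c} {2 * x + s} {2 * y} {2 * z}
    (trans (cong (2 ^_) exponent) (sym (^-*-assoc 2 i (2 * x + s)))) (trans (cong (_^ 2) B≡) (lifted-power {b} {y} 2 eb)))
  where
  h B C : ℕ
  h = 1 + i * s
  B = 2 ^ u * (2 ^ (i * s) ∸ 1)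
  C = 2 ^ u * (2 ^ (i * s) + 1)
  B≡ : B ≡ 2 ^ u * d
  B≡ = cong (2 ^ u *_) (trans (cong (_∸ 1) (sym ed)) (m+n∸n≡m d 1))
  lemma₁ : ∀ u w → 2 * u + (1 + w) + 1 ≡ 2 * (1 + u) + w
  lemma₁ = solve-∀
  lemma₂ : ∀ i x s → 2 * (i * x) + i * s ≡ i * (2 * x + s)
  lemma₂ = solve-∀
  exponent : 2 * u + h + 1 ≡ i * (2 * x + s)
  exponent = trans (lemma₁ u (i * s)) (trans (cong (λ w → 2 * w + i * s) (sym ea)) (lemma₂ i x s))

-- Exponential equations that bound the number of solutions

power-of-two-minus-one : ∀ {a s k} → 1 < a → 0 < s → a ^ s + 1 ≡ 2 ^ k → s ≡ 1
power-of-two-minus-one {a} {s} {k} a>1 s>0 e with 1 <? s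
... | no h = ≤-antisym (≮⇒≥ h) s>0
... | yes h = ⊥-elim (power-sum≢2^ {a} {1} {s} (s≤s z≤n) a>1 (λ (_ , d) → ∣1⇒≡1 d) h (k , trans (cong (a ^ s +_) (^-zeroˡ s)) e))

-- Halve `x` and `y` while both are even. Two odd exponents make `a ^ x + 1` an odd multiple of both
-- `2 ^ k` and `2 ^ l`. Mixed parities conflict modulo 4.
dependent-mersenne : ∀ {a b k l} x y → 1 < a → 1 < b → 1 < k → 1 < l → 0 < x → a + 1 ≡ 2 ^ k → b + 1 ≡ 2 ^ l → a ^ x ≡ b ^ y → k ≡ l
dependent-mersenne {a} {b} {k} {l} x y a>1 b>1 k>1 l>1 x>0 ea eb e = go x x y ≤-refl x>0 e
  where
  odd-case : ∀ {a k} x → 1 < a → a + 1 ≡ 2 ^ k → Odd x → ∃[ T ] (Odd T × a ^ x + 1 ≡ 2 ^ k * T)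
  odd-case {a} {k} x a>1 ea ox with split-< a>1 | odd⇒1+2* x ox
  ... | δ , refl , _ | j , refl = T 1 δ j , T-odd {1} {δ} j (1+2*-odd 0) ,
    trans (cong (a ^ x +_) (sym (^-zeroˡ x))) (trans (odd-power-sum 1 δ j) (cong (_* T 1 δ j) ea))
  base-odd : ∀ {a k} → 1 < k → a + 1 ≡ 2 ^ k → Odd a
  base-odd {a} {k} k>1 ea d = 1+2*-odd 0 (∣m+n∣m⇒∣n (subst (2 ∣_) (sym ea) (base∣^ 2 (<-trans (s≤s z≤n) k>1))) d)
  mixed : ∀ {a b k l} x y → 1 < b → 1 < l → Odd a → b + 1 ≡ 2 ^ l → 2 ∣ x → Odd y → a ^ x ≢ b ^ y
  mixed {a} {b} {k} {l} x y b>1 l>1 oa eb ex oy e with odd-case {b} {l} y b>1 eb oy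
  ... | T , _ , f = even-powers-sum {a} {1} {x} oa (1+2*-odd 0) ex
    (subst (4 ∣_) (trans (sym f) (cong₂ _+_ (sym e) (sym (^-zeroˡ x)))) (∣m⇒∣m*n T (^-monoʳ-∣ 2 {2} {l} l>1)))
  go : ∀ n x y → x ≤ n → 0 < x → a ^ x ≡ b ^ y → k ≡ l
  go zero x y x≤n x>0 e = ⊥-elim (<⇒≱ x>0 x≤n)
  go (suc n) x y x≤n x>0 e with 2 ∣? x | 2 ∣? y
  ... | yes ex | no oy = ⊥-elim (mixed {a} {b} {k} {l} x y b>1 l>1 (base-odd k>1 ea) eb ex oy e)
  ... | no ox | yes ey = ⊥-elim (mixed {b} {a} {l} {k} y x a>1 k>1 (base-odd l>1 eb) ea ey ox (sym e))
  ... | no ox | no oy with odd-case {a} {k} x a>1 ea ox | odd-case {b} {l} y b>1 eb oy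
  ... | T , oT , f | T′ , oT′ , f′ = proj₁ (exact-power-unique {2} (s≤s (s≤s z≤n)) k l oT oT′ (trans (sym f) (trans (cong (_+ 1) e) f′)))
  go (suc n) x y x≤n x>0 e | yes (divides x′ refl) | yes (divides y′ refl) =
    go n x′ y′ (≤-pred (≤-trans (m<m*n x′ 2 {{>-nonZero (*-pos⁻¹ˡ x>0)}} (s≤s (s≤s z≤n))) x≤n)) (*-pos⁻¹ˡ x>0)
      (^-cancelˡ-≡ 2 (s≤s z≤n) (trans (^-*-assoc a x′ 2) (trans e (sym (^-*-assoc b y′ 2)))))

-- For odd `z` the cofactor of c - 1 is an odd divisor of a power of 2. For `z = 2 * l` the numbers
-- c^l - 1 and c^l + 1 are both powers of 2, so `c ^ l = 3`.
power-minus-one : ∀ {c z r} → 1 < c → Odd c → 0 < z → c ^ z ≡ 1 + 2 ^ r → z ≡ 1 ⊎ (z ≡ 2 × c ≡ 3)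
power-minus-one {c} {z} {r} c>1 oc z>0 e with 2 ∣? z
... | no oz = inj₁ (odd-case (split-< c>1))
  where
  odd-case : ∃[ w ] (c ≡ 1 + w × 0 < w) → z ≡ 1
  odd-case (w , refl , _) = S≡1⇒n≡1 {1 + w} {1} {z} (s≤s z≤n) (s≤s z≤n) (odd∣2^⇒1 r (S-odd {1} {w} {z} (1+2*-odd 0) 2∣w oz) (divides w (sym w*S≡)))
    where
    2∣w : 2 ∣ w
    2∣w with 2 ∣? w
    ... | yes h = h
    ... | no h = ⊥-elim (oc (odd+odd (1+2*-odd 0) h))
    w*S≡ : w * S (1 + w) 1 z ≡ 2 ^ r
    w*S≡ = +-cancelˡ-≡ 1 _ _ (trans (cong (_+ w * S (1 + w) 1 z) (sym (^-zeroˡ z))) (trans (sym (^-difference 1 w z)) e))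
... | yes ez with 2*-even z ez
... | l , refl = inj₂ (even-case (split-< (1<^ {c} {l} c>1 l>0)))
  where
  l>0 : 0 < l
  l>0 = *-pos⁻¹ʳ 2 z>0
  even-case : ∃[ w ] (c ^ l ≡ 1 + w × 0 < w) → 2 * l ≡ 2 × c ≡ 3
  even-case (w , f , _) = cong (2 *_) l≡1 , trans (sym (*-identityʳ c)) (trans (cong (c ^_) (sym l≡1)) c^l≡3)
    where
    lemma : ∀ w → 1 + w * (2 * 1 + w) ≡ (1 + w) * (1 + w)
    lemma = solve-∀
    gap : w * (2 * 1 + w) ≡ 2 ^ r
    gap = +-cancelˡ-≡ 1 _ _ (trans (lemma w) (trans (cong₂ _*_ (sym f) (sym f))
      (trans (trans (sym (^-distribˡ-+-* c l l)) (cong (λ i → c ^ (l + i)) (sym (+-identityʳ l)))) e)))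
    2∣w : 2 ∣ w
    2∣w with 2 ∣? w
    ... | yes h = h
    ... | no h = ⊥-elim (odd-^ l oc (subst (2 ∣_) (sym f) (odd+odd (1+2*-odd 0) h)))
    c^l≡3 : c ^ l ≡ 3
    c^l≡3 = trans f (cong suc (power-of-two-gap {1} {w} {r} (1+2*-odd 0) 2∣w gap))
    l≡1 : l ≡ 1
    l≡1 = ≤-antisym (≮⇒≥ λ l>1 → <⇒≱ (≤-refl {4}) (subst (4 ≤_) c^l≡3
      (≤-trans (^-monoˡ-≤ 2 c>1) (^-monoʳ-≤ c {{>-nonZero (<⇒≤ c>1)}} l>1)))) l>0

-- The exponent is even, `k = 2 * l`, and lifting 9^l - 1 at 2 gives `2 ^ (2 * l) * 2 ∣ 8 * l`. This
-- forces `l = 1`.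
3^k≡1+2^k*a^s : ∀ {a k s} → 2 ∣ a → 1 < k → 0 < s → 3 ^ k ≡ 1 + 2 ^ k * a ^ s → a ^ s ≡ 2
3^k≡1+2^k*a^s {a} {k} {s} 2∣a k>1 s>0 e
  with 2*-even k (lifted-2-even {1} {k} {a ^ s} (1+2*-odd 0) k>1 (trans e (cong (_+ 2 ^ k * a ^ s) (sym (^-zeroˡ k)))))
... | zero , refl = ⊥-elim (<⇒≱ k>1 z≤n)
... | suc zero , refl = cancelˡ {4} (s≤s z≤n) (+-cancelˡ-≡ 1 _ _ (sym e))
... | l@(suc (suc r)) , refl = ⊥-elim (<⇒≱ (1+r<3^r (suc r) (s≤s z≤n)) (≤-trans (^-monoˡ-≤ (suc r) (n≤1+n 3)) bound))
  where
  8S≡ : 8 * S 9 1 l ≡ 2 ^ (2 * l) * a ^ s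
  8S≡ = +-cancelˡ-≡ 1 _ _ (trans (cong (_+ 8 * S 9 1 l) (sym (^-zeroˡ l))) (trans (sym (^-difference 1 8 l)) (trans (^-*-assoc 3 2 l) e)))
  divides-8S : 2 ^ (2 * l) * 2 ∣ 8 * S 9 1 l
  divides-8S = subst (2 ^ (2 * l) * 2 ∣_) (sym 8S≡) (*-monoʳ-∣ (2 ^ (2 * l)) (∣-trans 2∣a (base∣^ a s>0)))
  K>0 : 0 < 2 ^ (2 * l) * 2
  K>0 = *-pos (^-pos (2 * l) (s≤s z≤n)) (s≤s z≤n)
  lifting : 2 ^ (2 * l) * 2 ∣ 8 * l
  lifting = lte {l} (s≤s z≤n) {1} {8} {2 ^ (2 * l) * 2} {8} K>0 (λ (_ , d) → ∣1⇒≡1 d)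
    (λ q pq d → ∣-trans (prime-∣^ pq 2 (2 * l + 1) (subst (q ∣_) (sym (^-distribˡ-+-* 2 (2 * l) 1)) d)) (divides 4 refl))
    (λ _ → divides 2 refl) divides-8S
  bound : 4 ^ suc r ≤ 1 + suc r
  bound = *-cancelˡ-≤ 8 (subst (_≤ 8 * l) eq (∣-≤ (s≤s z≤n) lifting))
    where
    lemma : ∀ u → 4 * u * 2 ≡ 8 * u
    lemma = solve-∀
    eq : 2 ^ (2 * l) * 2 ≡ 8 * 4 ^ suc r
    eq = trans (cong (_* 2) (sym (^-*-assoc 2 2 l))) (lemma (4 ^ suc r))

-- Modulo N one has c = N + 2 ≡ 2, so c^r ≡ 1 and N^y divides z (c^r - 1) by lifting the exponent;
-- the cofactor 2^r of c^r - 1 is prime to N and can be removed, which makes N^y too large.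
no-type-B-solution : ∀ {N r z y t} → 1 < r → N + 1 ≡ 2 ^ r → 0 < z → z < y → (N + 2) ^ z ≢ 1 + 2 ^ t * N ^ y
no-type-B-solution {N} {r} {z} {y} {t} r>1 eN z>0 z<y e = <⇒≱ too-small too-big
  where
  open ≤-Reasoning
  r>0 : 0 < r
  r>0 = <-trans (s≤s z≤n) r>1
  N≥3 : 3 ≤ N
  N≥3 = +-cancelʳ-≤ 1 3 N (subst (4 ≤_) (sym eN) (^-monoʳ-≤ 2 {2} {r} r>1))
  N>0 : 0 < N
  N>0 = ≤-trans (s≤s z≤n) N≥3
  r≤N : r ≤ N
  r≤N = ≤-pred (subst (r <_) (trans (sym eN) (+-comm N 1)) (n<2^n r))
  N-odd : Odd N
  N-odd d = 1+2*-odd 0 (∣m+n∣m⇒∣n (subst (2 ∣_) (sym eN) (base∣^ 2 r>0)) d)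
  c≡ : ∀ k → (N + 2) ^ k ≡ 2 ^ k + N * S (2 + N) 2 k
  c≡ k = trans (cong (_^ k) (+-comm N 2)) (^-difference 2 N k)
  N∣c^z∸1 : ∀ {k w} → 0 < k → (N + 2) ^ k ≡ 1 + w → N ∣ w → ∃[ q ] 2 ^ k ≡ 1 + N * q
  N∣c^z∸1 {k} {w} k>0 f d with split-< (1<^ {2} {k} (s≤s (s≤s z≤n)) k>0)
  ... | v , g , _ with ∣m+n∣m⇒∣n (subst (N ∣_) (+-comm v (N * S (2 + N) 2 k)) (subst (N ∣_) (+-cancelˡ-≡ 1 _ _ (trans (sym f) (trans (c≡ k) (cong (_+ N * S (2 + N) 2 k) g)))) d)) (m∣m*n (S (2 + N) 2 k))
  ... | divides q h = q , trans g (cong suc (trans h (*-comm q N)))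
  -- `2 ^ z` is congruent to 1 modulo `N` and exceeds 1, so it is at least `1 + N = 2 ^ r`.
  r≤z : r ≤ z
  r≤z with N∣c^z∸1 z>0 e (∣n⇒∣m*n (2 ^ t) (base∣^ N (<-trans z>0 z<y)))
  ... | zero , f = ⊥-elim (<⇒≢ (1<^ {2} {z} (s≤s (s≤s z≤n)) z>0) (sym (trans f (cong suc (*-zeroʳ N)))))
  ... | suc q , f = ≮⇒≥ λ z<r → <⇒≱ (^-monoʳ-< 2 (s≤s (s≤s z≤n)) z<r) (begin
    2 ^ r            ≡⟨ trans (sym eN) (+-comm N 1) ⟩
    1 + N            ≤⟨ s≤s (m≤m*n N (suc q)) ⟩
    1 + N * suc q    ≡⟨ sym f ⟩
    2 ^ z            ∎)
  w : ℕ
  w = S (1 + 2 ^ r) 1 r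
  c^r≡ : (N + 2) ^ r ≡ 1 + 2 ^ r * w
  c^r≡ = trans (cong (_^ r) (trans (sym (+-assoc N 1 1)) (trans (+-comm (N + 1) 1) (cong suc eN))))
    (trans (^-difference 1 (2 ^ r) r) (cong (_+ 2 ^ r * w) (^-zeroˡ r)))
  w>0 : 0 < w
  w>0 = S-pos {1 + 2 ^ r} {1} {r} (s≤s z≤n) r>0
  N∣2^r*w : N ∣ 2 ^ r * w
  N∣2^r*w = divides (1 + S (2 + N) 2 r) (+-cancelˡ-≡ 1 _ _ (trans (sym c^r≡) (trans (c≡ r)
    (trans (cong (_+ N * S (2 + N) 2 r) (trans (sym eN) (+-comm N 1))) (cong suc (lemma N (S (2 + N) 2 r)))))))
    where
    lemma : ∀ N s → N + N * s ≡ (1 + s) * N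
    lemma = solve-∀
  -- c^(r z) - 1 computed in two ways
  N^y∣ : N ^ y ∣ 2 ^ r * w * S (1 + 2 ^ r * w) 1 z
  N^y∣ = subst (N ^ y ∣_) (+-cancelˡ-≡ 1 _ _ two-ways) (∣m⇒∣m*n (S (1 + 2 ^ t * N ^ y) 1 r) (n∣m*n (2 ^ t)))
    where
    one : ∀ X k → (1 + X) ^ k ≡ 1 + X * S (1 + X) 1 k
    one X k = trans (^-difference 1 X k) (cong (_+ X * S (1 + X) 1 k) (^-zeroˡ k))
    two-ways : 1 + 2 ^ t * N ^ y * S (1 + 2 ^ t * N ^ y) 1 r ≡ 1 + 2 ^ r * w * S (1 + 2 ^ r * w) 1 z
    two-ways = trans (sym (one (2 ^ t * N ^ y) r)) (trans (cong (_^ r) (sym e)) (trans (^-^-comm (N + 2) z r)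
      (trans (cong (_^ z) c^r≡) (one (2 ^ r * w) z))))
  N^y∣wz : N ^ y ∣ w * z
  N^y∣wz = coprime-divisor {n = 2 ^ r} (coprime-^ N>0 (coprime-sym (prime-coprime prime[2] N-odd)) y r)
    (subst (N ^ y ∣_) (*-assoc (2 ^ r) w z) (lte z>0 {1} {2 ^ r * w} {N ^ y} {2 ^ r * w} (^-pos y N>0) (λ (_ , d) → ∣1⇒≡1 d)
      (λ q pq d → ∣-trans (prime-∣^ pq N y d) N∣2^r*w) (λ d → ⊥-elim (odd-^ y N-odd d)) N^y∣))
  -- By `N + 2 ≤ 2 * N`, and the factor `2 ^ r` cancels on both sides.
  w<N^r : w < N ^ r
  w<N^r = *-cancelˡ-< (2 ^ r) w (N ^ r) (begin-strict
    2 ^ r * w         <⟨ ≤-refl ⟩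
    1 + 2 ^ r * w     ≡⟨ sym c^r≡ ⟩
    (N + 2) ^ r       ≤⟨ ^-monoˡ-≤ r (+-monoʳ-≤ N (≤-trans (<⇒≤ N≥3) (≤-reflexive (sym (+-identityʳ N))))) ⟩
    (2 * N) ^ r       ≡⟨ ^-distribʳ-* r 2 N ⟩
    2 ^ r * N ^ r     ∎)
  too-small : N ^ y < N ^ r * z
  too-small = ≤-<-trans (∣-≤ (*-pos w>0 z>0) N^y∣wz) (*-monoˡ-< z {{>-nonZero z>0}} w<N^r)
  -- With `z = r + j` this gives `N ^ r * z ≤ N ^ suc z ≤ N ^ y`, against `too-small`.
  grow : ∀ j → r + j ≤ N ^ suc j
  grow zero = subst₂ _≤_ (sym (+-identityʳ r)) (sym (*-identityʳ N)) r≤N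
  grow (suc j) = begin
    r + suc j            ≡⟨ +-suc r j ⟩
    1 + (r + j)          ≤⟨ +-mono-≤ (^-pos (suc j) N>0) (grow j) ⟩
    N ^ suc j + N ^ suc j ≡⟨ cong (N ^ suc j +_) (sym (+-identityʳ (N ^ suc j))) ⟩
    2 * N ^ suc j        ≤⟨ *-monoˡ-≤ (N ^ suc j) (<⇒≤ N≥3) ⟩
    N * N ^ suc j        ∎
  too-big : N ^ r * z ≤ N ^ y
  too-big with m≤n⇒∃[o]m+o≡n r≤z
  ... | j , refl = begin
    N ^ r * (r + j)      ≤⟨ *-monoʳ-≤ (N ^ r) (grow j) ⟩
    N ^ r * N ^ suc j    ≡⟨ sym (^-distribˡ-+-* N r (suc j)) ⟩
    N ^ (r + suc j)      ≤⟨ ^-monoʳ-≤ N {{>-nonZero N>0}} (subst (_≤ y) (sym (+-suc r j)) z<y) ⟩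
    N ^ y                ∎

-- Powers of 9 are 1, 2 or 4 modulo 7, and 3 times these is 3, 6 or 5. The lemma serves the
-- exceptional case 7 + 2 = 3^2, where `d + 2` is a proper power.
3^odd≢1-mod-7 : ∀ j {m} → 3 ^ (1 + 2 * j) ≢ 1 + 7 * m
3^odd≢1-mod-7 j {m} e = contradict (residue j)
  where
  residue : ∀ j → ∃[ q ] (9 ^ j ≡ 7 * q + 1 ⊎ 9 ^ j ≡ 7 * q + 2 ⊎ 9 ^ j ≡ 7 * q + 4)
  residue zero = 0 , inj₁ refl
  residue (suc j) with residue j
  ... | q , inj₁ f = 9 * q + 1 , inj₂ (inj₁ (trans (cong (9 *_) f) (lemma q)))
    where
    lemma : ∀ q → 9 * (7 * q + 1) ≡ 7 * (9 * q + 1) + 2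
    lemma = solve-∀
  ... | q , inj₂ (inj₁ f) = 9 * q + 2 , inj₂ (inj₂ (trans (cong (9 *_) f) (lemma q)))
    where
    lemma : ∀ q → 9 * (7 * q + 2) ≡ 7 * (9 * q + 2) + 4
    lemma = solve-∀
  ... | q , inj₂ (inj₂ f) = 9 * q + 5 , inj₁ (trans (cong (9 *_) f) (lemma q))
    where
    lemma : ∀ q → 9 * (7 * q + 4) ≡ 7 * (9 * q + 5) + 1
    lemma = solve-∀
  absurd : ∀ q n → 0 < n → n < 7 → 7 * q + n ≢ 7 * m
  absurd q n n>0 n<7 f = <⇒≱ n<7 (∣-≤ n>0 (∣m+n∣m⇒∣n (subst (7 ∣_) (sym f) (m∣m*n m)) (m∣m*n q)))
  start : ∀ {u} → 9 ^ j ≡ u → 3 * u ≡ 1 + 7 * m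
  start f = trans (cong (3 *_) (trans (sym f) (^-*-assoc 3 2 j))) e
  contradict : ∃[ q ] (9 ^ j ≡ 7 * q + 1 ⊎ 9 ^ j ≡ 7 * q + 2 ⊎ 9 ^ j ≡ 7 * q + 4) → ⊥
  contradict (q , inj₁ f) = absurd (3 * q) 2 (s≤s z≤n) (s≤s (s≤s (s≤s z≤n))) (+-cancelˡ-≡ 1 _ _ (trans (lemma q) (start f)))
    where
    lemma : ∀ q → 1 + (7 * (3 * q) + 2) ≡ 3 * (7 * q + 1)
    lemma = solve-∀
  contradict (q , inj₂ (inj₁ f)) = absurd (3 * q) 5 (s≤s z≤n) (s≤s (s≤s (s≤s (s≤s (s≤s (s≤s z≤n)))))) (+-cancelˡ-≡ 1 _ _ (trans (lemma q) (start f)))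
    where
    lemma : ∀ q → 1 + (7 * (3 * q) + 5) ≡ 3 * (7 * q + 2)
    lemma = solve-∀
  contradict (q , inj₂ (inj₂ f)) = absurd (3 * q + 1) 4 (s≤s z≤n) (s≤s (s≤s (s≤s (s≤s (s≤s z≤n))))) (+-cancelˡ-≡ 1 _ _ (trans (lemma q) (start f)))
    where
    lemma : ∀ q → 1 + (7 * (3 * q + 1) + 4) ≡ 3 * (7 * q + 4)
    lemma = solve-∀

-- At most two solutions

coprime-gcd-unique : ∀ {D m n D′ m′ n′} → Coprime m n → Coprime m′ n′ → D * m ≡ D′ * m′ → D * n ≡ D′ * n′ → D ≡ D′
coprime-gcd-unique {D} {m} {n} {D′} {m′} {n′} c c′ e f = begin
  D                        ≡⟨ sym (*-identityʳ D) ⟩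
  D * 1                    ≡⟨ cong (D *_) (sym (coprime⇒gcd≡1 c)) ⟩
  D * gcd m n              ≡⟨ c*gcd[m,n]≡gcd[cm,cn] D m n ⟩
  gcd (D * m) (D * n)      ≡⟨ cong₂ gcd e f ⟩
  gcd (D′ * m′) (D′ * n′)  ≡⟨ sym (c*gcd[m,n]≡gcd[cm,cn] D′ m′ n′) ⟩
  D′ * gcd m′ n′           ≡⟨ cong (D′ *_) (coprime⇒gcd≡1 c′) ⟩
  D′ * 1                   ≡⟨ *-identityʳ D′ ⟩
  D′                       ∎
  where open ≡-Reasoning

-- The gap δ′ of the second pair is δ^k a^s, which exceeds 2.
lifted-chain : ∀ {a b c x₁ y z x₂ x₃ k l} → 1 < a → 0 < b → 1 < k →
  Lifted a (b ^ y) (c ^ z) x₁ k x₂ → Lifted a (b ^ (k * y)) (c ^ (k * z)) x₂ l x₃ → ⊥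
lifted-chain {a} {b} {c} {x₁} {y} {z} {k = k} a>1 b>0 k>1
  (lifted D d δ s d>0 s>0 δ-small cdδ B≡ C≡ _ _ diff) (lifted D′ d′ δ′ _ _ _ δ′-small cdδ′ B≡′ C≡′ _ _ _) = contradict δ-small δ′-small
  where
  bD : D ^ k * d ^ k ≡ D′ * d′
  bD = trans (sym (^-distribʳ-* k D d)) (trans (lifted-power {b} {y} k B≡) B≡′)
  cD : D ^ k * (d + δ) ^ k ≡ D′ * (d′ + δ′)
  cD = trans (sym (^-distribʳ-* k D (d + δ))) (trans (lifted-power {c} {z} k C≡) C≡′)
  D′≡ : D ^ k ≡ D′
  D′≡ = coprime-gcd-unique (coprime-^ d>0 (coprime-+ʳ cdδ) k k) (coprime-+ʳ cdδ′) bD cD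
  D^k>0 : 0 < D ^ k
  D^k>0 = ^-pos k (*-pos⁻¹ˡ (subst (0 <_) B≡ (^-pos y b>0)))
  d′≡ : d ^ k ≡ d′
  d′≡ = cancelˡ D^k>0 (trans bD (cong (_* d′) (sym D′≡)))
  δ′≡ : δ ^ k * a ^ s ≡ δ′
  δ′≡ = +-cancelˡ-≡ (d ^ k) _ _ (trans (sym diff) (trans (cancelˡ D^k>0 (trans cD (cong (_* (d′ + δ′)) (sym D′≡)))) (cong (_+ δ′) (sym d′≡))))
  a^s>1 : 1 < a ^ s
  a^s>1 = 1<^ a>1 s>0
  contradict : δ ≡ 1 ⊎ δ ≡ 2 → δ′ ≡ 1 ⊎ δ′ ≡ 2 → ⊥
  contradict (inj₁ refl) h = small h
    where
    a^s≡ : a ^ s ≡ δ′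
    a^s≡ = trans (sym (trans (cong (_* a ^ s) (^-zeroˡ k)) (*-identityˡ (a ^ s)))) δ′≡
    small : δ′ ≡ 1 ⊎ δ′ ≡ 2 → ⊥
    small (inj₁ refl) = <⇒≢ a^s>1 (sym a^s≡)
    -- After a gap 1 the new gap is `a ^ s`, a difference of consecutive powers; it is odd and
    -- cannot be 2.
    small (inj₂ refl) = consecutive-powers-odd {d} {k} (<-trans (s≤s z≤n) k>1) diff
      (subst (2 ∣_) (sym δ′≡) ∣-refl)
  contradict (inj₂ refl) h = <⇒≱ (≤-trans (s≤s (s≤s (s≤s z≤n))) (subst (8 ≤_) δ′≡ (*-mono-≤ (^-monoʳ-≤ 2 {2} {k} k>1) a^s>1))) (small h)
    where
    small : δ′ ≡ 1 ⊎ δ′ ≡ 2 → δ′ ≤ 2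
    small (inj₁ refl) = s≤s z≤n
    small (inj₂ refl) = ≤-refl

no-three-proportional : ∀ {a b c x₁ y₁ z₁ x₂ y₂ z₂ x₃ y₃ z₃} → 1 < a → 1 < b →
  Sol a b c (x₁ , y₁ , z₁) → Sol a b c (x₂ , y₂ , z₂) → Sol a b c (x₃ , y₃ , z₃) →
  y₁ * z₂ ≡ y₂ * z₁ → y₂ * z₃ ≡ y₃ * z₂ → y₁ < y₂ → y₂ < y₃ → ⊥
no-three-proportional {a} {b} {c} {x₁} {y₁} {z₁} {x₂} a>1 b>1 σ₁ σ₂ σ₃ p₁₂ p₂₃ y₁<y₂ y₂<y₃
  with proportional-bc a>1 b>1 σ₁ σ₂ p₁₂ y₁<y₂
... | k , k>1 , refl , refl , L₁₂ with proportional-bc a>1 b>1 σ₂ σ₃ p₂₃ y₂<y₃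
... | l , _ , _ , _ , L₂₃ = lifted-chain {a} {b} {c} {x₁} {y₁} {z₁} a>1 (<-trans (s≤s z≤n) b>1) k>1 L₁₂ L₂₃

proportional-trans : ∀ {y₁ z₁ y₂ z₂ y₃ z₃} → 0 < y₁ → y₁ * z₂ ≡ y₂ * z₁ → y₁ * z₃ ≡ y₃ * z₁ → y₂ * z₃ ≡ y₃ * z₂
proportional-trans {y₁} {z₁} {y₂} {z₂} {y₃} {z₃} y₁>0 e f = cancelˡ y₁>0 (begin
  y₁ * (y₂ * z₃)  ≡⟨ lemma y₁ y₂ z₃ ⟩
  y₂ * (y₁ * z₃)  ≡⟨ cong (y₂ *_) f ⟩
  y₂ * (y₃ * z₁)  ≡⟨ lemma y₂ y₃ z₁ ⟩
  y₃ * (y₂ * z₁)  ≡⟨ cong (y₃ *_) (sym e) ⟩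
  y₃ * (y₁ * z₂)  ≡⟨ lemma y₃ y₁ z₂ ⟩
  y₁ * (y₃ * z₂)  ∎)
  where
  open ≡-Reasoning
  lemma : ∀ a b c → a * (b * c) ≡ b * (a * c)
  lemma = solve-∀

same-y : ∀ {a b c x₁ x₂ y z₁ z₂} → Sol a b c (x₁ , y , z₁) → Sol a b c (x₂ , y , z₂) → y * z₂ ≡ y * z₁ →
  SameSol a b c (x₁ , y , z₁) (x₂ , y , z₂)
same-y {a} {b} {c} {x₁} {x₂} {y} (_ , y>0 , _ , e₁) (_ , _ , _ , e₂) p with cancelˡ y>0 p
... | refl = inj₁ (+-cancelʳ-≡ (b ^ y) (a ^ x₁) (a ^ x₂) (trans e₁ (sym e₂)) , refl)

-- Wherever `y₃` lies relative to `y₁ < y₂`, a new value would complete a chain of three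
-- proportional solutions.
proportional-cover : ∀ {a b c x₁ y₁ z₁ x₂ y₂ z₂ x₃ y₃ z₃} → 1 < a → 1 < b →
  Sol a b c (x₁ , y₁ , z₁) → Sol a b c (x₂ , y₂ , z₂) → Sol a b c (x₃ , y₃ , z₃) →
  y₁ * z₂ ≡ y₂ * z₁ → y₁ < y₂ → y₁ * z₃ ≡ y₃ * z₁ →
  SameSol a b c (x₃ , y₃ , z₃) (x₁ , y₁ , z₁) ⊎ SameSol a b c (x₃ , y₃ , z₃) (x₂ , y₂ , z₂)
proportional-cover {a} {b} {c} {x₁} {y₁} {z₁} {x₂} {y₂} {z₂} {x₃} {y₃} {z₃} a>1 b>1 σ₁ σ₂ σ₃ p₁₂ y₁<y₂ p₁₃ with <-cmp y₃ y₁
... | tri< h _ _ = ⊥-elim (no-three-proportional a>1 b>1 σ₃ σ₁ σ₂ (sym p₁₃) p₁₂ h y₁<y₂)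
... | tri≈ _ refl _ = inj₁ (same-y {x₁ = x₃} {x₁} σ₃ σ₁ (sym p₁₃))
... | tri> _ _ h with <-cmp y₃ y₂
... | tri< g _ _ = ⊥-elim (no-three-proportional a>1 b>1 σ₁ σ₃ σ₂ p₁₃ (proportional-trans {y₁} {z₁} {y₃} {z₃} {y₂} {z₂} (proj₁ (proj₂ σ₁)) p₁₃ p₁₂) h g)
... | tri≈ _ refl _ = inj₂ (same-y {x₁ = x₃} {x₂} σ₃ σ₂ (proportional-trans {y₁} {z₁} {y₃} {z₃} {y₂} {z₂} (proj₁ (proj₂ σ₁)) p₁₃ p₁₂))
... | tri> _ _ g = ⊥-elim (no-three-proportional a>1 b>1 σ₁ σ₂ σ₃ p₁₂ (proportional-trans {y₁} {z₁} {y₂} {z₂} {y₃} {z₃} (proj₁ (proj₂ σ₁)) p₁₂ p₁₃) y₁<y₂ g)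

-- The first power equation forces `a = 2` and the second makes `b` odd. Then `D = b ^ y` is an odd
-- divisor of a power of 2.
gap-2-1 : ∀ {a b x y D k s l t} → 1 < a → 1 < b → 0 < x → 0 < y → 1 < k → 0 < s → 0 < l → 0 < t →
  a ^ x ≡ D * 2 → b ^ y ≡ D → 3 ^ k ≡ 1 + 2 ^ k * a ^ s → 3 ^ l ≡ 2 ^ l + b ^ t → ⊥
gap-2-1 {a} {b} {x} {y} {D} {k} {s} {l} {t} a>1 b>1 x>0 y>0 k>1 s>0 l>0 t>0 ea eb ek el =
  <⇒≢ (1<^ b>1 y>0) (sym (trans eb D≡1))
  where
  2∣a : 2 ∣ a
  2∣a = prime-∣^ prime[2] a x (subst (2 ∣_) (sym ea) (n∣m*n D))
  b-odd : Odd b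
  b-odd d = odd-^ l (1+2*-odd 1) (subst (2 ∣_) (sym el) (∣m∣n⇒∣m+n (base∣^ 2 l>0) (∣-trans d (base∣^ b t>0))))
  a≡2 : a ≡ 2
  a≡2 = ≤-antisym (∣-≤ (s≤s z≤n) (subst (a ∣_) (3^k≡1+2^k*a^s {a} {k} {s} 2∣a k>1 s>0 ek) (base∣^ a s>0))) a>1
  D≡1 : D ≡ 1
  D≡1 = odd∣2^⇒1 x (subst Odd eb (odd-^ y b-odd)) (divides 2 (trans (cong (_^ x) (sym a≡2)) (trans ea (*-comm D 2))))

-- Comparing the two descriptions of (a^x, b^y, c^z) leaves only (1, 1, 2), (2, 1, 3), (1, 2, 3) times D.
lifted-both : ∀ {a b c x y z x₂ y₃ k l} → 1 < a → 1 < b → 0 < x → 0 < y → 1 < k → 1 < l →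
  Lifted a (b ^ y) (c ^ z) x k x₂ → Lifted b (a ^ x) (c ^ z) y l y₃ →
  SameSol a b c (l * x , y₃ , l * z) (x₂ , k * y , k * z)
lifted-both {a} {b} {c} {x} {y} {z} {x₂} {y₃} {k} {l} a>1 b>1 x>0 y>0 k>1 l>1
  (lifted D d δ s d>0 s>0 δ-small cdδ B≡ C≡ A≡ x₂≡ diff) (lifted D′ d′ δ′ t _ t>0 δ′-small cdδ′ A≡′ C≡′ B≡′ y₃≡ diff′) =
  compare D′≡ (cancelˡ D>0 (trans (sym A≡) (trans A≡′ (cong (_* d′) (sym D′≡))))) (cancelˡ D>0 (trans (sym B≡) (trans B≡′ (cong (_* δ′) (sym D′≡)))))
    δ-small δ′-small
  where
  D>0 : 0 < D
  D>0 = *-pos⁻¹ˡ (subst (0 <_) B≡ (^-pos y (<-trans (s≤s z≤n) b>1)))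
  D′≡ : D ≡ D′
  D′≡ = coprime-gcd-unique {D} {δ} {d + δ} {D′} {d′} {d′ + δ′}
    (λ {i} (e , f) → cdδ (∣m+n∣m⇒∣n (subst (i ∣_) (+-comm d δ) f) e , e)) (coprime-+ʳ cdδ′) (trans (sym A≡) A≡′) (trans (sym C≡) C≡′)
  unit : ∀ n u → 1 ^ n * u ≡ u
  unit n u = trans (cong (_* u) (^-zeroˡ n)) (*-identityˡ u)
  compare : D ≡ D′ → δ ≡ d′ → d ≡ δ′ → δ ≡ 1 ⊎ δ ≡ 2 → δ′ ≡ 1 ⊎ δ′ ≡ 2 →
    SameSol a b c (l * x , y₃ , l * z) (x₂ , k * y , k * z)
  compare refl refl refl (inj₂ refl) (inj₂ refl) = ⊥-elim (<⇒≢ (s≤s (s≤s z≤n)) (sym (cdδ (∣-refl {2} , ∣-refl))))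
  compare refl refl refl (inj₂ refl) (inj₁ refl) = ⊥-elim (gap-2-1 {a} {b} {x} {y} {D} {k} {s} {l} {t} a>1 b>1 x>0 y>0 k>1 s>0 (<-trans (s≤s z≤n) l>1) t>0
    A≡ (trans B≡ (*-identityʳ D)) (trans diff (cong (_+ 2 ^ k * a ^ s) (^-zeroˡ k))) (trans diff′ (cong (2 ^ l +_) (unit l (b ^ t)))))
  compare refl refl refl (inj₁ refl) (inj₂ refl) = ⊥-elim (gap-2-1 {b} {a} {y} {x} {D} {l} {t} {k} {s} b>1 a>1 y>0 x>0 l>1 t>0 (<-trans (s≤s z≤n) k>1) s>0
    B≡ (trans A≡ (*-identityʳ D)) (trans diff′ (cong (_+ 2 ^ l * b ^ t) (^-zeroˡ l))) (trans diff (cong (2 ^ k +_) (unit k (a ^ s)))))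
  -- No contradiction is available here: `a ^ x = b ^ y = D`, both `a` and `b` are one less than a
  -- power of 2, and so `a = b`. The third solution is the second with its terms exchanged.
  compare refl refl refl (inj₁ refl) (inj₁ refl) = inj₂ (a-side , b-side)
    where
    mersenne : ∀ {a s k} → 2 ^ k ≡ 1 ^ k + 1 ^ k * a ^ s → a ^ s + 1 ≡ 2 ^ k
    mersenne {a} {s} {k} f = trans (+-comm (a ^ s) 1) (sym (trans f (cong₂ _+_ (^-zeroˡ k) (unit k (a ^ s)))))
    s≡1 : s ≡ 1
    s≡1 = power-of-two-minus-one {a} {s} {k} a>1 s>0 (mersenne {a} {s} {k} diff)
    t≡1 : t ≡ 1
    t≡1 = power-of-two-minus-one {b} {t} {l} b>1 t>0 (mersenne {b} {t} {l} diff′)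
    a+1≡ : a + 1 ≡ 2 ^ k
    a+1≡ = trans (cong (_+ 1) (trans (sym (*-identityʳ a)) (cong (a ^_) (sym s≡1)))) (mersenne {a} {s} {k} diff)
    b+1≡ : b + 1 ≡ 2 ^ l
    b+1≡ = trans (cong (_+ 1) (trans (sym (*-identityʳ b)) (cong (b ^_) (sym t≡1)))) (mersenne {b} {t} {l} diff′)
    k≡l : k ≡ l
    k≡l = dependent-mersenne {a} {b} {k} {l} x y a>1 b>1 k>1 l>1 x>0 a+1≡ b+1≡ (trans A≡ (sym B≡))
    a≡b : a ≡ b
    a≡b = +-cancelʳ-≡ 1 a b (trans a+1≡ (trans (cong (2 ^_) k≡l) (sym b+1≡)))
    a-side : a ^ (l * x) ≡ b ^ (k * y)
    a-side = trans (sym (lifted-power {a} {x} l A≡)) (trans (cong ((D * 1) ^_) (sym k≡l)) (lifted-power {b} {y} k B≡))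
    b-side : b ^ y₃ ≡ a ^ x₂
    b-side = begin
      b ^ y₃                   ≡⟨ cong (b ^_) y₃≡ ⟩
      b ^ (l * y + t)          ≡⟨ ^-distribˡ-+-* b (l * y) t ⟩
      b ^ (l * y) * b ^ t      ≡⟨ cong₂ _*_ (sym (lifted-power {b} {y} l B≡)) (cong₂ _^_ (sym a≡b) (trans t≡1 (sym s≡1))) ⟩
      (D * 1) ^ l * a ^ s      ≡⟨ cong (λ n → (D * 1) ^ n * a ^ s) (sym k≡l) ⟩
      (D * 1) ^ k * a ^ s      ≡⟨ cong (_* a ^ s) (lifted-power {a} {x} k A≡) ⟩
      a ^ (k * x) * a ^ s      ≡⟨ sym (^-distribˡ-+-* a (k * x) s) ⟩
      a ^ (k * x + s)          ≡⟨ cong (a ^_) (sym x₂≡) ⟩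
      a ^ x₂                   ∎
      where open ≡-Reasoning

-- Third solutions at an odd prime and at the prime 2

positive-exact-power : ∀ {p n} → Prime p → 0 < n → p ∣ n → ∃[ k ] ∃[ m ] (0 < k × n ≡ p ^ k * m × ¬ (p ∣ m))
positive-exact-power {p} {n} pp n>0 d with exact-power p (prime>1 pp) n n>0
... | zero , m , e , h = ⊥-elim (h (subst (p ∣_) (trans e (*-identityˡ m)) d))
... | suc k , m , e , h = suc k , m , s≤s z≤n , e , h

make-Local : ∀ {a b c p} → 0 < a → 0 < b → 0 < c → Prime p → p ∣ a → p ∣ b → p ∣ c → ∃[ L ] Local.p {a} {b} {c} L ≡ p
make-Local {p = p} a>0 b>0 c>0 pp da db dc with positive-exact-power pp a>0 da | positive-exact-power pp b>0 db | positive-exact-power pp c>0 dc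
... | α , a′ , α>0 , a≡ , ha | β , b′ , β>0 , b≡ , hb | γ , c′ , γ>0 , c≡ , hc =
  local p pp α β γ a′ b′ c′ α>0 β>0 γ>0 a≡ b≡ c≡ ha hb hc , refl

odd-prime-∤2 : ∀ {p δ} → Prime p → Odd p → δ ≡ 1 ⊎ δ ≡ 2 → ¬ (p ∣ δ)
odd-prime-∤2 pp op (inj₁ refl) d = <⇒≢ (prime>1 pp) (sym (∣1⇒≡1 d))
odd-prime-∤2 pp op (inj₂ refl) d with prime-∣-prime pp prime[2] d
... | refl = op ∣-refl

-- An odd `p` does not divide `δ ≤ 2`. By `difference` it divides `d` exactly when it divides
-- `d + δ`, hence neither. All three terms therefore have the valuation of `D`.
lifted-type-O : ∀ {a b c x y z k x₂} (L : Local a b c) → Odd (Local.p L) → 0 < a → 0 < k → Lifted a (b ^ y) (c ^ z) x k x₂ →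
  let open Local L in α * x ≡ β * y × β * y ≡ γ * z
lifted-type-O {a} {b} {c} {x} {y} {z} {k} (local p pp α β γ a′ b′ c′ α>0 _ _ a≡ b≡ c≡ ha hb hc) op a>0 k>0
  (lifted D d δ s d>0 s>0 δ-small cdδ B≡ C≡ A≡ _ diff)
  with exact-power p (prime>1 pp) D (*-pos⁻¹ˡ (subst (0 <_) A≡ (^-pos x a>0)))
... | e , D′ , refl , hD = trans αx (sym βy) , trans βy (sym γz)
  where
  p∣a^s : p ∣ a ^ s
  p∣a^s = ∣-trans (subst (p ∣_) (sym a≡) (∣m⇒∣m*n a′ (base∣^ p α>0))) (base∣^ a s>0)
  p∤δ : ¬ (p ∣ δ)
  p∤δ = odd-prime-∤2 pp op δ-small
  p∤d : ¬ (p ∣ d)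
  p∤d h = p∤δ (∣m+n∣m⇒∣n (prime-∣^ pp (d + δ) k (subst (p ∣_) (sym diff)
    (∣m∣n⇒∣m+n (∣-trans h (base∣^ d k>0)) (∣n⇒∣m*n (δ ^ k) p∣a^s)))) h)
  p∤d+δ : ¬ (p ∣ d + δ)
  p∤d+δ h = p∤d (prime-∣^ pp d k (∣m+n∣m⇒∣n (subst (p ∣_) (trans diff (+-comm (d ^ k) _))
    (∣-trans h (base∣^ (d + δ) k>0))) (∣n⇒∣m*n (δ ^ k) p∣a^s)))
  ∤-* : ∀ {m n} → ¬ (p ∣ m) → ¬ (p ∣ n) → ¬ (p ∣ m * n)
  ∤-* {m} {n} hm hn h with euclidsLemma m n pp h
  ... | inj₁ f = hm f
  ... | inj₂ f = hn f
  compare : ∀ {u α u′ v} n → u ≡ p ^ α * u′ → ¬ (p ∣ u′) → ¬ (p ∣ v) → u ^ n ≡ p ^ e * D′ * v → α * n ≡ e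
  compare {u} {α} {u′} {v} n u≡ hu hv f = proj₁ (exact-power-unique (prime>1 pp) (α * n) e (∤-^ pp hu n) (∤-* hD hv)
    (trans (sym (local-power p α u′ n u≡)) (trans f (*-assoc (p ^ e) D′ v))))
  αx : α * x ≡ e
  αx = compare {a} {α} {a′} {δ} x a≡ ha p∤δ A≡
  βy : β * y ≡ e
  βy = compare {b} {β} {b′} {d} y b≡ hb p∤d B≡
  γz : γ * z ≡ e
  γz = compare {c} {γ} {c′} {d + δ} z c≡ hc p∤d+δ C≡

odd-prime-cover : ∀ {a b c x₁ y₁ z₁ x₂ k} → 1 < a → 1 < b → (L : Local a b c) → Odd (Local.p L) → 1 < k →
  Sol a b c (x₁ , y₁ , z₁) → Sol a b c (x₂ , k * y₁ , k * z₁) → Lifted a (b ^ y₁) (c ^ z₁) x₁ k x₂ →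
  ∀ s → Sol a b c s → SameSol a b c s (x₁ , y₁ , z₁) ⊎ SameSol a b c s (x₂ , k * y₁ , k * z₁)
odd-prime-cover {a} {b} {c} {x₁} {y₁} {z₁} {x₂} {k} a>1 b>1 L op k>1 σ₁ σ₂ L₁₂ (x₃ , y₃ , z₃) σ₃
  with lifted-type-O {z = z₁} L op (<-trans (s≤s z≤n) a>1) (<-trans (s≤s z≤n) k>1) L₁₂
... | αx₁≡ , βy₁≡ = cases (local-type L (x₃ , y₃ , z₃) σ₃)
  where
  open Local L
  prop₁₂ : y₁ * (k * z₁) ≡ k * y₁ * z₁
  prop₁₂ = lemma y₁ k z₁
    where
    lemma : ∀ y k z → y * (k * z) ≡ k * y * z
    lemma = solve-∀
  y₁<ky₁ : y₁ < k * y₁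
  y₁<ky₁ = subst (y₁ <_) (*-comm y₁ k) (m<m*n y₁ k {{>-nonZero (proj₁ (proj₂ σ₁))}} k>1)
  -- If the third solution were the smaller one, the surplus `t` would make `β * y₁` exceed
  -- `α * x₁`, against type O of the first.
  lower : ∀ {l} t → x₁ ≡ l * x₃ → y₁ ≡ l * y₃ + t → 0 < t → α * x₃ ≤ β * y₃ → ⊥
  lower {l} t ex ey t>0 h = <⇒≢ (begin-strict
    α * x₁                ≡⟨ cong (α *_) ex ⟩
    α * (l * x₃)          ≡⟨ lemma α l x₃ ⟩
    l * (α * x₃)          ≤⟨ *-monoʳ-≤ l h ⟩
    l * (β * y₃)          <⟨ m<m+n (l * (β * y₃)) (*-pos β>0 t>0) ⟩
    l * (β * y₃) + β * t  ≡⟨ lemma′ l β y₃ t ⟩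
    β * (l * y₃ + t)      ≡⟨ cong (β *_) (sym ey) ⟩
    β * y₁                ∎) αx₁≡
    where
    open ≤-Reasoning
    lemma : ∀ a b c → a * (b * c) ≡ b * (a * c)
    lemma = solve-∀
    lemma′ : ∀ l b y t → l * (b * y) + b * t ≡ b * (l * y + t)
    lemma′ = solve-∀
  cases : WeakA L (x₃ , y₃ , z₃) ⊎ WeakB L (x₃ , y₃ , z₃) ⊎ StrictC L (x₃ , y₃ , z₃) →
    SameSol a b c (x₃ , y₃ , z₃) (x₁ , y₁ , z₁) ⊎ SameSol a b c (x₃ , y₃ , z₃) (x₂ , k * y₁ , k * z₁)
  cases (inj₁ (A≡ , _)) = proportional-cover a>1 b>1 σ₁ σ₂ σ₃ prop₁₂ y₁<ky₁ (cross-≡ {β} {γ} {y₁} {z₁} {y₃} {z₃} β>0 γ>0 βy₁≡ A≡)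
  cases (inj₂ (inj₂ C)) = ⊥-elim (strictC-weakA L (x₃ , y₃ , z₃) (x₁ , y₁ , z₁) σ₃ σ₁ C (βy₁≡ , ≤-reflexive (sym αx₁≡)))
  cases (inj₂ (inj₁ (B≡ , B≤))) = by-x (<-cmp x₁ x₃)
    where
    prop₁₃ : x₁ * z₃ ≡ x₃ * z₁
    prop₁₃ = cross-≡ {α} {γ} {x₁} {z₁} {x₃} {z₃} α>0 γ>0 (trans αx₁≡ βy₁≡) B≡
    σ₁′ : Sol b a c (y₁ , x₁ , z₁)
    σ₁′ = swap-Sol (x₁ , y₁ , z₁) σ₁
    σ₃′ : Sol b a c (y₃ , x₃ , z₃)
    σ₃′ = swap-Sol (x₃ , y₃ , z₃) σ₃
    by-x : _ → SameSol a b c (x₃ , y₃ , z₃) (x₁ , y₁ , z₁) ⊎ SameSol a b c (x₃ , y₃ , z₃) (x₂ , k * y₁ , k * z₁)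
    by-x (tri≈ _ refl _) = inj₁ (swap-SameSol {b} {a} {c} (y₃ , x₃ , z₃) (y₁ , x₃ , z₁) (same-y {x₁ = y₃} {y₁} σ₃′ σ₁′ (sym prop₁₃)))
    by-x (tri< x₁<x₃ _ _) with proportional-bc b>1 a>1 σ₁′ σ₃′ prop₁₃ x₁<x₃
    ... | l , l>1 , refl , refl , L₁₃ = inj₂ (lifted-both {a} {b} {c} {x₁} {y₁} {z₁} a>1 b>1 (proj₁ σ₁) (proj₁ (proj₂ σ₁)) k>1 l>1 L₁₂ L₁₃)
    by-x (tri> _ _ x₃<x₁) with proportional-bc b>1 a>1 σ₃′ σ₁′ (sym prop₁₃) x₃<x₁
    ... | l , l>1 , ex , _ , lifted _ _ _ t _ t>0 _ _ _ _ _ ey _ = ⊥-elim (lower {l} t ex ey t>0 B≤)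

swapped-same : ∀ {a b c x₁ y₁ z₁ x₂ y₂ z₂} → Sol a b c (x₁ , y₁ , z₁) → Sol a b c (x₂ , y₂ , z₂) → z₁ ≡ z₂ →
  a ^ x₁ ≡ b ^ y₂ → SameSol a b c (x₁ , y₁ , z₁) (x₂ , y₂ , z₂)
swapped-same {a} {b} {c} {x₁} {y₁} {z₁} {x₂} {y₂} (_ , _ , _ , e₁) (_ , _ , _ , e₂) refl h =
  inj₂ (h , +-cancelˡ-≡ (a ^ x₁) (b ^ y₁) (a ^ x₂) (trans e₁ (trans (sym e₂) (trans (+-comm (a ^ x₂) (b ^ y₂)) (cong (_+ a ^ x₂) (sym h))))))

-- At 2 the first term has valuation `1 + u` and the others `u`, so the first solution is strictly
-- of type A. A third one of type B must be treated by itself: dividing out its power of 2 gives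
-- `c′ ^ z₃ = 1 + 2 ^ t * b′ ^ y₃`.
power-of-two-cover : ∀ {i b c x₁ y₁ z₁ x₂ d u r} → 1 < 2 ^ i → 1 < b → 1 < c → 0 < i → 0 < u → 0 < r →
  Sol (2 ^ i) b c (x₁ , y₁ , z₁) → Sol (2 ^ i) b c (x₂ , 2 * y₁ , 2 * z₁) →
  i * x₁ ≡ 1 + u → d + 1 ≡ 2 ^ r → b ^ y₁ ≡ 2 ^ u * d → c ^ z₁ ≡ 2 ^ u * (d + 2) →
  ∀ s → Sol (2 ^ i) b c s → SameSol (2 ^ i) b c s (x₁ , y₁ , z₁) ⊎ SameSol (2 ^ i) b c s (x₂ , 2 * y₁ , 2 * z₁)
power-of-two-cover {i} {b} {c} {x₁} {y₁} {z₁} {x₂} {d} {u} {r} a>1 b>1 c>1 i>0 u>0 r>0 σ₁ σ₂ ix₁≡ d+1≡ eb ec (x₃ , y₃ , z₃) σ₃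
  with positive-exact-power {2} {b} prime[2] (<-trans (s≤s z≤n) b>1) (prime-∣^ prime[2] b y₁ (subst (2 ∣_) (sym eb) (∣m⇒∣m*n d (base∣^ 2 u>0))))
     | positive-exact-power {2} {c} prime[2] (<-trans (s≤s z≤n) c>1) (prime-∣^ prime[2] c z₁ (subst (2 ∣_) (sym ec) (∣m⇒∣m*n (d + 2) (base∣^ 2 u>0))))
... | β , b′ , β>0 , b≡ , ob | γ , c′ , γ>0 , c≡ , oc = cases (local-type L (x₃ , y₃ , z₃) σ₃)
  where
  L : Local (2 ^ i) b c
  L = local 2 prime[2] i β γ 1 b′ c′ i>0 β>0 γ>0 (sym (*-identityʳ (2 ^ i))) b≡ c≡ (1+2*-odd 0) ob oc
  y₁>0 : 0 < y₁
  y₁>0 = proj₁ (proj₂ σ₁)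
  z₁>0 : 0 < z₁
  z₁>0 = proj₁ (proj₂ (proj₂ σ₁))
  z₃>0 : 0 < z₃
  z₃>0 = proj₁ (proj₂ (proj₂ σ₃))
  y₃>0 : 0 < y₃
  y₃>0 = proj₁ (proj₂ σ₃)
  Goal : Set
  Goal = SameSol (2 ^ i) b c (x₃ , y₃ , z₃) (x₁ , y₁ , z₁) ⊎ SameSol (2 ^ i) b c (x₃ , y₃ , z₃) (x₂ , 2 * y₁ , 2 * z₁)
  d-odd : Odd d
  d-odd h = 1+2*-odd 0 (∣m+n∣m⇒∣n (subst (2 ∣_) (sym d+1≡) (base∣^ 2 r>0)) h)
  d+2-odd : Odd (d + 2)
  d+2-odd h = d-odd (∣m+n∣m⇒∣n (subst (2 ∣_) (+-comm d 2) h) ∣-refl)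
  b-data : β * y₁ ≡ u × b′ ^ y₁ ≡ d
  b-data = exact-power-unique {2} (s≤s (s≤s z≤n)) (β * y₁) u (odd-^ y₁ ob) d-odd (trans (sym (local-power 2 β b′ y₁ b≡)) eb)
  c-data : γ * z₁ ≡ u × c′ ^ z₁ ≡ d + 2
  c-data = exact-power-unique {2} (s≤s (s≤s z≤n)) (γ * z₁) u (odd-^ z₁ oc) d+2-odd (trans (sym (local-power 2 γ c′ z₁ c≡)) ec)
  βy₁≡γz₁ : β * y₁ ≡ γ * z₁
  βy₁≡γz₁ = trans (proj₁ b-data) (sym (proj₁ c-data))
  c′^z₁≡ : c′ ^ z₁ ≡ 1 + 2 ^ r
  c′^z₁≡ = trans (proj₂ c-data) (trans (lemma d) (cong suc d+1≡))
    where
    lemma : ∀ d → d + 2 ≡ 1 + (d + 1)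
    lemma = solve-∀
  c′>1 : 1 < c′
  c′>1 = ≰⇒> λ h → <⇒≱ (s≤s (^-pos r (s≤s z≤n))) (subst (_≤ 1) c′^z₁≡ (subst (c′ ^ z₁ ≤_) (^-zeroˡ z₁) (^-monoˡ-≤ z₁ h)))
  type-B : ∀ t → i * x₃ ≡ γ * z₃ → β * y₃ ≡ i * x₃ + t → c′ ^ z₃ ≡ 1 + 2 ^ t * b′ ^ y₃ → Goal
  type-B t B≡ βy₃≡ e = by-r (1 <? r)
    where
    t>0 : 0 < t
    t>0 = n≢0⇒n>0 λ { refl → odd-^ z₃ oc (subst (2 ∣_) (sym (trans e (cong suc (*-identityˡ (b′ ^ y₃))))) (odd+odd (1+2*-odd 0) (odd-^ y₃ ob))) }
    -- Strict type B in terms of exponents. For `y₁ = z₁ = 1` it is the size condition `z < y` of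
    -- `no-type-B-solution`.
    z₃y₁<y₃z₁ : z₃ * y₁ < y₃ * z₁
    z₃y₁<y₃z₁ = *-cancelˡ-< (β * γ) (z₃ * y₁) (y₃ * z₁) (begin-strict
      β * γ * (z₃ * y₁)     ≡⟨ lemma β γ z₃ y₁ ⟩
      γ * z₃ * (β * y₁)     <⟨ *-monoˡ-< (β * y₁) {{>-nonZero (*-pos β>0 y₁>0)}} (subst₂ _<_ B≡ (sym βy₃≡) (m<m+n (i * x₃) t>0)) ⟩
      β * y₃ * (β * y₁)     ≡⟨ cong (β * y₃ *_) βy₁≡γz₁ ⟩
      β * y₃ * (γ * z₁)     ≡⟨ lemma′ β y₃ γ z₁ ⟩
      β * γ * (y₃ * z₁)     ∎)
      where
      open ≤-Reasoning
      lemma : ∀ b g z y → b * g * (z * y) ≡ g * z * (b * y)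
      lemma = solve-∀
      lemma′ : ∀ b y g z → b * y * (g * z) ≡ b * g * (y * z)
      lemma′ = solve-∀
    -- For `r = 1` one has `d = b′ = 1` and `c′ = 3`; then `3 ^ z₃ = 1 + 2 ^ t` leaves `z₃` equal to
    -- 1 or 2, a known solution with exchanged terms. For `r > 1` the base `b′` is `2 ^ r - 1`, and
    -- `c′` is `2 ^ r + 1` or its square root 3.
    by-r : Dec (1 < r) → Goal
    by-r (no h) = small (power-minus-one {c′} {z₁} {r} c′>1 oc z₁>0 c′^z₁≡)
      where
      r≡1 : r ≡ 1
      r≡1 = ≤-antisym (≮⇒≥ h) r>0
      d≡1 : d ≡ 1
      d≡1 = +-cancelʳ-≡ 1 d 1 (trans d+1≡ (cong (2 ^_) r≡1))
      b′≡1 : b′ ≡ 1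
      b′≡1 with m^n≡1⇒n≡0∨m≡1 b′ y₁ (trans (proj₂ b-data) d≡1)
      ... | inj₁ f = ⊥-elim (<⇒≢ y₁>0 (sym f))
      ... | inj₂ f = f
      match : ∀ n → z₃ ≡ n * z₁ → (2 ^ i) ^ x₃ ≡ b ^ (n * y₁)
      match n f = begin
        (2 ^ i) ^ x₃       ≡⟨ ^-*-assoc 2 i x₃ ⟩
        2 ^ (i * x₃)       ≡⟨ cong (2 ^_) (trans B≡ (cong (γ *_) f)) ⟩
        2 ^ (γ * (n * z₁)) ≡⟨ cong (2 ^_) (trans (lemma γ n z₁) (cong (_* n) (proj₁ c-data))) ⟩
        2 ^ (u * n)        ≡⟨ sym (^-*-assoc 2 u n) ⟩
        (2 ^ u) ^ n        ≡⟨ lifted-power {b} {y₁} n (trans eb (trans (cong (2 ^ u *_) d≡1) (*-identityʳ (2 ^ u)))) ⟩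
        b ^ (n * y₁)       ∎
        where
        open ≡-Reasoning
        lemma : ∀ g n z → g * (n * z) ≡ g * z * n
        lemma = solve-∀
      finish : z₁ ≡ 1 → z₃ ≡ 1 ⊎ z₃ ≡ 2 → Goal
      finish z₁≡1 (inj₁ f) = inj₁ (swapped-same σ₃ σ₁ (trans f (sym z₁≡1))
        (trans (match 1 (trans f (sym (trans (*-identityˡ z₁) z₁≡1)))) (cong (b ^_) (*-identityˡ y₁))))
      finish z₁≡1 (inj₂ f) = inj₂ (swapped-same σ₃ σ₂ (trans f (cong (2 *_) (sym z₁≡1))) (match 2 (trans f (cong (2 *_) (sym z₁≡1)))))
      small : z₁ ≡ 1 ⊎ (z₁ ≡ 2 × c′ ≡ 3) → Goal
      small (inj₂ (f , g)) = ⊥-elim (9≢3 (trans (sym (cong₂ _^_ g f)) (trans c′^z₁≡ (cong (λ k → 1 + 2 ^ k) r≡1))))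
        where
        9≢3 : 9 ≢ 3
        9≢3 ()
      small (inj₁ z₁≡1) = finish z₁≡1 (third (power-minus-one {3} {z₃} {t} (s≤s (s≤s z≤n)) (1+2*-odd 1) z₃>0
        (trans (cong (_^ z₃) (sym c′≡3)) (trans e (cong suc (trans (cong (λ w → 2 ^ t * w ^ y₃) b′≡1) (trans (cong (2 ^ t *_) (^-zeroˡ y₃)) (*-identityʳ (2 ^ t)))))))))
        where
        c′≡3 : c′ ≡ 3
        c′≡3 = trans (sym (*-identityʳ c′)) (trans (cong (c′ ^_) (sym z₁≡1)) (trans c′^z₁≡ (cong (λ k → 1 + 2 ^ k) r≡1)))
        third : z₃ ≡ 1 ⊎ (z₃ ≡ 2 × 3 ≡ 3) → z₃ ≡ 1 ⊎ z₃ ≡ 2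
        third (inj₁ f) = inj₁ f
        third (inj₂ (f , _)) = inj₂ f
    by-r (yes r>1) = ⊥-elim (contradict (power-minus-one {c′} {z₁} {r} c′>1 oc z₁>0 c′^z₁≡))
      where
      b′>1 : 1 < b′
      b′>1 = ≰⇒> λ h → <⇒≱ (^-monoʳ-< 2 (s≤s (s≤s z≤n)) r>1) (subst (_≤ 2) d+1≡
        (+-monoˡ-≤ 1 (subst (_≤ 1) (proj₂ b-data) (subst (b′ ^ y₁ ≤_) (^-zeroˡ y₁) (^-monoˡ-≤ y₁ h)))))
      y₁≡1 : y₁ ≡ 1
      y₁≡1 = power-of-two-minus-one {b′} {y₁} {r} b′>1 y₁>0 (trans (cong (_+ 1) (proj₂ b-data)) d+1≡)
      b′≡d : b′ ≡ d
      b′≡d = trans (sym (*-identityʳ b′)) (trans (cong (b′ ^_) (sym y₁≡1)) (proj₂ b-data))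
      contradict : z₁ ≡ 1 ⊎ (z₁ ≡ 2 × c′ ≡ 3) → ⊥
      contradict (inj₁ z₁≡1) = no-type-B-solution {d} {r} {z₃} {y₃} {t} r>1 d+1≡ z₃>0
        (subst₂ _<_ (trans (cong (z₃ *_) y₁≡1) (*-identityʳ z₃)) (trans (cong (y₃ *_) z₁≡1) (*-identityʳ y₃)) z₃y₁<y₃z₁)
        (subst₂ (λ C B → C ^ z₃ ≡ 1 + 2 ^ t * B ^ y₃) (trans (sym (*-identityʳ c′)) (trans (cong (c′ ^_) (sym z₁≡1)) (proj₂ c-data))) b′≡d e)
      -- Here `d = 7` and `d + 2 = 9`. An even `z₃` is rewritten in base 9, and an odd one is
      -- impossible modulo 7.
      contradict (inj₂ (z₁≡2 , c′≡3)) = parity (2 ∣? z₃)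
        where
        d≡7 : d ≡ 7
        d≡7 = +-cancelʳ-≡ 2 d 7 (trans (sym (proj₂ c-data)) (cong₂ _^_ c′≡3 z₁≡2))
        e′ : 3 ^ z₃ ≡ 1 + 2 ^ t * 7 ^ y₃
        e′ = subst₂ (λ C B → C ^ z₃ ≡ 1 + 2 ^ t * B ^ y₃) c′≡3 (trans b′≡d d≡7) e
        z₃<2y₃ : z₃ < y₃ * 2
        z₃<2y₃ = subst₂ _<_ (trans (cong (z₃ *_) y₁≡1) (*-identityʳ z₃)) (cong (y₃ *_) z₁≡2) z₃y₁<y₃z₁
        parity : Dec (2 ∣ z₃) → ⊥
        parity (yes (divides z f)) = no-type-B-solution {7} {r} {z} {y₃} {t} r>1 (trans (cong (_+ 1) (sym d≡7)) d+1≡) (*-pos⁻¹ˡ (subst (0 <_) f z₃>0))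
          (*-cancelʳ-< 2 z y₃ (subst (_< y₃ * 2) f z₃<2y₃))
          (trans (^-*-assoc 3 2 z) (trans (cong (3 ^_) (trans (*-comm 2 z) (sym f))) e′))
        parity (no h) with odd⇒1+2* z₃ h | ∣n⇒∣m*n (2 ^ t) (base∣^ 7 y₃>0)
        ... | j , g | divides q k = 3^odd≢1-mod-7 j {q} (trans (cong (3 ^_) (sym g)) (trans e′ (cong suc (trans k (*-comm q 7)))))
  cases : WeakA L (x₃ , y₃ , z₃) ⊎ WeakB L (x₃ , y₃ , z₃) ⊎ StrictC L (x₃ , y₃ , z₃) → Goal
  cases (inj₁ (A≡ , _)) = proportional-cover a>1 b>1 σ₁ σ₂ σ₃ (lemma y₁ z₁) (m<m+n y₁ (≤-trans y₁>0 (m≤m+n y₁ 0)))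
      (cross-≡ {β} {γ} {y₁} {z₁} {y₃} {z₃} β>0 γ>0 βy₁≡γz₁ A≡)
    where
    lemma : ∀ y z → y * (2 * z) ≡ 2 * y * z
    lemma = solve-∀
  cases (inj₂ (inj₂ C)) = ⊥-elim (strictC-weakA L (x₃ , y₃ , z₃) (x₁ , y₁ , z₁) σ₃ σ₁ C
    (βy₁≡γz₁ , subst₂ _≤_ (sym (proj₁ b-data)) (sym ix₁≡) (n≤1+n u)))
  cases (inj₂ (inj₁ B@(B≡ , _))) with weakA-reduce (swap-Local L) y₃ x₃ z₃ (swap-Sol (x₃ , y₃ , z₃) σ₃) B
  ... | t , βy₃≡ , e = type-B t B≡ βy₃≡ (trans (sym e) (trans (cong (2 ^ t * b′ ^ y₃ +_) (^-zeroˡ x₃)) (+-comm _ 1)))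

-- Classification from a pair of solutions of a common type

bc-classified : ∀ {a b c x₁ y₁ z₁ x₂ y₂ z₂} → 1 < a → 1 < b → 1 < c → 1 < gcd a b →
  Sol a b c (x₁ , y₁ , z₁) → Sol a b c (x₂ , y₂ , z₂) → y₁ * z₂ ≡ y₂ * z₁ → y₁ < y₂ → Classified a b c
bc-classified {a} {b} {c} {x₁} {y₁} {z₁} {x₂} a>1 b>1 c>1 gcd>1 σ₁ σ₂ prop y₁<y₂ with proportional-bc a>1 b>1 σ₁ σ₂ prop y₁<y₂
... | k , k>1 , refl , refl , L@(lifted D d δ s d>0 s>0 δ-small cdδ B≡ C≡ A≡ refl diff) = by-δ δ-small
  where
  x₁>0 : 0 < x₁
  x₁>0 = proj₁ σ₁
  a>0 : 0 < a
  a>0 = <-trans (s≤s z≤n) a>1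
  b>0 : 0 < b
  b>0 = <-trans (s≤s z≤n) b>1
  c>0 : 0 < c
  c>0 = <-trans (s≤s z≤n) c>1
  s₁ s₂ : Triple
  s₁ = x₁ , y₁ , z₁
  s₂ = k * x₁ + s , k * y₁ , k * z₁
  distinct : ¬ SameSol a b c s₁ s₂
  distinct h = <⇒≢ (subst (z₁ <_) (*-comm z₁ k) (m<m*n z₁ k {{>-nonZero (proj₁ (proj₂ (proj₂ σ₁)))}} k>1)) (SameSol⇒z≡ c>1 σ₁ σ₂ h)
  cover : ∀ p → Prime p → Odd p → p ∣ a → ∀ t → Sol a b c t → SameSol a b c t s₁ ⊎ SameSol a b c t s₂
  cover p pp op p∣a with make-Local a>0 b>0 c>0 pp p∣a
      (prime-∣^ pp b y₁ (subst (p ∣_) (sym B≡) (∣m⇒∣m*n d p∣D))) (prime-∣^ pp c z₁ (subst (p ∣_) (sym C≡) (∣m⇒∣m*n (d + δ) p∣D)))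
    where
    -- An odd prime of `a` divides `D * δ` with `δ ≤ 2`. It therefore divides `D`, and through `D`
    -- also `b` and `c`, as a `Local` requires.
    p∣D : p ∣ D
    p∣D with euclidsLemma D δ pp (subst (p ∣_) A≡ (∣-trans p∣a (base∣^ a x₁>0)))
    ... | inj₁ h = h
    ... | inj₂ h = ⊥-elim (odd-prime-∤2 pp op δ-small h)
  ... | M , refl = odd-prime-cover a>1 b>1 M op k>1 σ₁ σ₂ L
  by-δ : δ ≡ 1 ⊎ δ ≡ 2 → Classified a b c
  by-δ (inj₁ refl) with prime-factor a a>1
  ... | p , pp , p∣a = classified s₁ s₂ σ₁ σ₂ distinct (cover p pp (∣-odd a-odd p∣a) p∣a)
      (inj₂ (inj₂ (inj₁ (familyIII {a} {b} {c} {x₁} {y₁} {z₁} {k} {s} {D} {d} a>1 x₁>0 k>1 s>0 d>0 B≡ (trans A≡ (*-identityʳ D)) diff′))))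
    where
    diff′ : (d + 1) ^ k ≡ d ^ k + a ^ s
    diff′ = trans diff (cong (d ^ k +_) (trans (cong (_* a ^ s) (^-zeroˡ k)) (*-identityˡ (a ^ s))))
    a-odd : Odd a
    a-odd h = consecutive-powers-odd {d} {k} (<-trans (s≤s z≤n) k>1) diff′ (∣-trans h (base∣^ a s>0))
  by-δ (inj₂ refl) with positive-exact-power {2} {a} prime[2] a>0 (prime-∣^ prime[2] a x₁ (subst (2 ∣_) (sym A≡) (n∣m*n D)))
  ... | i , g , i>0 , a≡ , og = by-g (1 <? g)
    where
    d-odd : Odd d
    d-odd h = <⇒≢ (s≤s (s≤s z≤n)) (sym (cdδ (h , ∣-refl)))
    k-even : 2 ∣ k
    k-even = lifted-2-even {d} {k} {a ^ s} d-odd k>1 diff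
    by-g : Dec (1 < g) → Classified a b c
    by-g (yes g>1) with prime-factor g g>1
    ... | p , pp , p∣g = classified s₁ s₂ σ₁ σ₂ distinct
        (cover p pp (∣-odd og p∣g) (subst (p ∣_) (sym a≡) (∣n⇒∣m*n (2 ^ i) p∣g)))
        (inj₂ (inj₂ (inj₂ (familyIV {a} {b} {c} {x₁} {y₁} {z₁} {k} {s} {D} {d} {i} {g} x₁>0 k>1 k-even s>0 d>0 d-odd i>0 g>1 og a≡ B≡ A≡ diff))))
    by-g (no h) = power-of-two (trans a≡ (trans (cong (2 ^ i *_) (≤-antisym (≮⇒≥ h) (odd-pos og))) (*-identityʳ (2 ^ i))))
      where
      ix₁>0 : 0 < i * x₁
      ix₁>0 = *-pos i>0 x₁>0
      u : ℕ
      u = i * x₁ ∸ 1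
      ix₁≡ : i * x₁ ≡ 1 + u
      ix₁≡ = sym (m+[n∸m]≡n ix₁>0)
      power-of-two : a ≡ 2 ^ i → Classified a b c
      power-of-two refl = build (lifted-power-of-two {d} {k} {i * s} d>0 d-odd k-even (<-trans (s≤s z≤n) k>1)
          (trans diff (cong (λ w → d ^ k + 2 ^ k * w) (^-*-assoc 2 i s))))
        where
        D≡ : D ≡ 2 ^ u
        D≡ = cancelʳ {2} (s≤s z≤n) (trans (sym A≡) (trans (^-*-assoc 2 i x₁) (trans (cong (2 ^_) ix₁≡) (*-comm 2 (2 ^ u)))))
        -- This is where `gcd a b > 1` enters: `u = 0` would mean `D = 1`, so `b` would be odd and
        -- coprime to `2 ^ i`.
        u>0 : 0 < u
        u>0 = n≢0⇒n>0 λ u≡0 → <⇒≢ gcd>1 (sym (coprime⇒gcd≡1 {2 ^ i} {b} (λ {n} (e , f) → odd∣2^⇒1 i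
          (∣-odd (subst Odd (sym (trans B≡ (trans (cong (_* d) (trans D≡ (cong (2 ^_) u≡0))) (*-identityˡ d)))) d-odd)
            (∣-trans f (base∣^ b (proj₁ (proj₂ σ₁))))) e)))
        build : k ≡ 2 × d + 1 ≡ 2 ^ (i * s) → Classified (2 ^ i) b c
        build (refl , d+1≡) = classified s₁ s₂ σ₁ σ₂ distinct
          (power-of-two-cover {i} {b} {c} {x₁} {y₁} {z₁} {2 * x₁ + s} {d} {u} {i * s} a>1 b>1 c>1 i>0 u>0 (*-pos i>0 s>0) σ₁ σ₂ ix₁≡ d+1≡
            (trans B≡ (cong (_* d) D≡)) (trans C≡ (cong (_* (d + 2)) D≡)))
          (inj₁ (familyI {a} {b} {c} {x₁} {y₁} {z₁} {s} {d} {i} {u} i>0 s>0 u>0 refl (trans B≡ (cong (_* d) D≡)) ix₁≡ d+1≡))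

-- Equal `y` forces equal `z` by the type and then equal `x` by the equation; otherwise the pair is
-- ordered by `y`. The alternative `s ≡ t` stays in the result because type O compares one fixed
-- solution with two unknown ones.
weakA-classified : ∀ {a b c} → 1 < a → 1 < b → 1 < c → 1 < gcd a b → (L : Local a b c) → ∀ s t →
  Sol a b c s → Sol a b c t → WeakA L s → WeakA L t → s ≡ t ⊎ Classified a b c
weakA-classified {a} {b} {c} a>1 b>1 c>1 gcd>1 L (x₁ , y₁ , z₁) (x₂ , y₂ , z₂) σ τ (A₁ , _) (A₂ , _) with <-cmp y₁ y₂
... | tri< h _ _ = inj₂ (bc-classified a>1 b>1 c>1 gcd>1 σ τ (cross-≡ {β} {γ} {y₁} {z₁} {y₂} {z₂} β>0 γ>0 A₁ A₂) h)
  where open Local L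
... | tri> _ _ h = inj₂ (bc-classified a>1 b>1 c>1 gcd>1 τ σ (cross-≡ {β} {γ} {y₂} {z₂} {y₁} {z₁} β>0 γ>0 A₂ A₁) h)
  where open Local L
... | tri≈ _ refl _ with cancelˡ (Local.γ>0 L) (trans (sym A₁) A₂)
... | refl = inj₁ (cong (λ x → x , y₁ , z₁) (^-cancelʳ-≡ a>1 (+-cancelʳ-≡ (b ^ y₁) (a ^ x₁) (a ^ x₂)
  (trans (proj₂ (proj₂ (proj₂ σ))) (sym (proj₂ (proj₂ (proj₂ τ))))))))

weakB-classified : ∀ {a b c} → 1 < a → 1 < b → 1 < c → 1 < gcd a b → (L : Local a b c) → ∀ s t →
  Sol a b c s → Sol a b c t → WeakB L s → WeakB L t → s ≡ t ⊎ Classified a b c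
weakB-classified {a} {b} {c} a>1 b>1 c>1 gcd>1 L s t σ τ B₁ B₂
  with weakA-classified b>1 a>1 c>1 (subst (1 <_) (gcd-comm a b) gcd>1) (swap-Local L) (swap s) (swap t) (swap-Sol s σ) (swap-Sol t τ) B₁ B₂
... | inj₁ e = inj₁ (cong swap e)
... | inj₂ h = inj₂ (swap-Classified h)

-- From the defined types and sets to local data

ExactPow⇒exact : ∀ {p k n} → 1 < p → ExactPow p k n → ∃[ m ] (n ≡ p ^ k * m × ¬ (p ∣ m))
ExactPow⇒exact {p} {k} p>1 (divides m refl , h) = m , *-comm m (p ^ k) , λ d → h (*-monoˡ-∣ (p ^ k) d)

ExactPow-unique : ∀ {p i j n} → 1 < p → ExactPow p i n → ExactPow p j n → i ≡ j
ExactPow-unique {p} {i} {j} p>1 e f with ExactPow⇒exact {p} {i} p>1 e | ExactPow⇒exact {p} {j} p>1 f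
... | m , g , hm | m′ , g′ , hm′ = proj₁ (exact-power-unique p>1 i j hm hm′ (trans (sym g) g′))

ExactPow-pos : ∀ {p k n} → ExactPow p k n → p ∣ n → 0 < k
ExactPow-pos {p} {zero} {n} (_ , h) d = ⊥-elim (h (subst (_∣ n) (sym (*-identityʳ p)) d))
ExactPow-pos {k = suc k} _ _ = s≤s z≤n

ExactPow⇒Local : ∀ {a b c p α β γ} → InQ a b c p → ExactPow p α a → ExactPow p β b → ExactPow p γ c →
  ∃[ L ] (Local.α {a} {b} {c} L ≡ α × Local.β L ≡ β × Local.γ L ≡ γ)
ExactPow⇒Local {p = p} {α} {β} {γ} (pp , da , db , dc) ea eb ec
  with ExactPow⇒exact {k = α} (prime>1 pp) ea | ExactPow⇒exact {k = β} (prime>1 pp) eb | ExactPow⇒exact {k = γ} (prime>1 pp) ec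
... | a′ , a≡ , ha | b′ , b≡ , hb | c′ , c≡ , hc =
  local p pp α β γ a′ b′ c′ (ExactPow-pos {k = α} ea da) (ExactPow-pos {k = β} eb db) (ExactPow-pos {k = γ} ec dc) a≡ b≡ c≡ ha hb hc , refl , refl , refl

Sc-classified : ∀ {a b c} → 1 < a → 1 < b → 1 < c → Sc a b c → Classified a b c
Sc-classified a>1 b>1 c>1 (_ , many , not-pow2 , s , p , σ , Q , α , β , γ , ea , eb , ec , lt , eq)
  with ExactPow⇒Local {α = α} {β} {γ} Q ea eb ec
... | L , refl , refl , refl = strictC-classified a>1 b>1 c>1 L many not-pow2 s σ (eq , lt)

-- Having both non-strict types, `s` can be paired with `t₁` and `t₂` whatever their types. It
-- cannot equal both, since these are inequivalent.
So-classified : ∀ {a b c} → 1 < a → 1 < b → 1 < c → So a b c → Classified a b c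
So-classified {a} {b} {c} a>1 b>1 c>1 (gcd>1 , (t₁ , t₂ , τ₁ , τ₂ , distinct) , s , p , σ , Q , α , β , γ , ea , eb , ec , eq₁ , eq₂)
  with ExactPow⇒Local {α = α} {β} {γ} Q ea eb ec
... | L , refl , refl , refl = choose (against t₁ τ₁) (against t₂ τ₂)
  where
  A : WeakA L s
  A = eq₂ , ≤-reflexive (sym eq₁)
  B : WeakB L s
  B = trans eq₁ eq₂ , ≤-reflexive eq₁
  against : ∀ t → Sol a b c t → s ≡ t ⊎ Classified a b c
  against t τ with local-type L t τ
  ... | inj₁ A′ = weakA-classified a>1 b>1 c>1 gcd>1 L s t σ τ A A′
  ... | inj₂ (inj₁ B′) = weakB-classified a>1 b>1 c>1 gcd>1 L s t σ τ B B′
  ... | inj₂ (inj₂ C′) = ⊥-elim (strictC-weakA L t s τ σ C′ A)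
  choose : s ≡ t₁ ⊎ Classified a b c → s ≡ t₂ ⊎ Classified a b c → Classified a b c
  choose (inj₂ h) _ = h
  choose (inj₁ _) (inj₂ h) = h
  choose (inj₁ refl) (inj₁ refl) = ⊥-elim (distinct (SameSol-refl {a} {b} {c} s))

Saa-classified : ∀ {a b c} → 1 < a → 1 < b → 1 < c → Saa a b c → Classified a b c
Saa-classified a>1 b>1 c>1 (gcd>1 , s , t , p , σ , τ , s≢t , Q , (α , β , γ , ea , eb , ec , lt , eq) , (α′ , β′ , γ′ , ea′ , eb′ , ec′ , lt′ , eq′))
  -- Each type statement carries its own valuations; they are identified first so that one `Local`
  -- serves both solutions.
  with ExactPow-unique {i = α} {α′} (prime>1 (proj₁ Q)) ea ea′ | ExactPow-unique {i = β} {β′} (prime>1 (proj₁ Q)) eb eb′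
     | ExactPow-unique {i = γ} {γ′} (prime>1 (proj₁ Q)) ec ec′ | ExactPow⇒Local {α = α} {β} {γ} Q ea eb ec
... | refl | refl | refl | L , refl , refl , refl with weakA-classified a>1 b>1 c>1 gcd>1 L s t σ τ (eq , <⇒≤ lt) (eq′ , <⇒≤ lt′)
... | inj₁ s≡t = ⊥-elim (s≢t s≡t)
... | inj₂ h = h

Sbb-classified : ∀ {a b c} → 1 < a → 1 < b → 1 < c → Sbb a b c → Classified a b c
Sbb-classified a>1 b>1 c>1 (gcd>1 , s , t , p , σ , τ , s≢t , Q , (α , β , γ , ea , eb , ec , lt , eq) , (α′ , β′ , γ′ , ea′ , eb′ , ec′ , lt′ , eq′))
  with ExactPow-unique {i = α} {α′} (prime>1 (proj₁ Q)) ea ea′ | ExactPow-unique {i = β} {β′} (prime>1 (proj₁ Q)) eb eb′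
     | ExactPow-unique {i = γ} {γ′} (prime>1 (proj₁ Q)) ec ec′ | ExactPow⇒Local {α = α} {β} {γ} Q ea eb ec
... | refl | refl | refl | L , refl , refl , refl with weakB-classified a>1 b>1 c>1 gcd>1 L s t σ τ (eq , <⇒≤ lt) (eq′ , <⇒≤ lt′)
... | inj₁ s≡t = ⊥-elim (s≢t s≡t)
... | inj₂ h = h

theorem4p3 : (a b c : ℕ) → 1 < a → 1 < b → 1 < c → 1 < gcd a b →
    (Sc a b c ⊎ So a b c ⊎ Saa a b c ⊎ Sbb a b c) →
    NEq a b c 2 ×
    ∃[ s1 ] ∃[ s2 ] (Sol a b c s1 × Sol a b c s2 × s1 ≢ s2 ×
    (InFamily FamI a b c s1 s2 ⊎ InFamily FamII a b c s1 s2 ⊎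
    InFamily FamIII a b c s1 s2 ⊎ InFamily FamIV a b c s1 s2))
theorem4p3 a b c a>1 b>1 c>1 gcd>1 h = Classified⇒conclusion (classify h)
  where
  classify : Sc a b c ⊎ So a b c ⊎ Saa a b c ⊎ Sbb a b c → Classified a b c
  classify (inj₁ S) = Sc-classified a>1 b>1 c>1 S
  classify (inj₂ (inj₁ S)) = So-classified a>1 b>1 c>1 S
  classify (inj₂ (inj₂ (inj₁ S))) = Saa-classified a>1 b>1 c>1 S
  classify (inj₂ (inj₂ (inj₂ S))) = Sbb-classified a>1 b>1 c>1 S
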